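{- Let $n$ be a positive integer with $n\equiv 3\pmod 4$, and let $a,b$ be indeterminates. Then, modulo $[n](1-aq^n)(a-q^n)(1-bq^n)(b-q^n)$, \[ \sum_{k=0}^{n-1}[6k+1]\frac{(aq,q/a;q^2)_k(q^2,b^3q,q/b^3;q^4)_k}{(q^4,q^4/a,aq^4;q^4)_k(q^2/b^3,b^3q^2;q^2)_k}q^{2k} \equiv\frac{(1-aq^n)(a-q^n)(-1-b^2+bq^n)}{(b-a)(1-ba)}\frac{(q^5,aq^2,q^2/a;q^4)_{(3n-1)/4}}{(q,q^4/a,aq^4;q^4)_{(3n-1)/4}} +\frac{(1-bq^n)(b-q^n)(-1-a^2+aq^n)}{(a-b)(1-ab)}\frac{(q^3,b^3,1/b^3;q^4)_{(n+1)/4}}{(1/q,q^2/b^3,b^3q^2;q^4)_{(n+1)/4}}. \]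
   Context: For $x$ and integer $n\ge 0$, $(x;q)_n=\prod_{j=0}^{n-1}(1-xq^j)$, and $(x_1,\dots,x_m;q)_n=(x_1;q)_n\cdots(x_m;q)_n$. $[r]=(1-q^r)/(1-q)$ is the $q$-integer. A congruence modulo a polynomial $P$ in $q,a,b$ between rational functions whose denominators are coprime to $P$ means that the difference is a rational function whose numerator is divisible by $P$ and whose denominator is coprime to $P$. -}

module Defs where

open import Data.Nat as ℕ using (ℕ; zero; suc)
open import Data.Rational as ℚ using (ℚ; 0ℚ; 1ℚ)
open import Data.Rational.Properties using (_≟_)
open import Data.Maybe using (Maybe; just; nothing; _>>=_)
open import Data.Product using (Σ; _×_; _,_)
open import Relation.Nullary using (yes; no; ¬_)
open import Relation.Binary.PropositionalEquality using (_≡_; _≢_)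

data Var : Set where
  vq va vb : Var

Env : Set
Env = Var → ℚ

-- Polynomials in q, a, b with rational coefficients (syntax), with
-- equality = equality as polynomial functions on ℚ³ (ℚ is infinite,
-- so this is equality of polynomials in ℚ[q,a,b]).

infixl 6 _⊕_
infixl 7 _⊗_

data Poly : Set where
  con  : ℚ → Poly
  var  : Var → Poly
  _⊕_  : Poly → Poly → Poly
  _⊗_  : Poly → Poly → Poly
  ⊖_   : Poly → Poly

evalP : Env → Poly → ℚ
evalP ρ (con c) = c
evalP ρ (var v) = ρ v
evalP ρ (f ⊕ g) = evalP ρ f ℚ.+ evalP ρ g
evalP ρ (f ⊗ g) = evalP ρ f ℚ.* evalP ρ g
evalP ρ (⊖ f)   = ℚ.- evalP ρ f

_≈P_ : Poly → Poly → Set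
f ≈P g = ∀ ρ → evalP ρ f ≡ evalP ρ g

_∣P_ : Poly → Poly → Set
F ∣P E = Σ Poly λ G → (F ⊗ G) ≈P E

IsUnitP : Poly → Set
IsUnitP F = Σ ℚ λ c → (c ≢ 0ℚ) × (F ≈P con c)

CoprimeP : Poly → Poly → Set
CoprimeP E P = ∀ F → F ∣P E → F ∣P P → IsUnitP F

powP : Poly → ℕ → Poly
powP f zero    = con 1ℚ
powP f (suc k) = powP f k ⊗ f

sumP : ℕ → (ℕ → Poly) → Poly
sumP zero    f = con 0ℚ
sumP (suc k) f = sumP k f ⊕ f k

infixl 6 _+ʳ_ _-ʳ_
infixl 7 _*ʳ_ _/ʳ_

data RF : Set where
  cst  : ℚ → RF
  vr   : Var → RF
  _+ʳ_ : RF → RF → RF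
  _*ʳ_ : RF → RF → RF
  -ʳ_  : RF → RF
  _/ʳ_ : RF → RF → RF

safeDiv : ℚ → ℚ → Maybe ℚ
safeDiv x y with y ≟ 0ℚ
... | yes _  = nothing
... | no y≢0 = just (ℚ._÷_ x y {{ℚ.≢-nonZero y≢0}})

evalR : Env → RF → Maybe ℚ
evalR ρ (cst c)  = just c
evalR ρ (vr v)   = just (ρ v)
evalR ρ (f +ʳ g) = evalR ρ f >>= λ x → evalR ρ g >>= λ y → just (x ℚ.+ y)
evalR ρ (f *ʳ g) = evalR ρ f >>= λ x → evalR ρ g >>= λ y → just (x ℚ.* y)
evalR ρ (-ʳ f)   = evalR ρ f >>= λ x → just (ℚ.- x)
evalR ρ (f /ʳ g) = evalR ρ f >>= λ x → evalR ρ g >>= λ y → safeDiv x y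

_-ʳ_ : RF → RF → RF
f -ʳ g = f +ʳ (-ʳ g)

oneR : RF
oneR = cst 1ℚ

powR : RF → ℕ → RF
powR f zero    = oneR
powR f (suc k) = powR f k *ʳ f

prodR : ℕ → (ℕ → RF) → RF
prodR zero    f = oneR
prodR (suc k) f = prodR k f *ʳ f k

sumR : ℕ → (ℕ → RF) → RF
sumR zero    f = cst 0ℚ
sumR (suc k) f = sumR k f +ʳ f k

qR aR bR : RF
qR = vr vq
aR = vr va
bR = vr vb

poch : RF → RF → ℕ → RF
poch x p k = prodR k (λ j → oneR -ʳ (x *ʳ powR p j))

qint : ℕ → RF
qint r = (oneR -ʳ powR qR r) /ʳ (oneR -ʳ qR)

-- Congruence of rational functions modulo a polynomial P:
-- L - R = N·P/E with N, E polynomials and E coprime to P.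
-- Equality of rational functions is tested at every point of ℚ³ where
-- both sides are defined (a nonempty Zariski-open, hence dense, set).

CongMod : Poly → RF → RF → Set
CongMod P L R =
  Σ Poly λ N → Σ Poly λ E → CoprimeP E P ×
    (∀ (ρ : Env) (x y : ℚ) → evalR ρ L ≡ just x → evalR ρ R ≡ just y →
       (x ℚ.- y) ℚ.* evalP ρ E ≡ evalP ρ N ℚ.* evalP ρ P)

qP aP bP : Poly
qP = var vq
aP = var va
bP = var vb

modulus : ℕ → Poly
modulus n =
  sumP n (powP qP)
  ⊗ (con 1ℚ ⊕ ⊖ (aP ⊗ powP qP n)) ⊗ (aP ⊕ ⊖ powP qP n)
  ⊗ (con 1ℚ ⊕ ⊖ (bP ⊗ powP qP n)) ⊗ (bP ⊕ ⊖ powP qP n)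

b3 : RF
b3 = powR bR 3

q2 q4 : RF
q2 = powR qR 2
q4 = powR qR 4

summand : ℕ → RF
summand k =
  qint (6 ℕ.* k ℕ.+ 1)
  *ʳ ((poch (aR *ʳ qR) q2 k *ʳ poch (qR /ʳ aR) q2 k
       *ʳ poch q2 q4 k *ʳ poch (b3 *ʳ qR) q4 k *ʳ poch (qR /ʳ b3) q4 k)
      /ʳ (poch q4 q4 k *ʳ poch (q4 /ʳ aR) q4 k *ʳ poch (aR *ʳ q4) q4 k
          *ʳ poch (q2 /ʳ b3) q2 k *ʳ poch (b3 *ʳ q2) q2 k))
  *ʳ powR qR (2 ℕ.* k)

lhs : ℕ → RF
lhs n = sumR n summand

rhs : ℕ → RF
rhs n =
  (((oneR -ʳ aR *ʳ qn) *ʳ (aR -ʳ qn) *ʳ ((-ʳ oneR) -ʳ powR bR 2 +ʳ bR *ʳ qn))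
     /ʳ ((bR -ʳ aR) *ʳ (oneR -ʳ bR *ʳ aR)))
  *ʳ ((poch (powR qR 5) q4 M *ʳ poch (aR *ʳ q2) q4 M *ʳ poch (q2 /ʳ aR) q4 M)
      /ʳ (poch qR q4 M *ʳ poch (q4 /ʳ aR) q4 M *ʳ poch (aR *ʳ q4) q4 M))
  +ʳ
  (((oneR -ʳ bR *ʳ qn) *ʳ (bR -ʳ qn) *ʳ ((-ʳ oneR) -ʳ powR aR 2 +ʳ aR *ʳ qn))
     /ʳ ((aR -ʳ bR) *ʳ (oneR -ʳ aR *ʳ bR)))
  *ʳ ((poch (powR qR 3) q4 K *ʳ poch b3 q4 K *ʳ poch (oneR /ʳ b3) q4 K)
      /ʳ (poch (oneR /ʳ qR) q4 K *ʳ poch (q2 /ʳ b3) q4 K *ʳ poch (b3 *ʳ q2) q4 K))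
  where
    qn : RF
    qn = powR qR n
    M K : ℕ
    M = (3 ℕ.* n ℕ.∸ 1) ℕ./ 4
    K = (n ℕ.+ 1) ℕ./ 4

{-# OPTIONS --safe #-}

-- Put y = b³ and E(a,u) = (1 − au)(a − u).  The k-th summand depends on a and y only through quotients
-- E(a,q^{2j+1})/E(a,q^{4j+4}) and E(y,q^{4j+1})/E(y,q^{2j+2}), so it is invariant under a ↦ 1/a and y ↦ 1/y.
-- Zeilberger-type telescoping in the shifts a ↦ aq⁴ and y ↦ yq⁴ evaluates the sum at a = q^{2i+1} and at
-- y = q^{4i+1}; the cases 2i+1 = n and 4i+1 = 3n give the congruences modulo (1−aqⁿ)(a−qⁿ) and (1−bqⁿ)(b−qⁿ).
-- Modulo [n], the sum is recovered for generic a by Lagrange interpolation at the n nodes a = q^{2i+1}.  The i-th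
-- interpolation coefficient contains (q^{2i+1−4(n−1)}; q⁴)_{2n−1} (1 − q^{2i+1}) / (q²; q²)_{2n−1}; since (z; q⁴)_L / (q⁴; q⁴)_L
-- is integral at odd powers z of q up to factors 1 + q^j (q-Vandermonde and Pascal), it is divisible by 1 − qⁿ.
-- Divisibility and coprimality of polynomials are checked on the Zariski-dense set of points where q ≥ 2 is an integer
-- and a, b are odd powers of q or 1/q.
module Submission where

open import Defs
open import Data.Empty using (⊥-elim)
open import Data.Maybe using (just; _>>=_)
open import Data.Nat as ℕ using (ℕ; zero; suc; z≤n; s≤s; _%_)
open import Data.Nat.DivMod using (m*n/n≡m; m≡m%n+[m/n]*n)
import Data.Nat.Properties as ℕₚ
open import Data.Nat.Solver using (module +-*-Solver)
open import Data.Product using (Σ; _×_; _,_; proj₁; proj₂)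
open import Data.Rational as ℚ using (ℚ; 0ℚ; 1ℚ; _+_; _*_; _-_; -_)
open import Data.Rational.Properties as ℚₚ
  using (+-*-commutativeRing; *-inverseʳ; *-comm; *-assoc; +-comm; +-assoc; *-identityˡ; *-identityʳ
        ; +-identityˡ; +-identityʳ; *-zeroˡ; *-zeroʳ; *-distribˡ-+; +-inverseʳ; _≟_)
open import Data.Sum using (_⊎_; inj₁; inj₂)
open import Function using (_∘_)
open import Level using (0ℓ)
open import Relation.Binary.Definitions using (tri<; tri≈; tri>)
open import Relation.Binary.PropositionalEquality
  using (_≡_; _≢_; refl; sym; trans; cong; cong₂; subst; module ≡-Reasoning)
open import Relation.Nullary using (yes; no)
open import Relation.Nullary.Decidable using (dec⇒maybe)
open import Tactic.RingSolver using (solve-∀)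
import Tactic.RingSolver.Core.AlmostCommutativeRing as ACR

-- Rational arithmetic with total division

-- The denominators of the summands contain factors 1 - q^{4j}, which for composite n share
-- cyclotomic factors with [n] and so are not allowed as denominators. Interpolation trades them for
-- quotients whose regularity can be proved. It is ordinary Lagrange interpolation in the variable a
-- + 1/a, because (1 - au)(a - u) = au((u + 1/u) - (a + 1/a)). `CongMod` asks for one denominator
-- coprime to the whole modulus, where coprimality ranges over all common divisors. No factorisation
-- into irreducibles is used: the allowed denominators are nonzero at the test points and satisfy,
-- at a = 2 and b = 3, a Bezout relation with 1 - qⁿ. The first condition excludes common factors
-- that involve a or b, the second those in q alone; both pass to products. Parity keeps the test
-- points off the poles: the poles in a and in y lie at even powers of q and 1/q, and the cube of an
-- odd power is again an odd power.

ℚ-ring : ACR.AlmostCommutativeRing 0ℓ 0ℓ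
ℚ-ring = ACR.fromCommutativeRing +-*-commutativeRing (λ x → dec⇒maybe (0ℚ ≟ x))

open ≡-Reasoning

-- inv 0 = 0, so that division is total and a term for the ring solver.
inv : ℚ → ℚ
inv x with x ≟ 0ℚ
... | yes _  = 0ℚ
... | no x≢0 = ℚ.1/_ x {{ℚ.≢-nonZero x≢0}}

infixl 7 _/_
_/_ : ℚ → ℚ → ℚ
x / y = x * inv y

*-inv : ∀ {x} → x ≢ 0ℚ → x * inv x ≡ 1ℚ
*-inv {x} x≢0 with x ≟ 0ℚ
... | yes x≡0 = ⊥-elim (x≢0 x≡0)
... | no x≢0′ = *-inverseʳ x {{ℚ.≢-nonZero x≢0′}}

1≢0 : 1ℚ ≢ 0ℚ
1≢0 ()

*-cancelˡ : ∀ {z x y} → z ≢ 0ℚ → z * x ≡ z * y → x ≡ y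
*-cancelˡ {z} {x} {y} z≢0 eq = begin
  x               ≡⟨ lem x ⟩
  inv z * (z * x) ≡⟨ cong (inv z *_) eq ⟩
  inv z * (z * y) ≡⟨ lem y ⟨
  y               ∎
  where
  lem : ∀ t → t ≡ inv z * (z * t)
  lem t = begin
    t               ≡⟨ *-identityˡ t ⟨
    1ℚ * t          ≡⟨ cong (_* t) (trans (*-comm (inv z) z) (*-inv z≢0)) ⟨
    inv z * z * t   ≡⟨ *-assoc (inv z) z t ⟩
    inv z * (z * t) ∎

*-nonzero : ∀ {x y} → x ≢ 0ℚ → y ≢ 0ℚ → x * y ≢ 0ℚ
*-nonzero {x} x≢0 y≢0 xy≡0 = y≢0 (*-cancelˡ x≢0 (trans xy≡0 (sym (*-zeroʳ x))))

nonzero-*ˡ : ∀ {x y} → x * y ≢ 0ℚ → x ≢ 0ℚ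
nonzero-*ˡ {_} {y} xy≢0 x≡0 = xy≢0 (trans (cong (_* y) x≡0) (*-zeroˡ y))

nonzero-*ʳ : ∀ {x y} → x * y ≢ 0ℚ → y ≢ 0ℚ
nonzero-*ʳ {x} xy≢0 y≡0 = xy≢0 (trans (cong (x *_) y≡0) (*-zeroʳ x))

inv-nonzero : ∀ {x} → x ≢ 0ℚ → inv x ≢ 0ℚ
inv-nonzero {x} x≢0 = nonzero-*ʳ {x} (λ eq → 1≢0 (trans (sym (*-inv x≢0)) eq))

neg-nonzero : ∀ {x} → x ≢ 0ℚ → - x ≢ 0ℚ
neg-nonzero {x} x≢0 eq = x≢0 (trans (lem x) (cong -_ eq))
  where
  lem : ∀ x → x ≡ - (- x)
  lem = solve-∀ ℚ-ring

/-intro : ∀ {x y z} → y ≢ 0ℚ → x ≡ z * y → x / y ≡ z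
/-intro {x} {y} {z} y≢0 eq = begin
  x * inv y       ≡⟨ cong (_* inv y) eq ⟩
  z * y * inv y   ≡⟨ *-assoc z y (inv y) ⟩
  z * (y * inv y) ≡⟨ cong (z *_) (*-inv y≢0) ⟩
  z * 1ℚ          ≡⟨ *-identityʳ z ⟩
  z               ∎

/-* : ∀ {x y} → y ≢ 0ℚ → x / y * y ≡ x
/-* {x} {y} y≢0 = trans (lem x y (inv y)) (trans (cong (x *_) (*-inv y≢0)) (*-identityʳ x))
  where
  lem : ∀ a b c → a * c * b ≡ a * (b * c)
  lem = solve-∀ ℚ-ring

/-cross : ∀ {x y z w} → y ≢ 0ℚ → w ≢ 0ℚ → x * w ≡ z * y → x / y ≡ z / w
/-cross {x} {y} {z} {w} y≢0 w≢0 eq = /-intro y≢0 (begin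
  x               ≡⟨ *-identityʳ x ⟨
  x * 1ℚ          ≡⟨ cong (x *_) (*-inv w≢0) ⟨
  x * (w * inv w) ≡⟨ *-assoc x w (inv w) ⟨
  x * w * inv w   ≡⟨ cong (_* inv w) eq ⟩
  z * y * inv w   ≡⟨ lem z y (inv w) ⟩
  z / w * y       ∎)
  where
  lem : ∀ a b c → a * b * c ≡ a * c * b
  lem = solve-∀ ℚ-ring

inv-* : ∀ {x y} → x ≢ 0ℚ → y ≢ 0ℚ → inv (x * y) ≡ inv x * inv y
inv-* {x} {y} x≢0 y≢0 = *-cancelˡ (*-nonzero x≢0 y≢0) (begin
  x * y * inv (x * y)         ≡⟨ *-inv (*-nonzero x≢0 y≢0) ⟩
  1ℚ                          ≡⟨ cong₂ _*_ (*-inv x≢0) (*-inv y≢0) ⟨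
  x * inv x * (y * inv y)     ≡⟨ lem x y (inv x) (inv y) ⟩
  x * y * (inv x * inv y)     ∎)
  where
  lem : ∀ a b c d → a * c * (b * d) ≡ a * b * (c * d)
  lem = solve-∀ ℚ-ring

/-*-/ : ∀ {x y z w} → y ≢ 0ℚ → w ≢ 0ℚ → (x / y) * (z / w) ≡ (x * z) / (y * w)
/-*-/ {x} {y} {z} {w} y≢0 w≢0 = trans (lem x (inv y) z (inv w)) (cong (x * z *_) (sym (inv-* y≢0 w≢0)))
  where
  lem : ∀ a b c d → a * b * (c * d) ≡ a * c * (b * d)
  lem = solve-∀ ℚ-ring

x-y≡0⇒x≡y : ∀ {x y} → x - y ≡ 0ℚ → x ≡ y
x-y≡0⇒x≡y {x} {y} eq = trans (lem x y) (trans (cong (_+ y) eq) (+-identityˡ y))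
  where
  lem : ∀ x y → x ≡ x - y + y
  lem = solve-∀ ℚ-ring

x≡y⇒x-y≡0 : ∀ {x y} → x ≡ y → x - y ≡ 0ℚ
x≡y⇒x-y≡0 {x} refl = +-inverseʳ x

≢⇒-≢0 : ∀ {x y} → x ≢ y → x - y ≢ 0ℚ
≢⇒-≢0 x≢y eq = x≢y (x-y≡0⇒x≡y eq)

-- Powers, finite products and finite sums.

infixr 8 _^_
_^_ : ℚ → ℕ → ℚ
x ^ zero  = 1ℚ
x ^ suc k = x ^ k * x

^-+ : ∀ x m n → x ^ (m ℕ.+ n) ≡ x ^ m * x ^ n
^-+ x zero    n = sym (*-identityˡ _)
^-+ x (suc m) n = trans (cong (_* x) (^-+ x m n)) (lem (x ^ m) (x ^ n) x)
  where
  lem : ∀ a b c → a * b * c ≡ a * c * b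
  lem = solve-∀ ℚ-ring

^-* : ∀ x m n → (x ^ m) ^ n ≡ x ^ (n ℕ.* m)
^-* x m zero    = refl
^-* x m (suc n) = begin
  (x ^ m) ^ n * x ^ m     ≡⟨ cong (_* x ^ m) (^-* x m n) ⟩
  x ^ (n ℕ.* m) * x ^ m   ≡⟨ ^-+ x (n ℕ.* m) m ⟨
  x ^ (n ℕ.* m ℕ.+ m)     ≡⟨ cong (x ^_) (ℕₚ.+-comm (n ℕ.* m) m) ⟩
  x ^ (m ℕ.+ n ℕ.* m)     ∎

^-distrib : ∀ x y n → (x * y) ^ n ≡ x ^ n * y ^ n
^-distrib x y zero    = refl
^-distrib x y (suc n) = trans (cong (_* (x * y)) (^-distrib x y n)) (lem (x ^ n) (y ^ n) x y)
  where
  lem : ∀ a b c d → a * b * (c * d) ≡ a * c * (b * d)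
  lem = solve-∀ ℚ-ring

1^ : ∀ n → 1ℚ ^ n ≡ 1ℚ
1^ zero    = refl
1^ (suc n) = trans (*-identityʳ _) (1^ n)

^-nonzero : ∀ {x} n → x ≢ 0ℚ → x ^ n ≢ 0ℚ
^-nonzero zero    x≢0 = 1≢0
^-nonzero (suc n) x≢0 = *-nonzero (^-nonzero n x≢0) x≢0

prod : ℕ → (ℕ → ℚ) → ℚ
prod zero    f = 1ℚ
prod (suc k) f = prod k f * f k

sum : ℕ → (ℕ → ℚ) → ℚ
sum zero    f = 0ℚ
sum (suc k) f = sum k f + f k

prod-cong : ∀ k {f g} → (∀ j → j ℕ.< k → f j ≡ g j) → prod k f ≡ prod k g
prod-cong zero    eq = refl
prod-cong (suc k) eq = cong₂ _*_ (prod-cong k (λ j j<k → eq j (ℕₚ.m<n⇒m<1+n j<k))) (eq k ℕₚ.≤-refl)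

sum-cong : ∀ k {f g} → (∀ j → j ℕ.< k → f j ≡ g j) → sum k f ≡ sum k g
sum-cong zero    eq = refl
sum-cong (suc k) eq = cong₂ _+_ (sum-cong k (λ j j<k → eq j (ℕₚ.m<n⇒m<1+n j<k))) (eq k ℕₚ.≤-refl)

prod-nonzero : ∀ k {f} → (∀ j → j ℕ.< k → f j ≢ 0ℚ) → prod k f ≢ 0ℚ
prod-nonzero zero    nz = 1≢0
prod-nonzero (suc k) nz = *-nonzero (prod-nonzero k (λ j j<k → nz j (ℕₚ.m<n⇒m<1+n j<k))) (nz k ℕₚ.≤-refl)

prod-zero : ∀ k {f} j → j ℕ.< k → f j ≡ 0ℚ → prod k f ≡ 0ℚ
prod-zero (suc k) {f} j j<1+k eq with ℕₚ.m≤n⇒m<n∨m≡n (ℕ.s≤s⁻¹ j<1+k)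
... | inj₁ j<k  = trans (cong (_* f k) (prod-zero k j j<k eq)) (*-zeroˡ (f k))
... | inj₂ refl = trans (cong (prod k f *_) eq) (*-zeroʳ (prod k f))

prod-* : ∀ k f g → prod k (λ j → f j * g j) ≡ prod k f * prod k g
prod-* zero    f g = refl
prod-* (suc k) f g = trans (cong (_* (f k * g k)) (prod-* k f g)) (lem (prod k f) (prod k g) (f k) (g k))
  where
  lem : ∀ a b c d → a * b * (c * d) ≡ a * c * (b * d)
  lem = solve-∀ ℚ-ring

prod-inv : ∀ k {f} → (∀ j → j ℕ.< k → f j ≢ 0ℚ) → prod k (λ j → inv (f j)) ≡ inv (prod k f)
prod-inv zero    nz = refl
prod-inv (suc k) {f} nz = trans (cong (_* inv (f k)) (prod-inv k nz′))
  (sym (inv-* (prod-nonzero k nz′) (nz k ℕₚ.≤-refl)))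
  where
  nz′ : ∀ j → j ℕ.< k → f j ≢ 0ℚ
  nz′ j j<k = nz j (ℕₚ.m<n⇒m<1+n j<k)

prod-/ : ∀ k {f g} → (∀ j → j ℕ.< k → g j ≢ 0ℚ) → prod k (λ j → f j / g j) ≡ prod k f / prod k g
prod-/ k {f} {g} nz = trans (prod-* k f (λ j → inv (g j))) (cong (prod k f *_) (prod-inv k nz))

prod-front : ∀ k f → prod (suc k) f ≡ f 0 * prod k (f ∘ suc)
prod-front zero    f = *-comm 1ℚ (f 0)
prod-front (suc k) f = trans (cong (_* f (suc k)) (prod-front k f))
  (*-assoc (f 0) (prod k (f ∘ suc)) (f (suc k)))

prod-reverse : ∀ k (f : ℕ → ℚ) → prod k (λ j → f (k ℕ.∸ j)) ≡ prod k (f ∘ suc)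
prod-reverse zero    f = refl
prod-reverse (suc k) f = begin
  prod (suc k) (λ j → f (suc k ℕ.∸ j))       ≡⟨ prod-front k (λ j → f (suc k ℕ.∸ j)) ⟩
  f (suc k) * prod k (λ j → f (k ℕ.∸ j))     ≡⟨ cong (f (suc k) *_) (prod-reverse k f) ⟩
  f (suc k) * prod k (f ∘ suc)               ≡⟨ *-comm (f (suc k)) (prod k (f ∘ suc)) ⟩
  prod (suc k) (f ∘ suc)                     ∎

prod-+ : ∀ k l f → prod (k ℕ.+ l) f ≡ prod k f * prod l (λ j → f (k ℕ.+ j))
prod-+ k zero    f = trans (cong (λ m → prod m f) (ℕₚ.+-identityʳ k)) (sym (*-identityʳ (prod k f)))
prod-+ k (suc l) f = begin
  prod (k ℕ.+ suc l) f                                       ≡⟨ cong (λ m → prod m f) (ℕₚ.+-suc k l) ⟩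
  prod (k ℕ.+ l) f * f (k ℕ.+ l)                             ≡⟨ cong (_* f (k ℕ.+ l)) (prod-+ k l f) ⟩
  prod k f * prod l (λ j → f (k ℕ.+ j)) * f (k ℕ.+ l)        ≡⟨ *-assoc (prod k f) (prod l (λ j → f (k ℕ.+ j))) (f (k ℕ.+ l)) ⟩
  prod k f * (prod l (λ j → f (k ℕ.+ j)) * f (k ℕ.+ l))      ∎

sum-*ˡ : ∀ k c f → sum k (λ j → c * f j) ≡ c * sum k f
sum-*ˡ zero    c f = sym (*-zeroʳ c)
sum-*ˡ (suc k) c f = trans (cong (_+ c * f k) (sum-*ˡ k c f)) (sym (*-distribˡ-+ c _ _))

sum-+ : ∀ k f g → sum k (λ j → f j + g j) ≡ sum k f + sum k g
sum-+ zero    f g = refl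
sum-+ (suc k) f g = trans (cong (_+ (f k + g k)) (sum-+ k f g)) (lem (sum k f) (sum k g) (f k) (g k))
  where
  lem : ∀ a b c d → a + b + (c + d) ≡ a + c + (b + d)
  lem = solve-∀ ℚ-ring

sum-front : ∀ k f → sum (suc k) f ≡ f 0 + sum k (f ∘ suc)
sum-front zero    f = +-comm 0ℚ (f 0)
sum-front (suc k) f = trans (cong (_+ f (suc k)) (sum-front k f))
  (+-assoc (f 0) (sum k (f ∘ suc)) (f (suc k)))

sum-zero : ∀ k {f} → (∀ j → j ℕ.< k → f j ≡ 0ℚ) → sum k f ≡ 0ℚ
sum-zero zero    eq = refl
sum-zero (suc k) eq = cong₂ _+_ (sum-zero k (λ j j<k → eq j (ℕₚ.m<n⇒m<1+n j<k))) (eq k ℕₚ.≤-refl)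

-- Telescoping in the shifts a ↦ aq⁴ and y ↦ yq⁴

-- For nonzero arguments this is au((u + 1/u) - (a + 1/a)): up to a monomial, a difference of two
-- values of x + 1/x.
E : ℚ → ℚ → ℚ
E a u = (1ℚ - a * u) * (a - u)

-- At Z = q^{2k} the quotient of the two is the ratio of the summands k + 1 and k, both without
-- their q-integer. Multiplying numerator and denominator by ay has merged the factors at a and 1/a,
-- and those at y and 1/y, into values of `E`.
ratioNum ratioDen : ℚ → ℚ → ℚ → ℚ → ℚ
ratioNum q a y Z = q * q * (1ℚ - q * q * (Z * Z)) * E a (q * Z) * E y (q * (Z * Z))
ratioDen q a y Z = (1ℚ - q * q * q * q * (Z * Z)) * E a (q * q * q * q * (Z * Z)) * E y (q * q * Z)

term : ℚ → ℚ → ℚ → ℕ → ℚ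
term q a y k = prod k (λ j → ratioNum q a y ((q * q) ^ j) / ratioDen q a y ((q * q) ^ j))

-- The weight at k is 1 - q^{6k+1}; the division by 1 - q in the q-integer is postponed.
partialSum : ℚ → ℚ → ℚ → ℕ → ℚ
partialSum q a y N =
  sum N (λ k → (1ℚ - q * ((q * q) ^ k * (q * q) ^ k * (q * q) ^ k)) * term q a y k)

-- Two products with consecutive ratios n/d and n′/d′ stay proportional, with factor g/(κh), as long
-- as g/h changes by the quotient of these ratios. A relation between products thus reduces to one
-- polynomial identity in Z.
ratio-step : ∀ X B κ {h g} h′ {g′} n {d} n′ {d′} → d ≢ 0ℚ → d′ ≢ 0ℚ → h ≢ 0ℚ →
  X * κ * h ≡ B * g → g * n * h′ * d′ ≡ n′ * g′ * h * d →
  X * (n / d) * κ * h′ ≡ B * (n′ / d′) * g′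
ratio-step X B κ {h} {g} h′ {g′} n {d} n′ {d′} d≢0 d′≢0 h≢0 ih eq =
  *-cancelˡ (*-nonzero h≢0 (*-nonzero d≢0 d′≢0)) (begin
    h * (d * d′) * (X * (n / d) * κ * h′)   ≡⟨ l₁ h d d′ X n (inv d) κ h′ ⟩
    X * κ * h * (n / d * d) * h′ * d′       ≡⟨ cong₂ (λ s t → s * t * h′ * d′) ih (/-* {n} d≢0) ⟩
    B * g * n * h′ * d′                     ≡⟨ l₂ B g n h′ d′ ⟩
    B * (g * n * h′ * d′)                   ≡⟨ cong (B *_) eq ⟩
    B * (n′ * g′ * h * d)                   ≡⟨ cong (λ s → B * (s * g′ * h * d)) (/-* {n′} d′≢0) ⟨
    B * (n′ / d′ * d′ * g′ * h * d)         ≡⟨ l₃ h d d′ B n′ (inv d′) g′ ⟩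
    h * (d * d′) * (B * (n′ / d′) * g′)     ∎)
  where
  l₁ : ∀ h d d′ X n i κ h′ → h * (d * d′) * (X * (n * i) * κ * h′) ≡ X * κ * h * (n * i * d) * h′ * d′
  l₁ = solve-∀ ℚ-ring
  l₂ : ∀ B g n h′ d′ → B * g * n * h′ * d′ ≡ B * (g * n * h′ * d′)
  l₂ = solve-∀ ℚ-ring
  l₃ : ∀ h d d′ B n′ i g′ → B * (n′ * i * d′ * g′ * h * d) ≡ h * (d * d′) * (B * (n′ * i) * g′)
  l₃ = solve-∀ ℚ-ring

-- The inductive step shared by both telescoping proofs: c, c′ are the two
-- summands, S, S′ their partial sums and B β / (Z u) the antidifference.
telescope-step : ∀ q Z {u u₁ m n} c c′ {B B₁} κ s t e e′ S S′ D {g g′ w β β₁ nB dB} →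
  m ≢ 0ℚ →
  c * κ ≡ B * g →
  c′ * (κ * s) * (n * u) ≡ B * (g′ * t) →
  m * u₁ ≡ n * u →
  κ * (s * e′ * S′ + t * e * S) * (Z * u) ≡ t * D * (q * q) * (B * β) →
  B₁ * dB ≡ B * nB →
  m * β₁ ≡ dB * (q * Z - 1ℚ) →
  Z * w * (g′ * e′ + g * (n * u) * e) ≡ D * (nB * (q * Z - 1ℚ) - q * q * n * β) →
  κ * (s * e′ * (S′ + w * c′) + t * e * (S + w * c)) * (Z * (q * q) * u₁) ≡ t * D * (q * q) * (B₁ * β₁)
telescope-step q Z {u} {u₁} {m} {n} c c′ {B} {B₁} κ s t e e′ S S′ D {g} {g′} {w} {β} {β₁} {nB} {dB}
  m≢0 hc hc′ mn ih hB hβ identity = *-cancelˡ m≢0 (begin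
    m * (κ * (s * e′ * (S′ + w * c′) + t * e * (S + w * c)) * (Z * (q * q) * u₁))
      ≡⟨ l₀ m (κ * (s * e′ * (S′ + w * c′) + t * e * (S + w * c))) (Z * (q * q)) u₁ ⟩
    κ * (s * e′ * (S′ + w * c′) + t * e * (S + w * c)) * (Z * (q * q) * (m * u₁))
      ≡⟨ cong (λ a → κ * (s * e′ * (S′ + w * c′) + t * e * (S + w * c)) * (Z * (q * q) * a)) mn ⟩
    κ * (s * e′ * (S′ + w * c′) + t * e * (S + w * c)) * (Z * (q * q) * (n * u))
      ≡⟨ l₁ κ s e′ S′ w c′ t e S c q Z n u ⟩
    q * q * (n * (κ * (s * e′ * S′ + t * e * S) * (Z * u))
      + Z * w * (e′ * (c′ * (κ * s) * (n * u)) + t * e * (n * u) * (c * κ)))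
      ≡⟨ cong₂ (λ a b → q * q * (n * a + Z * w * b)) ih
          (cong₂ (λ a b → e′ * a + t * e * (n * u) * b) hc′ hc) ⟩
    q * q * (n * (t * D * (q * q) * (B * β))
      + Z * w * (e′ * (B * (g′ * t)) + t * e * (n * u) * (B * g)))
      ≡⟨ l₂ q n t D B β Z w e′ g′ e u g ⟩
    q * q * t * B * (D * (q * q * n * β) + Z * w * (g′ * e′ + g * (n * u) * e))
      ≡⟨ cong (λ a → q * q * t * B * (D * (q * q * n * β) + a)) identity ⟩
    q * q * t * B * (D * (q * q * n * β) + D * (nB * (q * Z - 1ℚ) - q * q * n * β))
      ≡⟨ l₃ q t B D (q * q * n * β) nB (q * Z - 1ℚ) ⟩
    t * D * (q * q) * (B * nB) * (q * Z - 1ℚ)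
      ≡⟨ cong (λ a → t * D * (q * q) * a * (q * Z - 1ℚ)) hB ⟨
    t * D * (q * q) * (B₁ * dB) * (q * Z - 1ℚ)
      ≡⟨ l₄ (t * D * (q * q)) B₁ dB (q * Z - 1ℚ) ⟩
    t * D * (q * q) * B₁ * (dB * (q * Z - 1ℚ))
      ≡⟨ cong (t * D * (q * q) * B₁ *_) hβ ⟨
    t * D * (q * q) * B₁ * (m * β₁)
      ≡⟨ l₅ (t * D * (q * q)) B₁ m β₁ ⟩
    m * (t * D * (q * q) * (B₁ * β₁)) ∎)
  where
  l₀ : ∀ m a z u → m * (a * (z * u)) ≡ a * (z * (m * u))
  l₀ = solve-∀ ℚ-ring
  l₁ : ∀ κ s e′ S′ w c′ t e S c q Z n u →
    κ * (s * e′ * (S′ + w * c′) + t * e * (S + w * c)) * (Z * (q * q) * (n * u)) ≡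
    q * q * (n * (κ * (s * e′ * S′ + t * e * S) * (Z * u))
      + Z * w * (e′ * (c′ * (κ * s) * (n * u)) + t * e * (n * u) * (c * κ)))
  l₁ = solve-∀ ℚ-ring
  l₂ : ∀ q n t D B β Z w e′ g′ e u g →
    q * q * (n * (t * D * (q * q) * (B * β))
      + Z * w * (e′ * (B * (g′ * t)) + t * e * (n * u) * (B * g))) ≡
    q * q * t * B * (D * (q * q * n * β) + Z * w * (g′ * e′ + g * (n * u) * e))
  l₂ = solve-∀ ℚ-ring
  l₃ : ∀ q t B D b n z → q * q * t * B * (D * b + D * (n * z - b)) ≡ t * D * (q * q) * (B * n) * z
  l₃ = solve-∀ ℚ-ring
  l₄ : ∀ C B d z → C * (B * d) * z ≡ C * B * (d * z)
  l₄ = solve-∀ ℚ-ring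
  l₅ : ∀ C B u b → C * B * (u * b) ≡ u * (C * (B * b))
  l₅ = solve-∀ ℚ-ring

module ShiftA (q A y : ℚ) where

  q⁴ A⁺ : ℚ
  q⁴ = q * q * q * q
  A⁺ = A * q⁴

  Z : ℕ → ℚ
  Z k = (q * q) ^ k

  -- Consecutive ratio of `B`, the product common to the summands at A and at Aq⁴: the first is `B`
  -- times g/κ, the second is `B` times g′t/(κsh).
  nB dB : ℚ → ℚ
  nB Z = (1ℚ - q * q * (Z * Z)) * (1ℚ - A * q * Z) * (A * (q * q * q) - Z) * E y (q * (Z * Z))
  dB Z = q * ratioDen q A y Z

  B : ℕ → ℚ
  B N = prod N (λ j → nB (Z j) / dB (Z j))

  κ : ℚ
  κ = (A * (q * q * q) - 1ℚ) * (A * q - 1ℚ)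

  g g′ β : ℚ → ℚ
  g Z = (A * (q * q * q) - Z) * (A * q - Z)
  g′ Z = (1ℚ - A * q * Z) * (1ℚ - A * (q * q * q) * Z) * (A - Z * Z)
  β Z = (1ℚ - Z * Z) * (A - Z * Z) * (Z - q) * E y Z

  h : ℚ → ℚ
  h Z = 1ℚ - A * (q⁴ * (Z * Z))

  D s t e e′ : ℚ
  D = A * (1ℚ + A * (q * q))
  t = 1ℚ - A * q⁴
  s = A - 1ℚ
  e = E y (A * q)
  e′ = E y (A * (q * q * q))

  module _ (q≢0 : q ≢ 0ℚ) (N : ℕ)
           (den≢0 : ∀ k → k ℕ.< N → ratioDen q A y (Z k) ≢ 0ℚ)
           (den⁺≢0 : ∀ k → k ℕ.< N → ratioDen q A⁺ y (Z k) ≢ 0ℚ) where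

    dB≢0 : ∀ k → k ℕ.< N → dB (Z k) ≢ 0ℚ
    dB≢0 k k<N = *-nonzero q≢0 (den≢0 k k<N)

    h≢0 : ∀ k → k ℕ.< N → h (Z k) ≢ 0ℚ
    h≢0 k k<N = nonzero-*ˡ {h (Z k)} {A - q⁴ * (Z k * Z k)}
      (nonzero-*ʳ {1ℚ - q⁴ * (Z k * Z k)}
        (nonzero-*ˡ {_} {E y (q * q * Z k)} (den≢0 k k<N)))

    term-B : ∀ k → k ℕ.≤ N → term q A y k * κ ≡ B k * g (Z k)
    term-B zero _ = refl
    term-B (suc k) k<N = begin
      term q A y (suc k) * κ ≡⟨ *-identityʳ (term q A y (suc k) * κ) ⟨
      term q A y (suc k) * κ * 1ℚ
        ≡⟨ ratio-step (term q A y k) (B k) κ {g = g (Z k)} 1ℚ (ratioNum q A y (Z k)) (nB (Z k))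
             (den≢0 k k<N) (dB≢0 k k<N) 1≢0
             (trans (*-identityʳ (term q A y k * κ)) (term-B k (ℕₚ.<⇒≤ k<N)))
             (l q A (Z k) (E y (q * (Z k * Z k))) (ratioDen q A y (Z k))) ⟩
      B (suc k) * g (Z (suc k)) ∎
      where
      l : ∀ q A Z Ey d →
        (A * (q * q * q) - Z) * (A * q - Z) * (q * q * (1ℚ - q * q * (Z * Z)) * ((1ℚ - A * (q * Z)) * (A - q * Z)) * Ey) * 1ℚ * (q * d) ≡
        (1ℚ - q * q * (Z * Z)) * (1ℚ - A * q * Z) * (A * (q * q * q) - Z) * Ey * ((A * (q * q * q) - Z * (q * q)) * (A * q - Z * (q * q))) * 1ℚ * d
      l = solve-∀ ℚ-ring

    term⁺-B : ∀ k → k ℕ.< N → term q A⁺ y k * (κ * s) * h (Z k) ≡ B k * (g′ (Z k) * t)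
    term⁺-B zero _ = l q A
      where
      l : ∀ q A → 1ℚ * ((A * (q * q * q) - 1ℚ) * (A * q - 1ℚ) * (A - 1ℚ)) * (1ℚ - A * (q * q * q * q * (1ℚ * 1ℚ))) ≡
        1ℚ * ((1ℚ - A * q * 1ℚ) * (1ℚ - A * (q * q * q) * 1ℚ) * (A - 1ℚ * 1ℚ) * (1ℚ - A * (q * q * q * q)))
      l = solve-∀ ℚ-ring
    term⁺-B (suc k) k<N =
      ratio-step (term q A⁺ y k) (B k) (κ * s) {g = g′ (Z k) * t} (h (Z (suc k))) (ratioNum q A⁺ y (Z k)) (nB (Z k))
        (den⁺≢0 k k<N′) (dB≢0 k k<N′) (h≢0 k k<N′) (term⁺-B k k<N′)
        (l q A (Z k) (E y (q * (Z k * Z k))) (E y (q * q * Z k)))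
      where
      k<N′ = ℕₚ.<-trans (ℕₚ.n<1+n k) k<N
      l : ∀ q A Z Ey Ey′ →
        (1ℚ - A * q * Z) * (1ℚ - A * (q * q * q) * Z) * (A - Z * Z) * (1ℚ - A * (q * q * q * q)) *
        (q * q * (1ℚ - q * q * (Z * Z)) * ((1ℚ - A * (q * q * q * q) * (q * Z)) * (A * (q * q * q * q) - q * Z)) * Ey) *
        (1ℚ - A * (q * q * q * q * (Z * (q * q) * (Z * (q * q))))) *
        (q * ((1ℚ - q * q * q * q * (Z * Z)) * ((1ℚ - A * (q * q * q * q * (Z * Z))) * (A - q * q * q * q * (Z * Z))) * Ey′)) ≡
        (1ℚ - q * q * (Z * Z)) * (1ℚ - A * q * Z) * (A * (q * q * q) - Z) * Ey *
        ((1ℚ - A * q * (Z * (q * q))) * (1ℚ - A * (q * q * q) * (Z * (q * q))) * (A - Z * (q * q) * (Z * (q * q))) * (1ℚ - A * (q * q * q * q))) *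
        (1ℚ - A * (q * q * q * q * (Z * Z))) *
        ((1ℚ - q * q * q * q * (Z * Z)) * ((1ℚ - A * (q * q * q * q) * (q * q * q * q * (Z * Z))) * (A * (q * q * q * q) - q * q * q * q * (Z * Z))) * Ey′)
      l = solve-∀ ℚ-ring

    -- Creative telescoping: a combination of the summands at A and at Aq⁴ is the difference of
    -- consecutive values of a multiple of Bβ/Z, and `identity` is the certificate. The trailing
    -- factor 1 stands for the `u` of `telescope-step`, which is nontrivial for the shift in y.
    telescoped : ∀ k → k ℕ.≤ N →
      κ * (s * e′ * partialSum q A⁺ y k + t * e * partialSum q A y k) * (Z k * 1ℚ) ≡ t * D * (q * q) * (B k * β (Z k))
    -- The certificate β contains 1 - Z², which vanishes at Z = 1, so the antidifference starts at
    -- 0.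
    telescoped zero _ = l κ (s * e′) (t * e) (t * D * (q * q)) A q (E y 1ℚ)
      where
      l : ∀ κ a b C A q e → κ * (a * 0ℚ + b * 0ℚ) * (1ℚ * 1ℚ) ≡ C * (1ℚ * ((1ℚ - 1ℚ * 1ℚ) * (A - 1ℚ * 1ℚ) * (1ℚ - q) * e))
      l = solve-∀ ℚ-ring
    telescoped (suc k) k<N =
      telescope-step q (Z k) (term q A y k) (term q A⁺ y k) {B k} {B (suc k)} κ s t e e′ (partialSum q A y k) (partialSum q A⁺ y k) D
        {g (Z k)} {g′ (Z k)} {nB = nB (Z k)} {dB (Z k)}
        (h≢0 k k<N) (term-B k (ℕₚ.<⇒≤ k<N))
        (trans (cong (term q A⁺ y k * (κ * s) *_) (*-identityʳ (h (Z k)))) (term⁺-B k k<N)) refl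
        (telescoped k (ℕₚ.<⇒≤ k<N))
        (trans (*-assoc (B k) (nB (Z k) / dB (Z k)) (dB (Z k))) (cong (B k *_) (/-* {nB (Z k)} (dB≢0 k k<N))))
        (lβ q A (Z k) y) (identity q A (Z k) y)
      where
      lβ : ∀ q A Z y →
        (1ℚ - A * (q * q * q * q * (Z * Z))) * ((1ℚ - Z * (q * q) * (Z * (q * q))) * (A - Z * (q * q) * (Z * (q * q))) * (Z * (q * q) - q) * ((1ℚ - y * (Z * (q * q))) * (y - Z * (q * q)))) ≡
        q * ((1ℚ - q * q * q * q * (Z * Z)) * ((1ℚ - A * (q * q * q * q * (Z * Z))) * (A - q * q * q * q * (Z * Z))) * ((1ℚ - y * (q * q * Z)) * (y - q * q * Z))) * (q * Z - 1ℚ)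
      lβ = solve-∀ ℚ-ring
      identity : ∀ q A Z y →
        Z * (1ℚ - q * (Z * Z * Z)) *
          ((1ℚ - A * q * Z) * (1ℚ - A * (q * q * q) * Z) * (A - Z * Z) * ((1ℚ - y * (A * (q * q * q))) * (y - A * (q * q * q))) +
           (A * (q * q * q) - Z) * (A * q - Z) * ((1ℚ - A * (q * q * q * q * (Z * Z))) * 1ℚ) * ((1ℚ - y * (A * q)) * (y - A * q))) ≡
        A * (1ℚ + A * (q * q)) *
          ((1ℚ - q * q * (Z * Z)) * (1ℚ - A * q * Z) * (A * (q * q * q) - Z) * ((1ℚ - y * (q * (Z * Z))) * (y - q * (Z * Z))) * (q * Z - 1ℚ) -
           q * q * (1ℚ - A * (q * q * q * q * (Z * Z))) * ((1ℚ - Z * Z) * (A - Z * Z) * (Z - q) * ((1ℚ - y * Z) * (y - Z))))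
      identity = solve-∀ ℚ-ring

    -- The antidifference at N carries `B N`; once a factor of that product vanishes, the sums at A
    -- and at Aq⁴ are proportional.
    shift : κ ≢ 0ℚ → B N ≡ 0ℚ →
      (1ℚ - A) * e′ * partialSum q A⁺ y N ≡ (1ℚ - A * q⁴) * e * partialSum q A y N
    shift κ≢0 B≡0 = *-cancelˡ (*-nonzero κ≢0 (^-nonzero N (*-nonzero q≢0 q≢0))) (x-y≡0⇒x≡y (begin
      κ * Z N * ((1ℚ - A) * e′ * partialSum q A⁺ y N) - κ * Z N * (t * e * partialSum q A y N)
        ≡⟨ l κ (Z N) A e′ (partialSum q A⁺ y N) t e (partialSum q A y N) ⟩
      - (κ * (s * e′ * partialSum q A⁺ y N + t * e * partialSum q A y N) * (Z N * 1ℚ))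
        ≡⟨ cong -_ (telescoped N ℕₚ.≤-refl) ⟩
      - (t * D * (q * q) * (B N * β (Z N)))
        ≡⟨ cong (λ b → - (t * D * (q * q) * (b * β (Z N)))) B≡0 ⟩
      - (t * D * (q * q) * (0ℚ * β (Z N)))
        ≡⟨ l₀ (t * D * (q * q)) (β (Z N)) ⟩
      0ℚ ∎))
      where
      l : ∀ κ Z A e′ S′ t e S →
        κ * Z * ((1ℚ - A) * e′ * S′) - κ * Z * (t * e * S) ≡ - (κ * ((A - 1ℚ) * e′ * S′ + t * e * S) * (Z * 1ℚ))
      l = solve-∀ ℚ-ring
      l₀ : ∀ a b → - (a * (0ℚ * b)) ≡ 0ℚ
      l₀ = solve-∀ ℚ-ring

module ShiftY (q a y : ℚ) where

  q⁴ y⁺ : ℚ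
  q⁴ = q * q * q * q
  y⁺ = y * q⁴

  Z : ℕ → ℚ
  Z k = (q * q) ^ k

  nB dB : ℚ → ℚ
  nB Z = (1ℚ - q * q * (Z * Z)) * E a (q * Z) * ((1ℚ - y * (q * (Z * Z))) * (y * (q * q * q) - Z * Z))
  dB Z = q * ratioDen q a y Z

  B : ℕ → ℚ
  B N = prod N (λ j → nB (Z j) / dB (Z j))

  -- The argument q²Z of `E y` advances by q² from one summand to the next, so the shift by q⁴ is
  -- two steps long and leaves the two factors u and u₁ in the shifted summand. For the shift in a
  -- the argument q⁴Z² advances by q⁴, and a single factor h is left.
  g g′ β u u₁ : ℚ → ℚ
  g Z = (1ℚ - y * q) * (y * (q * q * q) - Z * Z)
  g′ Z = (1ℚ - y * (q * (Z * Z))) * (y * (q * q) - Z) * (y - Z) * (y * (q * q * q) - 1ℚ)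
  u Z = 1ℚ - y * (q * q * Z)
  u₁ Z = 1ℚ - y * (q * q * (Z * (q * q)))
  β Z = (1ℚ - Z * Z) * (y - Z) * (Z - q) * E a (Z * Z)

  D κ s t e e′ : ℚ
  D = (1ℚ - y * y * q⁴) * y
  κ = (1ℚ - y * q) * (y * (q * q * q) - 1ℚ)
  t = 1ℚ - y * q⁴
  s = 1ℚ - y
  e = - E a (y * q)
  e′ = E a (y * (q * q * q))

  module _ (q≢0 : q ≢ 0ℚ) (N : ℕ)
           (den≢0 : ∀ k → k ℕ.< N → ratioDen q a y (Z k) ≢ 0ℚ)
           (den⁺≢0 : ∀ k → k ℕ.< N → ratioDen q a y⁺ (Z k) ≢ 0ℚ)
           (u₁≢0 : ∀ k → k ℕ.< N → u₁ (Z k) ≢ 0ℚ) where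

    dB≢0 : ∀ k → k ℕ.< N → dB (Z k) ≢ 0ℚ
    dB≢0 k k<N = *-nonzero q≢0 (den≢0 k k<N)

    u≢0 : ∀ k → k ℕ.< N → u (Z k) ≢ 0ℚ
    u≢0 k k<N = nonzero-*ˡ {u (Z k)} {y - q * q * Z k}
      (nonzero-*ʳ {(1ℚ - q⁴ * (Z k * Z k)) * E a (q⁴ * (Z k * Z k))} (den≢0 k k<N))

    term-B : ∀ k → k ℕ.≤ N → term q a y k * κ ≡ B k * g (Z k)
    term-B zero _ = l q y
      where
      l : ∀ q y → 1ℚ * ((1ℚ - y * q) * (y * (q * q * q) - 1ℚ)) ≡ 1ℚ * ((1ℚ - y * q) * (y * (q * q * q) - 1ℚ * 1ℚ))
      l = solve-∀ ℚ-ring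
    term-B (suc k) k<N = begin
      term q a y (suc k) * κ ≡⟨ *-identityʳ (term q a y (suc k) * κ) ⟨
      term q a y (suc k) * κ * 1ℚ
        ≡⟨ ratio-step (term q a y k) (B k) κ {g = g (Z k)} 1ℚ (ratioNum q a y (Z k)) (nB (Z k))
             (den≢0 k k<N) (dB≢0 k k<N) 1≢0
             (trans (*-identityʳ (term q a y k * κ)) (term-B k (ℕₚ.<⇒≤ k<N)))
             (l q y (Z k) (E a (q * Z k)) (ratioDen q a y (Z k))) ⟩
      B (suc k) * g (Z (suc k)) ∎
      where
      l : ∀ q y Z Ea d →
        (1ℚ - y * q) * (y * (q * q * q) - Z * Z) * (q * q * (1ℚ - q * q * (Z * Z)) * Ea * ((1ℚ - y * (q * (Z * Z))) * (y - q * (Z * Z)))) * 1ℚ * (q * d) ≡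
        (1ℚ - q * q * (Z * Z)) * Ea * ((1ℚ - y * (q * (Z * Z))) * (y * (q * q * q) - Z * Z)) * ((1ℚ - y * q) * (y * (q * q * q) - Z * (q * q) * (Z * (q * q)))) * 1ℚ * d
      l = solve-∀ ℚ-ring

    term⁺-B : ∀ k → k ℕ.< N → term q a y⁺ k * (κ * s) * (u₁ (Z k) * u (Z k)) ≡ B k * (g′ (Z k) * t)
    term⁺-B zero _ = l q y
      where
      l : ∀ q y → 1ℚ * ((1ℚ - y * q) * (y * (q * q * q) - 1ℚ) * (1ℚ - y)) * ((1ℚ - y * (q * q * (1ℚ * (q * q)))) * (1ℚ - y * (q * q * 1ℚ))) ≡
        1ℚ * ((1ℚ - y * (q * (1ℚ * 1ℚ))) * (y * (q * q) - 1ℚ) * (y - 1ℚ) * (y * (q * q * q) - 1ℚ) * (1ℚ - y * (q * q * q * q)))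
      l = solve-∀ ℚ-ring
    term⁺-B (suc k) k<N =
      ratio-step (term q a y⁺ k) (B k) (κ * s) {g = g′ (Z k) * t} (u₁ (Z (suc k)) * u (Z (suc k))) (ratioNum q a y⁺ (Z k)) (nB (Z k))
        (den⁺≢0 k k<N′) (dB≢0 k k<N′) (*-nonzero (u₁≢0 k k<N′) (u≢0 k k<N′)) (term⁺-B k k<N′)
        (l q y (Z k) (E a (q * Z k)) (E a (q⁴ * (Z k * Z k))))
      where
      k<N′ = ℕₚ.<-trans (ℕₚ.n<1+n k) k<N
      l : ∀ q y Z Ea Ea′ →
        (1ℚ - y * (q * (Z * Z))) * (y * (q * q) - Z) * (y - Z) * (y * (q * q * q) - 1ℚ) * (1ℚ - y * (q * q * q * q)) *
        (q * q * (1ℚ - q * q * (Z * Z)) * Ea * ((1ℚ - y * (q * q * q * q) * (q * (Z * Z))) * (y * (q * q * q * q) - q * (Z * Z)))) *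
        ((1ℚ - y * (q * q * (Z * (q * q) * (q * q)))) * (1ℚ - y * (q * q * (Z * (q * q))))) *
        (q * ((1ℚ - q * q * q * q * (Z * Z)) * Ea′ * ((1ℚ - y * (q * q * Z)) * (y - q * q * Z)))) ≡
        (1ℚ - q * q * (Z * Z)) * Ea * ((1ℚ - y * (q * (Z * Z))) * (y * (q * q * q) - Z * Z)) *
        ((1ℚ - y * (q * (Z * (q * q) * (Z * (q * q))))) * (y * (q * q) - Z * (q * q)) * (y - Z * (q * q)) * (y * (q * q * q) - 1ℚ) * (1ℚ - y * (q * q * q * q))) *
        ((1ℚ - y * (q * q * (Z * (q * q)))) * (1ℚ - y * (q * q * Z))) *
        ((1ℚ - q * q * q * q * (Z * Z)) * Ea′ * ((1ℚ - y * (q * q * q * q) * (q * q * Z)) * (y * (q * q * q * q) - q * q * Z)))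
      l = solve-∀ ℚ-ring

    telescoped : ∀ k → k ℕ.≤ N →
      κ * (s * e′ * partialSum q a y⁺ k + t * e * partialSum q a y k) * (Z k * u (Z k)) ≡ t * D * (q * q) * (B k * β (Z k))
    telescoped zero _ = l κ (s * e′) (t * e) (t * D * (q * q)) y q (E a (1ℚ * 1ℚ)) (1ℚ * u (Z 0))
      where
      l : ∀ κ a b C y q e z → κ * (a * 0ℚ + b * 0ℚ) * z ≡ C * (1ℚ * ((1ℚ - 1ℚ * 1ℚ) * (y - 1ℚ) * (1ℚ - q) * e))
      l = solve-∀ ℚ-ring
    telescoped (suc k) k<N =
      telescope-step q (Z k) {u (Z k)} {u₁ (Z k)} {u (Z k)} {u₁ (Z k)} (term q a y k) (term q a y⁺ k) {B k} {B (suc k)} κ s t e e′ (partialSum q a y k) (partialSum q a y⁺ k) D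
        {g (Z k)} {g′ (Z k)} {nB = nB (Z k)} {dB (Z k)}
        (u≢0 k k<N) (term-B k (ℕₚ.<⇒≤ k<N))
        (term⁺-B k k<N) (*-comm (u (Z k)) (u₁ (Z k)))
        (telescoped k (ℕₚ.<⇒≤ k<N))
        (trans (*-assoc (B k) (nB (Z k) / dB (Z k)) (dB (Z k))) (cong (B k *_) (/-* {nB (Z k)} (dB≢0 k k<N))))
        (lβ q a (Z k) y) (identity q a (Z k) y)
      where
      lβ : ∀ q a Z y →
        (1ℚ - y * (q * q * Z)) * ((1ℚ - Z * (q * q) * (Z * (q * q))) * (y - Z * (q * q)) * (Z * (q * q) - q) *
          ((1ℚ - a * (Z * (q * q) * (Z * (q * q)))) * (a - Z * (q * q) * (Z * (q * q))))) ≡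
        q * ((1ℚ - q * q * q * q * (Z * Z)) * ((1ℚ - a * (q * q * q * q * (Z * Z))) * (a - q * q * q * q * (Z * Z))) * ((1ℚ - y * (q * q * Z)) * (y - q * q * Z))) * (q * Z - 1ℚ)
      lβ = solve-∀ ℚ-ring
      identity : ∀ q a Z y →
        Z * (1ℚ - q * (Z * Z * Z)) *
          ((1ℚ - y * (q * (Z * Z))) * (y * (q * q) - Z) * (y - Z) * (y * (q * q * q) - 1ℚ) * ((1ℚ - a * (y * (q * q * q))) * (a - y * (q * q * q))) +
           (1ℚ - y * q) * (y * (q * q * q) - Z * Z) * ((1ℚ - y * (q * q * (Z * (q * q)))) * (1ℚ - y * (q * q * Z))) * - ((1ℚ - a * (y * q)) * (a - y * q))) ≡
        (1ℚ - y * y * (q * q * q * q)) * y *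
          ((1ℚ - q * q * (Z * Z)) * ((1ℚ - a * (q * Z)) * (a - q * Z)) * ((1ℚ - y * (q * (Z * Z))) * (y * (q * q * q) - Z * Z)) * (q * Z - 1ℚ) -
           q * q * (1ℚ - y * (q * q * (Z * (q * q)))) * ((1ℚ - Z * Z) * (y - Z) * (Z - q) * ((1ℚ - a * (Z * Z)) * (a - Z * Z))))
      identity = solve-∀ ℚ-ring

    shift : κ ≢ 0ℚ → u (Z N) ≢ 0ℚ → B N ≡ 0ℚ →
      (1ℚ - y) * e′ * partialSum q a y⁺ N ≡ (1ℚ - y * q⁴) * E a (y * q) * partialSum q a y N
    shift κ≢0 uN≢0 B≡0 = *-cancelˡ (*-nonzero κ≢0 (*-nonzero (^-nonzero N (*-nonzero q≢0 q≢0)) uN≢0)) (x-y≡0⇒x≡y (begin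
      κ * (Z N * u (Z N)) * (s * e′ * partialSum q a y⁺ N) - κ * (Z N * u (Z N)) * (t * E a (y * q) * partialSum q a y N)
        ≡⟨ l κ (Z N * u (Z N)) s e′ (partialSum q a y⁺ N) t (E a (y * q)) (partialSum q a y N) ⟩
      κ * (s * e′ * partialSum q a y⁺ N + t * e * partialSum q a y N) * (Z N * u (Z N))
        ≡⟨ telescoped N ℕₚ.≤-refl ⟩
      t * D * (q * q) * (B N * β (Z N))
        ≡⟨ cong (λ b → t * D * (q * q) * (b * β (Z N))) B≡0 ⟩
      t * D * (q * q) * (0ℚ * β (Z N))
        ≡⟨ l₀ (t * D * (q * q)) (β (Z N)) ⟩
      0ℚ ∎))
      where
      l : ∀ κ Z s e′ S′ t e S →
        κ * Z * (s * e′ * S′) - κ * Z * (t * e * S) ≡ κ * (s * e′ * S′ + t * - e * S) * Z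
      l = solve-∀ ℚ-ring
      l₀ : ∀ a b → a * (0ℚ * b) ≡ 0ℚ
      l₀ = solve-∀ ℚ-ring

-- Lagrange interpolation in a

E-antisym : ∀ a b → E a b ≡ - E b a
E-antisym = l
  where
  l : ∀ a b → (1ℚ - a * b) * (a - b) ≡ - ((1ℚ - b * a) * (b - a))
  l = solve-∀ ℚ-ring

-- With x(t) = t + 1/t this is (x(u) - x(a))(x(v) - x(b)) - (x(u) - x(b))(x(v) - x(a)) = (x(b) -
-- x(a))(x(v) - x(u)), multiplied by abuv.
E-plücker : ∀ a b u v → E a u * E b v - E b u * E a v ≡ E a b * E u v
E-plücker = l
  where
  l : ∀ a b u v → ((1ℚ - a * u) * (a - u)) * ((1ℚ - b * v) * (b - v)) - ((1ℚ - b * u) * (b - u)) * ((1ℚ - a * v) * (a - v))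
    ≡ ((1ℚ - a * b) * (a - b)) * ((1ℚ - u * v) * (u - v))
  l = solve-∀ ℚ-ring

-- Omits the factor j = i from a product over an initial segment without renumbering the indices.
skip : ℕ → ℕ → ℚ → ℚ
skip i j x with i ℕ.≟ j
... | yes _ = 1ℚ
... | no  _ = x

skip-≡ : ∀ i x → skip i i x ≡ 1ℚ
skip-≡ i x with i ℕ.≟ i
... | yes _  = refl
... | no i≢i = ⊥-elim (i≢i refl)

skip-≢ : ∀ {i j} x → i ≢ j → skip i j x ≡ x
skip-≢ {i} {j} x i≢j with i ℕ.≟ j
... | yes i≡j = ⊥-elim (i≢j i≡j)
... | no _    = refl

module Lagrange (u : ℕ → ℚ) where

  ℓ : ℕ → ℕ → ℚ → ℚ
  ℓ n i a = prod n (λ j → skip i j (E a (u j) / E (u i) (u j)))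

  c : ℕ → ℕ → ℚ
  c n i = prod n (λ j → skip i j (inv (E (u i) (u j))))

  P : ℕ → ℚ → ℚ
  P n a = prod n (λ j → E a (u j))

  ℓ-before : ∀ n i a → n ℕ.≤ i → ℓ n i a ≡ P n a * c n i
  ℓ-before zero    i a _   = refl
  ℓ-before (suc n) i a n<i = begin
    ℓ n i a * skip i n (E a (u n) / E (u i) (u n))          ≡⟨ cong₂ _*_ (ℓ-before n i a (ℕₚ.<⇒≤ n<i)) (skip-≢ _ i≢n) ⟩
    P n a * c n i * (E a (u n) / E (u i) (u n))             ≡⟨ l (P n a) (c n i) (E a (u n)) (inv (E (u i) (u n))) ⟩
    P (suc n) a * (c n i * inv (E (u i) (u n)))             ≡⟨ cong (λ x → P (suc n) a * (c n i * x)) (skip-≢ (inv (E (u i) (u n))) i≢n) ⟨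
    P (suc n) a * c (suc n) i                               ∎
    where
    i≢n = λ i≡n → ℕₚ.<⇒≢ n<i (sym i≡n)
    l : ∀ p c x y → p * c * (x * y) ≡ p * x * (c * y)
    l = solve-∀ ℚ-ring

  -- Stated as a product because E(a, u i) may vanish: restoring the omitted factor gives the full
  -- product over the nodes.
  ℓ-after : ∀ n i a → i ℕ.< n → ℓ n i a * E a (u i) ≡ P n a * c n i
  ℓ-after (suc n) i a i<1+n with ℕₚ.m≤n⇒m<n∨m≡n (ℕ.s≤s⁻¹ i<1+n)
  ... | inj₁ i<n = begin
    ℓ n i a * skip i n (E a (u n) / E (u i) (u n)) * E a (u i)  ≡⟨ cong (λ x → ℓ n i a * x * E a (u i)) (skip-≢ (E a (u n) / E (u i) (u n)) (ℕₚ.<⇒≢ i<n)) ⟩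
    ℓ n i a * (E a (u n) / E (u i) (u n)) * E a (u i)           ≡⟨ l (ℓ n i a) (E a (u n)) (inv (E (u i) (u n))) (E a (u i)) ⟩
    ℓ n i a * E a (u i) * (E a (u n) * inv (E (u i) (u n)))     ≡⟨ cong (_* (E a (u n) * inv (E (u i) (u n)))) (ℓ-after n i a i<n) ⟩
    P n a * c n i * (E a (u n) * inv (E (u i) (u n)))           ≡⟨ l′ (P n a) (c n i) (E a (u n)) (inv (E (u i) (u n))) ⟩
    P (suc n) a * (c n i * inv (E (u i) (u n)))                 ≡⟨ cong (λ x → P (suc n) a * (c n i * x)) (skip-≢ (inv (E (u i) (u n))) (ℕₚ.<⇒≢ i<n)) ⟨
    P (suc n) a * c (suc n) i                                   ∎
    where
    l : ∀ p x y z → p * (x * y) * z ≡ p * z * (x * y)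
    l = solve-∀ ℚ-ring
    l′ : ∀ p c x y → p * c * (x * y) ≡ p * x * (c * y)
    l′ = solve-∀ ℚ-ring
  ... | inj₂ refl = begin
    ℓ n n a * skip n n (E a (u n) / E (u n) (u n)) * E a (u n)  ≡⟨ cong₂ (λ x y → x * y * E a (u n)) (ℓ-before n n a ℕₚ.≤-refl) (skip-≡ n (E a (u n) / E (u n) (u n))) ⟩
    P n a * c n n * 1ℚ * E a (u n)                              ≡⟨ l (P n a) (c n n) (E a (u n)) ⟩
    P (suc n) a * (c n n * 1ℚ)                                  ≡⟨ cong (λ x → P (suc n) a * (c n n * x)) (skip-≡ n (inv (E (u n) (u n)))) ⟨
    P (suc n) a * c (suc n) n                                   ∎
    where
    l : ∀ p c x → p * c * 1ℚ * x ≡ p * x * (c * 1ℚ)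
    l = solve-∀ ℚ-ring

  Distinct : ℕ → Set
  Distinct n = ∀ i j → i ℕ.< n → j ℕ.< n → i ≢ j → E (u i) (u j) ≢ 0ℚ

  -- In x = a + 1/a this is interpolation of a polynomial of degree at most n at n + 1 nodes,
  -- multiplied by aⁿ. Products of n values of `E` suffice as interpolated functions, and they allow
  -- an induction that adds one factor and one node at a time.
  interpolation : ∀ n (z : ℕ → ℚ) → Distinct (suc n) → ∀ a →
    prod n (λ l → E a (z l)) ≡ sum (suc n) (λ i → prod n (λ l → E (u i) (z l)) * ℓ (suc n) i a)
  interpolation zero z _ a = sym (l (skip 0 0 (E a (u 0) / E (u 0) (u 0))) (skip-≡ 0 (E a (u 0) / E (u 0) (u 0))))
    where
    l : ∀ x → x ≡ 1ℚ → 0ℚ + 1ℚ * (1ℚ * x) ≡ 1ℚ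
    l _ refl = refl
  interpolation (suc n) z distinct a = begin
    F a * E a zₙ
      ≡⟨ cong (_* E a zₙ) (interpolation n z distinct′ a) ⟩
    sum N (λ i → F (u i) * ℓ N i a) * E a zₙ
      ≡⟨ *-comm (sum N (λ i → F (u i) * ℓ N i a)) (E a zₙ) ⟩
    E a zₙ * sum N (λ i → F (u i) * ℓ N i a)
      ≡⟨ sum-*ˡ N (E a zₙ) (λ i → F (u i) * ℓ N i a) ⟨
    sum N (λ i → E a zₙ * (F (u i) * ℓ N i a))
      -- The Plücker relation for a, u i, z n and the new node w splits the new factor: one part
      -- lengthens the basis function of u i, the other is its value at w. By the induction
      -- hypothesis at w, the latter add up to the contribution of the node w.
      ≡⟨ sum-cong N split ⟩
    sum N (λ i → F (u i) * E (u i) zₙ * ℓ (suc N) i a + E w zₙ * R * (F (u i) * ℓ N i w))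
      ≡⟨ sum-+ N (λ i → F (u i) * E (u i) zₙ * ℓ (suc N) i a) (λ i → E w zₙ * R * (F (u i) * ℓ N i w)) ⟩
    main + sum N (λ i → E w zₙ * R * (F (u i) * ℓ N i w))
      ≡⟨ cong (main +_) (sum-*ˡ N (E w zₙ * R) (λ i → F (u i) * ℓ N i w)) ⟩
    main + E w zₙ * R * sum N (λ i → F (u i) * ℓ N i w)
      ≡⟨ cong (λ x → main + E w zₙ * R * x) (interpolation n z distinct′ w) ⟨
    main + E w zₙ * R * F w
      ≡⟨ cong (main +_) (l₁ (E w zₙ) R (F w)) ⟩
    main + F w * E w zₙ * (R * 1ℚ)
      ≡⟨ cong₂ (λ x y → main + F w * E w zₙ * (x * y)) R≡ (sym (skip-≡ N (E a w / E w w))) ⟩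
    main + F w * E w zₙ * ℓ (suc N) N a ∎
    where
    N = suc n
    w = u N
    zₙ = z n
    F : ℚ → ℚ
    F b = prod n (λ l → E b (z l))
    R = P N a / P N w
    main = sum N (λ i → F (u i) * E (u i) zₙ * ℓ (suc N) i a)
    distinct′ : Distinct N
    distinct′ i j i<N j<N = distinct i j (ℕₚ.m<n⇒m<1+n i<N) (ℕₚ.m<n⇒m<1+n j<N)
    w≢ : ∀ j → j ℕ.< N → E w (u j) ≢ 0ℚ
    w≢ j j<N = distinct N j ℕₚ.≤-refl (ℕₚ.m<n⇒m<1+n j<N) (λ N≡j → ℕₚ.<⇒≢ j<N (sym N≡j))
    ≢w : ∀ i → i ℕ.< N → E (u i) w ≢ 0ℚ
    ≢w i i<N = distinct i N (ℕₚ.m<n⇒m<1+n i<N) ℕₚ.≤-refl (ℕₚ.<⇒≢ i<N)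
    Pw≢0 : P N w ≢ 0ℚ
    Pw≢0 = prod-nonzero N w≢
    l₁ : ∀ e r f → e * r * f ≡ f * e * (r * 1ℚ)
    l₁ = solve-∀ ℚ-ring
    R≡ : R ≡ ℓ N N a
    R≡ = sym (trans (prod-cong N (λ j j<N → skip-≢ (E a (u j) / E w (u j)) (λ N≡j → ℕₚ.<⇒≢ j<N (sym N≡j))))
                    (prod-/ N w≢))
    split : ∀ i → i ℕ.< N →
      E a zₙ * (F (u i) * ℓ N i a) ≡ F (u i) * E (u i) zₙ * ℓ (suc N) i a + E w zₙ * R * (F (u i) * ℓ N i w)
    split i i<N = *-cancelˡ (≢w i i<N) (x-y≡0⇒x≡y (begin
      b * (E a zₙ * (f * ℓ N i a)) - b * (f * E (u i) zₙ * ℓ (suc N) i a + E w zₙ * R * (f * ℓ N i w))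
        ≡⟨ cong (λ x → b * (E a zₙ * (f * ℓ N i a)) - b * (f * E (u i) zₙ * (ℓ N i a * x) + E w zₙ * R * (f * ℓ N i w)))
             (skip-≢ (E a w / b) (ℕₚ.<⇒≢ i<N)) ⟩
      b * (E a zₙ * (f * ℓ N i a)) - b * (f * E (u i) zₙ * (ℓ N i a * (E a w / b)) + E w zₙ * R * (f * ℓ N i w))
        ≡⟨ l₂ b (E a zₙ) f (ℓ N i a) (E (u i) zₙ) (E a w) (inv b) (E w zₙ) R (ℓ N i w) ⟩
      f * (ℓ N i a * (E a zₙ * b - E (u i) zₙ * (E a w * (b * inv b))) - ℓ N i w * b * E w zₙ * R)
        ≡⟨ cong (λ x → f * (ℓ N i a * (E a zₙ * b - E (u i) zₙ * x) - ℓ N i w * b * E w zₙ * R))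
             (trans (cong (E a w *_) (*-inv (≢w i i<N))) (*-identityʳ (E a w))) ⟩
      f * (ℓ N i a * (E a zₙ * b - E (u i) zₙ * E a w) - ℓ N i w * b * E w zₙ * R)
        ≡⟨ cong₂ (λ x y → f * (ℓ N i a * x - ℓ N i w * b * y * R)) (E-plücker a (u i) zₙ w) (E-antisym w zₙ) ⟩
      f * (ℓ N i a * (E a (u i) * E zₙ w) - ℓ N i w * b * - E zₙ w * R)
        ≡⟨ cong (λ x → f * (ℓ N i a * (E a (u i) * E zₙ w) - ℓ N i w * x * - E zₙ w * R)) (E-antisym (u i) w) ⟩
      f * (ℓ N i a * (E a (u i) * E zₙ w) - ℓ N i w * - E w (u i) * - E zₙ w * R)
        ≡⟨ l₃ f (ℓ N i a) (E a (u i)) (E zₙ w) (ℓ N i w) (E w (u i)) R ⟩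
      f * E zₙ w * (ℓ N i a * E a (u i) - ℓ N i w * E w (u i) * R)
        ≡⟨ cong₂ (λ x y → f * E zₙ w * (x - y * R)) (ℓ-after N i a i<N) (ℓ-after N i w i<N) ⟩
      f * E zₙ w * (P N a * c N i - P N w * c N i * (P N a * inv (P N w)))
        ≡⟨ l₄ f (E zₙ w) (P N a) (c N i) (P N w) (inv (P N w)) ⟩
      f * E zₙ w * P N a * c N i * (1ℚ - P N w * inv (P N w))
        ≡⟨ cong (λ x → f * E zₙ w * P N a * c N i * (1ℚ - x)) (*-inv Pw≢0) ⟩
      f * E zₙ w * P N a * c N i * (1ℚ - 1ℚ)
        ≡⟨ *-zeroʳ (f * E zₙ w * P N a * c N i) ⟩
      0ℚ ∎))
      where
      f = F (u i)
      b = E (u i) w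
      l₂ : ∀ b eaz f la eiz eaw ib ewz r lw →
        b * (eaz * (f * la)) - b * (f * eiz * (la * (eaw * ib)) + ewz * r * (f * lw)) ≡
        f * (la * (eaz * b - eiz * (eaw * (b * ib))) - lw * b * ewz * r)
      l₂ = solve-∀ ℚ-ring
      l₃ : ∀ f la eai ezw lw ewi r →
        f * (la * (eai * ezw) - lw * - ewi * - ezw * r) ≡ f * ezw * (la * eai - lw * ewi * r)
      l₃ = solve-∀ ℚ-ring
      l₄ : ∀ f e p c w i → f * e * (p * c - w * c * (p * i)) ≡ f * e * p * c * (1ℚ - w * i)
      l₄ = solve-∀ ℚ-ring

-- The a-dependence of the k-th summand is a product of k factors E a (Q j) / E a (p j),
-- so clearing the poles p j leaves a product to which interpolation applies.
splitNode : (Q p : ℕ → ℚ) → ℕ → ℕ → ℚ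
splitNode Q p k l with l ℕ.<? k
... | yes _ = Q l
... | no  _ = p l

prod-splitNode : ∀ Q p a k r →
  prod (k ℕ.+ r) (λ l → E a (splitNode Q p k l)) ≡ prod k (λ l → E a (Q l)) * prod r (λ l → E a (p (k ℕ.+ l)))
prod-splitNode Q p a k r = trans (prod-+ k r (λ l → E a (splitNode Q p k l)))
  (cong₂ _*_ (prod-cong k (λ l l<k → cong (E a) (low l l<k))) (prod-cong r (λ l _ → cong (E a) (high l))))
  where
  low : ∀ l → l ℕ.< k → splitNode Q p k l ≡ Q l
  low l l<k with l ℕ.<? k
  ... | yes _  = refl
  ... | no l≮k = ⊥-elim (l≮k l<k)
  high : ∀ l → splitNode Q p k (k ℕ.+ l) ≡ p (k ℕ.+ l)
  high l with k ℕ.+ l ℕ.<? k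
  ... | yes lt = ⊥-elim (ℕₚ.<⇒≱ lt (ℕₚ.m≤m+n k l))
  ... | no _   = refl

module _ (q y : ℚ) where

  private
    Z : ℕ → ℚ
    Z k = (q * q) ^ k

  node pole : ℕ → ℚ
  node j = q * Z j
  pole j = q * q * q * q * (Z j * Z j)

  open Lagrange node

  coeffNum coeffDen : ℕ → ℚ
  coeffNum j = q * q * (1ℚ - q * q * (Z j * Z j)) * E y (q * (Z j * Z j))
  coeffDen j = (1ℚ - pole j) * E y (q * q * Z j)

  poles : ℕ → ℚ → ℚ
  poles n a = prod n (λ j → E a (pole j))

  term-poles : ∀ a k r → (∀ j → j ℕ.< k → coeffDen j ≢ 0ℚ) → (∀ j → j ℕ.< k → E a (pole j) ≢ 0ℚ) →
    poles (k ℕ.+ r) a * term q a y k ≡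
    prod k (λ j → coeffNum j / coeffDen j) * prod (k ℕ.+ r) (λ l → E a (splitNode node pole k l))
  term-poles a k r d≢0 e≢0 = begin
    poles (k ℕ.+ r) a * term q a y k
      ≡⟨ cong₂ _*_ (prod-+ k r (λ j → E a (pole j))) (trans (prod-cong k factor) (trans (prod-* k (λ j → coeffNum j / coeffDen j) (λ j → E a (node j) / E a (pole j)))
           (cong (prod k (λ j → coeffNum j / coeffDen j) *_) (prod-/ k e≢0)))) ⟩
    poles k a * rest * (prod k (λ j → coeffNum j / coeffDen j) * (P k a / poles k a))
      ≡⟨ l₁ (poles k a) rest (prod k (λ j → coeffNum j / coeffDen j)) (P k a) (inv (poles k a)) ⟩
    prod k (λ j → coeffNum j / coeffDen j) * (P k a * rest) * (poles k a * inv (poles k a))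
      ≡⟨ cong (prod k (λ j → coeffNum j / coeffDen j) * (P k a * rest) *_) (*-inv (prod-nonzero k e≢0)) ⟩
    prod k (λ j → coeffNum j / coeffDen j) * (P k a * rest) * 1ℚ
      ≡⟨ *-identityʳ (prod k (λ j → coeffNum j / coeffDen j) * (P k a * rest)) ⟩
    prod k (λ j → coeffNum j / coeffDen j) * (P k a * rest)
      ≡⟨ cong (prod k (λ j → coeffNum j / coeffDen j) *_) (prod-splitNode node pole a k r) ⟨
    prod k (λ j → coeffNum j / coeffDen j) * prod (k ℕ.+ r) (λ l → E a (splitNode node pole k l)) ∎
    where
    rest = prod r (λ l → E a (pole (k ℕ.+ l)))
    l₁ : ∀ p r c m i → p * r * (c * (m * i)) ≡ c * (m * r) * (p * i)
    l₁ = solve-∀ ℚ-ring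
    factor : ∀ j → j ℕ.< k →
      ratioNum q a y (Z j) / ratioDen q a y (Z j) ≡ coeffNum j / coeffDen j * (E a (node j) / E a (pole j))
    factor j j<k = trans
      (cong₂ (λ x z → x * inv z) (l₂ (q * q * (1ℚ - q * q * (Z j * Z j))) (E a (node j)) (E y (q * (Z j * Z j))))
         (l₂ (1ℚ - pole j) (E a (pole j)) (E y (q * q * Z j))))
      (sym (/-*-/ {coeffNum j} {z = E a (node j)} (d≢0 j j<k) (e≢0 j j<k)))
      where
      l₂ : ∀ x y z → x * y * z ≡ x * z * y
      l₂ = solve-∀ ℚ-ring

  -- The summand of index k has its poles in a among the first k, so `poles n` clears all summands
  -- with k ≤ n. Each cleared summand is a product of n factors `E a`, one fewer than there are
  -- nodes.
  partialSum-interpolation : ∀ n → Distinct (suc n) →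
    (∀ j → j ℕ.< n → coeffDen j ≢ 0ℚ) →
    (∀ i j → i ℕ.< suc n → j ℕ.< n → E (node i) (pole j) ≢ 0ℚ) →
    ∀ a → (∀ j → j ℕ.< n → E a (pole j) ≢ 0ℚ) →
    poles n a * partialSum q a y (suc n) ≡
    sum (suc n) (λ i → poles n (node i) * partialSum q (node i) y (suc n) * ℓ (suc n) i a)
  partialSum-interpolation n distinct d≢0 p≢0 a a≢0 = begin
    poles n a * sum N (λ k → w k * term q a y k)
      ≡⟨ sum-*ˡ N (poles n a) (λ k → w k * term q a y k) ⟨
    sum N (λ k → poles n a * (w k * term q a y k))
      ≡⟨ sum-cong N interpolated ⟩
    sum N (λ k → sum N (λ i → poles n (node i) * (w k * term q (node i) y k) * ℓ N i a))
      ≡⟨ sum-swap N N (λ k i → poles n (node i) * (w k * term q (node i) y k) * ℓ N i a) ⟩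
    sum N (λ i → sum N (λ k → poles n (node i) * (w k * term q (node i) y k) * ℓ N i a))
      ≡⟨ sum-cong N (λ i _ → collect i) ⟩
    sum N (λ i → poles n (node i) * partialSum q (node i) y N * ℓ N i a) ∎
    where
    N = suc n
    w : ℕ → ℚ
    w k = 1ℚ - q * (Z k * Z k * Z k)
    sum-swap : ∀ m n (f : ℕ → ℕ → ℚ) → sum m (λ k → sum n (f k)) ≡ sum n (λ i → sum m (λ k → f k i))
    sum-swap zero    n f = sym (sum-zero n (λ _ _ → refl))
    sum-swap (suc m) n f = trans (cong (_+ sum n (f m)) (sum-swap m n f))
      (sym (sum-+ n (λ i → sum m (λ k → f k i)) (f m)))
    collect : ∀ i → sum N (λ k → poles n (node i) * (w k * term q (node i) y k) * ℓ N i a) ≡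
      poles n (node i) * partialSum q (node i) y N * ℓ N i a
    collect i = begin
      sum N (λ k → poles n (node i) * (w k * term q (node i) y k) * ℓ N i a)
        ≡⟨ sum-cong N (λ k _ → l₁ (poles n (node i)) (w k * term q (node i) y k) (ℓ N i a)) ⟩
      sum N (λ k → poles n (node i) * ℓ N i a * (w k * term q (node i) y k))
        ≡⟨ sum-*ˡ N (poles n (node i) * ℓ N i a) (λ k → w k * term q (node i) y k) ⟩
      poles n (node i) * ℓ N i a * partialSum q (node i) y N
        ≡⟨ l₁ (poles n (node i)) (partialSum q (node i) y N) (ℓ N i a) ⟨
      poles n (node i) * partialSum q (node i) y N * ℓ N i a ∎
      where
      l₁ : ∀ x y z → x * y * z ≡ x * z * y
      l₁ = solve-∀ ℚ-ring
    pole-term : ∀ b k r → k ℕ.+ r ≡ n → (∀ j → j ℕ.< n → E b (pole j) ≢ 0ℚ) →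
      poles n b * (w k * term q b y k) ≡
      w k * prod k (λ j → coeffNum j / coeffDen j) * prod n (λ l → E b (splitNode node pole k l))
    pole-term b k r refl b≢0 = begin
      poles n b * (w k * term q b y k)   ≡⟨ l₁ (poles n b) (w k) (term q b y k) ⟩
      w k * (poles n b * term q b y k)
        ≡⟨ cong (w k *_) (term-poles b k r (λ j j<k → d≢0 j (ℕₚ.m≤n⇒m≤n+o r j<k)) (λ j j<k → b≢0 j (ℕₚ.m≤n⇒m≤n+o r j<k))) ⟩
      w k * (prod k (λ j → coeffNum j / coeffDen j) * prod n (λ l → E b (splitNode node pole k l)))
        ≡⟨ *-assoc (w k) (prod k (λ j → coeffNum j / coeffDen j)) (prod n (λ l → E b (splitNode node pole k l))) ⟨
      w k * prod k (λ j → coeffNum j / coeffDen j) * prod n (λ l → E b (splitNode node pole k l)) ∎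
      where
      l₁ : ∀ x y z → x * (y * z) ≡ y * (x * z)
      l₁ = solve-∀ ℚ-ring
    interpolated : ∀ k → k ℕ.< N →
      poles n a * (w k * term q a y k) ≡ sum N (λ i → poles n (node i) * (w k * term q (node i) y k) * ℓ N i a)
    interpolated k k<N = begin
      poles n a * (w k * term q a y k)
        ≡⟨ pole-term a k (n ℕ.∸ k) k+r a≢0 ⟩
      γ * F a
        ≡⟨ cong (γ *_) (interpolation n (splitNode node pole k) distinct a) ⟩
      γ * sum N (λ i → F (node i) * ℓ N i a)
        ≡⟨ sum-*ˡ N γ (λ i → F (node i) * ℓ N i a) ⟨
      sum N (λ i → γ * (F (node i) * ℓ N i a))
        ≡⟨ sum-cong N (λ i i<N → trans (sym (*-assoc γ (F (node i)) (ℓ N i a)))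
             (cong (_* ℓ N i a) (sym (pole-term (node i) k (n ℕ.∸ k) k+r (λ j → p≢0 i j i<N))))) ⟩
      sum N (λ i → poles n (node i) * (w k * term q (node i) y k) * ℓ N i a) ∎
      where
      k+r = ℕₚ.m+[n∸m]≡n (ℕ.s≤s⁻¹ k<N)
      γ = w k * prod k (λ j → coeffNum j / coeffDen j)
      F : ℚ → ℚ
      F b = prod n (λ l → E b (splitNode node pole k l))

-- Polynomial functions and density

ι : ℕ → ℚ
ι zero    = 0ℚ
ι (suc k) = 1ℚ + ι k

ι-nonNeg : ∀ k → ℚ.NonNegative (ι k)
ι-pos : ∀ k → ℚ.Positive (ι (suc k))
ι-nonNeg zero    = _
ι-nonNeg (suc k) = ℚₚ.pos⇒nonNeg (ι (suc k)) {{ι-pos k}}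
ι-pos k = ℚₚ.pos+nonNeg⇒pos 1ℚ (ι k) {{ι-nonNeg k}}

ι-suc≢0 : ∀ k → ι (suc k) ≢ 0ℚ
ι-suc≢0 k eq = ℚₚ.<⇒≢ (ℚₚ.positive⁻¹ (ι (suc k)) {{ι-pos k}}) (sym eq)

ι-injective : ∀ {k l} → ι k ≡ ι l → k ≡ l
ι-injective {zero}  {zero}  _  = refl
ι-injective {zero}  {suc l} eq = ⊥-elim (ι-suc≢0 l (sym eq))
ι-injective {suc k} {zero}  eq = ⊥-elim (ι-suc≢0 k eq)
ι-injective {suc k} {suc l} eq = cong suc (ι-injective (trans (lem (ι k)) (trans (cong (- 1ℚ +_) eq) (sym (lem (ι l))))))
  where
  lem : ∀ x → x ≡ - 1ℚ + (1ℚ + x)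
  lem = solve-∀ ℚ-ring

ι-+ : ∀ k l → ι (k ℕ.+ l) ≡ ι k + ι l
ι-+ zero    l = sym (+-identityˡ (ι l))
ι-+ (suc k) l = trans (cong (1ℚ +_) (ι-+ k l)) (sym (+-assoc 1ℚ (ι k) (ι l)))

ι-* : ∀ k l → ι (k ℕ.* l) ≡ ι k * ι l
ι-* zero    l = sym (*-zeroˡ (ι l))
ι-* (suc k) l = trans (ι-+ l (k ℕ.* l)) (trans (cong (ι l +_) (ι-* k l)) (lem (ι k) (ι l)))
  where
  lem : ∀ x y → y + x * y ≡ (1ℚ + x) * y
  lem = solve-∀ ℚ-ring

ι-^ : ∀ k e → ι (k ℕ.^ e) ≡ ι k ^ e
ι-^ k zero    = refl
ι-^ k (suc e) = trans (ι-* k (k ℕ.^ e)) (trans (cong (ι k *_) (ι-^ k e)) (*-comm (ι k) (ι k ^ e)))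

Injective : (ℕ → ℚ) → Set
Injective τ = ∀ {k l} → τ k ≡ τ l → k ≡ l

-- The index counts coefficients, so the degree is less than d.
PolyFun : ℕ → (ℚ → ℚ) → Set
PolyFun zero    f = ∀ t → f t ≡ 0ℚ
PolyFun (suc d) f = Σ ℚ λ c → Σ (ℚ → ℚ) λ g → PolyFun d g × (∀ t → f t ≡ c + t * g t)

PolyFun-cong : ∀ d {f g} → (∀ t → f t ≡ g t) → PolyFun d f → PolyFun d g
PolyFun-cong zero    eq pf t           = trans (sym (eq t)) (pf t)
PolyFun-cong (suc d) eq (c , h , ph , e) = c , h , ph , λ t → trans (sym (eq t)) (e t)

PolyFun-zero : ∀ d → PolyFun d (λ _ → 0ℚ)
PolyFun-zero zero    t = refl
PolyFun-zero (suc d) = 0ℚ , (λ _ → 0ℚ) , PolyFun-zero d , lem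
  where
  lem : ∀ t → 0ℚ ≡ 0ℚ + t * 0ℚ
  lem = solve-∀ ℚ-ring

PolyFun-const : ∀ d c → PolyFun (suc d) (λ _ → c)
PolyFun-const d c = c , (λ _ → 0ℚ) , PolyFun-zero d , lem c
  where
  lem : ∀ c t → c ≡ c + t * 0ℚ
  lem = solve-∀ ℚ-ring

PolyFun-shift : ∀ d {f} → PolyFun d f → PolyFun (suc d) (λ t → t * f t)
PolyFun-shift d {f} pf = 0ℚ , f , pf , λ t → sym (+-identityˡ (t * f t))

PolyFun-suc : ∀ d {f} → PolyFun d f → PolyFun (suc d) f
PolyFun-suc zero    {f} pf = PolyFun-cong 1 {λ _ → 0ℚ} (λ t → sym (pf t)) (PolyFun-zero 1)
PolyFun-suc (suc d) (c , g , pg , e) = c , g , PolyFun-suc d pg , e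

PolyFun-weaken : ∀ e d {f} → PolyFun d f → PolyFun (e ℕ.+ d) f
PolyFun-weaken zero    d pf = pf
PolyFun-weaken (suc e) d pf = PolyFun-suc (e ℕ.+ d) (PolyFun-weaken e d pf)

PolyFun-+ : ∀ d {f g} → PolyFun d f → PolyFun d g → PolyFun d (λ t → f t + g t)
PolyFun-+ zero    pf pg t = cong₂ _+_ (pf t) (pg t)
PolyFun-+ (suc d) {f} {g} (a , f′ , pf , ef) (b , g′ , pg , eg) =
  a + b , (λ t → f′ t + g′ t) , PolyFun-+ d pf pg , λ t → trans (cong₂ _+_ (ef t) (eg t)) (lem a b t (f′ t) (g′ t))
  where
  lem : ∀ a b t x y → a + t * x + (b + t * y) ≡ a + b + t * (x + y)
  lem = solve-∀ ℚ-ring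

PolyFun-scale : ∀ d c {f} → PolyFun d f → PolyFun d (λ t → c * f t)
PolyFun-scale zero    c pf t = trans (cong (c *_) (pf t)) (*-zeroʳ c)
PolyFun-scale (suc d) c {f} (a , f′ , pf , ef) =
  c * a , (λ t → c * f′ t) , PolyFun-scale d c pf , λ t → trans (cong (c *_) (ef t)) (lem a c t (f′ t))
  where
  lem : ∀ a c t x → c * (a + t * x) ≡ c * a + t * (c * x)
  lem = solve-∀ ℚ-ring

PolyFun-* : ∀ d e {f g} → PolyFun d f → PolyFun e g → PolyFun (d ℕ.+ e) (λ t → f t * g t)
PolyFun-* zero    e {f} {g} pf pg = PolyFun-cong e {λ _ → 0ℚ} (λ t → sym (trans (cong (_* g t) (pf t)) (*-zeroˡ (g t)))) (PolyFun-zero e)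
PolyFun-* (suc d) e {f} {g} (a , f′ , pf , ef) pg =
  PolyFun-cong (suc d ℕ.+ e) {λ t → a * g t + t * (f′ t * g t)} (λ t → trans (lem a (g t) t (f′ t)) (cong (_* g t) (sym (ef t))))
    (PolyFun-+ (suc d ℕ.+ e) (PolyFun-scale (suc d ℕ.+ e) a (PolyFun-weaken (suc d) e pg)) (PolyFun-shift (d ℕ.+ e) (PolyFun-* d e pf pg)))
  where
  lem : ∀ a g t f → a * g + t * (f * g) ≡ (a + t * f) * g
  lem = solve-∀ ℚ-ring

factor-root : ∀ d {f} → PolyFun (suc d) f → ∀ s →
  Σ (ℚ → ℚ) λ g → PolyFun d g × (∀ t → f t - f s ≡ (t - s) * g t)
factor-root zero {f} (c , f′ , pf , ef) s = f′ , pf , λ t → begin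
  f t - f s                     ≡⟨ cong₂ _-_ (ef t) (ef s) ⟩
  c + t * f′ t - (c + s * f′ s) ≡⟨ cong₂ (λ x y → c + t * x - (c + s * y)) (pf t) (pf s) ⟩
  c + t * 0ℚ - (c + s * 0ℚ)     ≡⟨ lem c t s ⟩
  (t - s) * 0ℚ                  ≡⟨ cong ((t - s) *_) (pf t) ⟨
  (t - s) * f′ t                ∎
  where
  lem : ∀ c t s → c + t * 0ℚ - (c + s * 0ℚ) ≡ (t - s) * 0ℚ
  lem = solve-∀ ℚ-ring
factor-root (suc d) {f} (c , f′ , pf , ef) s with factor-root d pf s
... | g , pg , eg = (λ t → f′ t + s * g t) ,
  PolyFun-+ (suc d) pf (PolyFun-scale (suc d) s (PolyFun-suc d pg)) , λ t → begin
  f t - f s                            ≡⟨ cong₂ _-_ (ef t) (ef s) ⟩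
  c + t * f′ t - (c + s * f′ s)        ≡⟨ l₁ c t s (f′ t) (f′ s) ⟩
  (t - s) * f′ t + s * (f′ t - f′ s)   ≡⟨ cong (λ x → (t - s) * f′ t + s * x) (eg t) ⟩
  (t - s) * f′ t + s * ((t - s) * g t) ≡⟨ l₂ (t - s) (f′ t) s (g t) ⟩
  (t - s) * (f′ t + s * g t)           ∎
  where
  l₁ : ∀ c t s x y → c + t * x - (c + s * y) ≡ (t - s) * x + s * (x - y)
  l₁ = solve-∀ ℚ-ring
  l₂ : ∀ u x s y → u * x + s * (u * y) ≡ u * (x + s * y)
  l₂ = solve-∀ ℚ-ring

vanishing : ∀ d {f} → PolyFun d f → ∀ {τ} → Injective τ → (∀ k → f (τ k) ≡ 0ℚ) → ∀ t → f t ≡ 0ℚ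
vanishing zero    pf τ-inj z t = pf t
vanishing (suc d) {f} pf {τ} τ-inj z t with factor-root d pf (τ 0)
... | g , pg , eg = begin
  f t              ≡⟨ factored t ⟩
  (t - τ 0) * g t  ≡⟨ cong ((t - τ 0) *_) (vanishing d pg {λ k → τ (suc k)} (λ eq → ℕₚ.suc-injective (τ-inj eq)) zg t) ⟩
  (t - τ 0) * 0ℚ   ≡⟨ *-zeroʳ (t - τ 0) ⟩
  0ℚ               ∎
  where
  l : ∀ x → x ≡ x - 0ℚ
  l = solve-∀ ℚ-ring
  factored : ∀ t → f t ≡ (t - τ 0) * g t
  factored t = trans (l (f t)) (trans (cong (λ x → f t - x) (sym (z 0))) (eg t))
  zg : ∀ k → g (τ (suc k)) ≡ 0ℚ
  zg k = *-cancelˡ (≢⇒-≢0 (λ eq → ℕₚ.1+n≢0 (τ-inj eq)))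
    (trans (sym (factored (τ (suc k)))) (trans (z (suc k)) (sym (*-zeroʳ (τ (suc k) - τ 0)))))

agreement : ∀ d e {f g} → PolyFun d f → PolyFun e g → ∀ {τ} → Injective τ → (∀ k → f (τ k) ≡ g (τ k)) → ∀ t → f t ≡ g t
agreement d e {f} {g} pf pg {τ} τ-inj eq t = x-y≡0⇒x≡y (trans (l (f t) (g t))
  (vanishing (e ℕ.+ d) {λ t → f t + - 1ℚ * g t}
    (PolyFun-+ (e ℕ.+ d) (PolyFun-weaken e d pf) (subst (λ m → PolyFun m (λ t → - 1ℚ * g t)) (ℕₚ.+-comm d e) (PolyFun-weaken d e (PolyFun-scale e (- 1ℚ) pg))))
    τ-inj (λ k → trans (sym (l (f (τ k)) (g (τ k)))) (x≡y⇒x-y≡0 (eq k))) t))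
  where
  l : ∀ x y → x - y ≡ x + - 1ℚ * y
  l = solve-∀ ℚ-ring

PolyFun-^ : ∀ d e {f} → PolyFun d f → PolyFun (e ℕ.+ d) (λ t → t ^ e * f t)
PolyFun-^ d zero    {f} pf = PolyFun-cong d (λ t → sym (*-identityˡ (f t))) pf
PolyFun-^ d (suc e) {f} pf = PolyFun-cong (suc e ℕ.+ d) (λ t → l t (t ^ e) (f t)) (PolyFun-shift (e ℕ.+ d) (PolyFun-^ d e pf))
  where
  l : ∀ t p x → t * (p * x) ≡ p * t * x
  l = solve-∀ ℚ-ring

-- Coefficients have to be recovered from values: the constant term is the value at 0, and the
-- quotient by t vanishes off 0, hence everywhere, having infinitely many zeros.
leading-zero : ∀ m {r} a → PolyFun m r → (∀ t → a * t ^ m + r t ≡ 0ℚ) → a ≡ 0ℚ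
leading-zero zero    {r} a pr eq = trans (l a) (trans (cong (a * 1ℚ +_) (sym (pr 0ℚ))) (eq 0ℚ))
  where
  l : ∀ a → a ≡ a * 1ℚ + 0ℚ
  l = solve-∀ ℚ-ring
leading-zero (suc m) {r} a (c , s , ps , e) eq = leading-zero m a ps (vanishing (suc m) {f}
    (PolyFun-+ (suc m) {λ t → a * t ^ m} (PolyFun-scale (suc m) a (PolyFun-cong (suc m) (λ t → *-identityʳ (t ^ m))
       (subst (λ k → PolyFun k (λ t → t ^ m * 1ℚ)) (ℕₚ.+-comm m 1) (PolyFun-^ 1 m (PolyFun-const 0 1ℚ))))) (PolyFun-suc m ps))
    {λ k → ι (suc k)} (λ eq → ℕₚ.suc-injective (ι-injective eq)) λ k → off (ι (suc k)) (ι-suc≢0 k))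
  where
  f : ℚ → ℚ
  f t = a * t ^ m + s t
  l₁ : ∀ a p c x → c ≡ a * (p * 0ℚ) + (c + 0ℚ * x)
  l₁ = solve-∀ ℚ-ring
  c≡0 : c ≡ 0ℚ
  c≡0 = trans (l₁ a (0ℚ ^ m) c (s 0ℚ)) (trans (cong (a * 0ℚ ^ suc m +_) (sym (e 0ℚ))) (eq 0ℚ))
  l₂ : ∀ a p t x → t * (a * p + x) ≡ a * (p * t) + (0ℚ + t * x)
  l₂ = solve-∀ ℚ-ring
  off : ∀ t → t ≢ 0ℚ → f t ≡ 0ℚ
  off t t≢0 = *-cancelˡ t≢0 (begin
    t * f t                               ≡⟨ l₂ a (t ^ m) t (s t) ⟩
    a * (t ^ m * t) + (0ℚ + t * s t)      ≡⟨ cong (λ c → a * (t ^ m * t) + (c + t * s t)) c≡0 ⟨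
    a * (t ^ m * t) + (c + t * s t)       ≡⟨ cong (a * (t ^ m * t) +_) (e t) ⟨
    a * (t ^ m * t) + r t                 ≡⟨ eq t ⟩
    0ℚ                                    ≡⟨ *-zeroʳ t ⟨
    t * 0ℚ                                ∎)

-- `PolyFun` only bounds the degree; the exact one is found by testing coefficients against 0 from
-- the top.
leading : ∀ d {f} → PolyFun d f → (∀ t → f t ≡ 0ℚ) ⊎
  Σ ℕ λ m → Σ ℚ λ a → Σ (ℚ → ℚ) λ r → a ≢ 0ℚ × PolyFun m r × (∀ t → f t ≡ a * t ^ m + r t)
leading zero pf = inj₁ pf
leading (suc d) {f} (c , g , pg , e) with leading d pg
... | inj₂ (m , a , r , a≢0 , pr , eg) = inj₂ (suc m , a , (λ t → c + t * r t) , a≢0 , (c , r , pr , λ _ → refl) ,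
        λ t → trans (e t) (trans (cong (λ x → c + t * x) (eg t)) (l c t a (t ^ m) (r t))))
  where
  l : ∀ c t a p r → c + t * (a * p + r) ≡ a * (p * t) + (c + t * r)
  l = solve-∀ ℚ-ring
... | inj₁ zg with c ≟ 0ℚ
...   | yes c≡0 = inj₁ λ t → trans (e t) (trans (cong₂ (λ c x → c + t * x) c≡0 (zg t)) (l t))
  where
  l : ∀ t → 0ℚ + t * 0ℚ ≡ 0ℚ
  l = solve-∀ ℚ-ring
...   | no c≢0  = inj₂ (0 , c , (λ _ → 0ℚ) , c≢0 , (λ _ → refl) , λ t → trans (e t) (trans (cong (λ x → c + t * x) (zg t)) (l c t)))
  where
  l : ∀ c t → c + t * 0ℚ ≡ c * 1ℚ + 0ℚ
  l = solve-∀ ℚ-ring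

-- If f had positive degree, the product of the leading terms of f and g would be a nonzero term of
-- positive degree in the constant fg.
unit-constant : ∀ d e {f g} → PolyFun d f → PolyFun e g → ∀ {c} → c ≢ 0ℚ →
  (∀ t → f t * g t ≡ c) → ∀ s t → f s ≡ f t
unit-constant d e {f} {g} pf pg {c} c≢0 fg≡c s t with leading d pf | leading e pg
... | inj₁ zf | _ = ⊥-elim (c≢0 (trans (sym (fg≡c 0ℚ)) (trans (cong (_* g 0ℚ) (zf 0ℚ)) (*-zeroˡ (g 0ℚ)))))
... | inj₂ _ | inj₁ zg = ⊥-elim (c≢0 (trans (sym (fg≡c 0ℚ)) (trans (cong (f 0ℚ *_) (zg 0ℚ)) (*-zeroʳ (f 0ℚ)))))
... | inj₂ (zero , a , r , _ , pr , ef) | inj₂ _ = trans (const s) (sym (const t))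
  where
  const : ∀ t → f t ≡ a * 1ℚ + 0ℚ
  const t = trans (ef t) (cong (a * 1ℚ +_) (pr t))
... | inj₂ (suc m , a , r , a≢0 , pr , ef) | inj₂ (k , b , w , b≢0 , pw , eg) = ⊥-elim (*-nonzero a≢0 b≢0
    (leading-zero (suc m ℕ.+ k) (a * b)
      (PolyFun-+ M {λ t → a * (t ^ suc m * w t) + b * (t ^ k * r t) + r t * w t}
        (PolyFun-+ M (PolyFun-+ M (PolyFun-scale M a (PolyFun-^ k (suc m) pw))
            (PolyFun-scale M b (subst (λ m → PolyFun m (λ t → t ^ k * r t)) (ℕₚ.+-comm k (suc m)) (PolyFun-^ (suc m) k pr))))
          (PolyFun-* (suc m) k pr pw))
        (PolyFun-const (m ℕ.+ k) (- c)))
      λ t → begin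
        a * b * t ^ M + (a * (t ^ suc m * w t) + b * (t ^ k * r t) + r t * w t + - c)
          ≡⟨ cong (λ x → a * b * x + (a * (t ^ suc m * w t) + b * (t ^ k * r t) + r t * w t + - c)) (^-+ t (suc m) k) ⟩
        a * b * (t ^ suc m * t ^ k) + (a * (t ^ suc m * w t) + b * (t ^ k * r t) + r t * w t + - c)
          ≡⟨ l a b (t ^ suc m) (t ^ k) (r t) (w t) c ⟩
        (a * t ^ suc m + r t) * (b * t ^ k + w t) - c
          ≡⟨ cong₂ (λ x y → x * y - c) (ef t) (eg t) ⟨
        f t * g t - c
          ≡⟨ x≡y⇒x-y≡0 (fg≡c t) ⟩
        0ℚ ∎))
  where
  M = suc m ℕ.+ k
  l : ∀ a b p q r w c → a * b * (p * q) + (a * (p * w) + b * (q * r) + r * w + - c) ≡ (a * p + r) * (b * q + w) - c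
  l = solve-∀ ℚ-ring

-- Polynomial syntax in three variables: density and synthetic division.

env : ℚ → ℚ → ℚ → Env
env q a b vq = q
env q a b va = a
env q a b vb = b

evalP-cong : ∀ f {ρ σ} → (∀ v → ρ v ≡ σ v) → evalP ρ f ≡ evalP σ f
evalP-cong (con c) eq = refl
evalP-cong (var v) eq = eq v
evalP-cong (f ⊕ g) eq = cong₂ _+_ (evalP-cong f eq) (evalP-cong g eq)
evalP-cong (f ⊗ g) eq = cong₂ _*_ (evalP-cong f eq) (evalP-cong g eq)
evalP-cong (⊖ f)   eq = cong -_ (evalP-cong f eq)

env-η : ∀ (ρ : Env) v → env (ρ vq) (ρ va) (ρ vb) v ≡ ρ v
env-η ρ vq = refl
env-η ρ va = refl
env-η ρ vb = refl

Coordinate : (ℚ → Env) → Set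
Coordinate path = ∀ v → PolyFun 2 (λ t → path t v)

evalP-PolyFun : ∀ f {path} → Coordinate path → Σ ℕ λ d → PolyFun d (λ t → evalP (path t) f)
evalP-PolyFun (con c) p = 1 , PolyFun-const 0 c
evalP-PolyFun (var v) p = 2 , p v
evalP-PolyFun (f ⊕ g) {path} p with evalP-PolyFun f p | evalP-PolyFun g p
... | d , pf | e , pg = e ℕ.+ d , PolyFun-+ (e ℕ.+ d) (PolyFun-weaken e d pf)
  (subst (λ m → PolyFun m (λ t → evalP (path t) g)) (ℕₚ.+-comm d e) (PolyFun-weaken d e pg))
evalP-PolyFun (f ⊗ g) p with evalP-PolyFun f p | evalP-PolyFun g p
... | d , pf | e , pg = d ℕ.+ e , PolyFun-* d e pf pg
evalP-PolyFun (⊖ f) {path} p with evalP-PolyFun f p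
... | d , pf = d , PolyFun-cong d (λ t → l (evalP (path t) f)) (PolyFun-scale d (- 1ℚ) pf)
  where
  l : ∀ x → - 1ℚ * x ≡ - x
  l = solve-∀ ℚ-ring

PolyFun-id : PolyFun 2 (λ t → t)
PolyFun-id = 0ℚ , (λ _ → 1ℚ) , PolyFun-const 0 1ℚ , l
  where
  l : ∀ t → t ≡ 0ℚ + t * 1ℚ
  l = solve-∀ ℚ-ring

pathq : ∀ a b → Coordinate (λ t → env t a b)
pathq a b vq = PolyFun-id
pathq a b va = PolyFun-const 1 a
pathq a b vb = PolyFun-const 1 b

patha : ∀ q b → Coordinate (λ t → env q t b)
patha q b vq = PolyFun-const 1 q
patha q b va = PolyFun-id
patha q b vb = PolyFun-const 1 b

pathb : ∀ q a → Coordinate (λ t → env q a t)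
pathb q a vq = PolyFun-const 1 q
pathb q a va = PolyFun-const 1 a
pathb q a vb = PolyFun-id

path-agreement : ∀ f g {path path′} → Coordinate path → Coordinate path′ → ∀ {τ} → Injective τ →
  (∀ k → evalP (path (τ k)) f ≡ evalP (path′ (τ k)) g) → ∀ t → evalP (path t) f ≡ evalP (path′ t) g
path-agreement f g p p′ τ-inj eq t with evalP-PolyFun f p | evalP-PolyFun g p′
... | d , pf | e , pg = agreement d e pf pg τ-inj eq t

-- The identity is extended in b, then in a, then in q. The test values of a may depend on q and
-- those of b on both, which fits points whose coordinates are powers of q.
dense : ∀ f g {τq : ℕ → ℚ} {τa : ℕ → ℕ → ℚ} {τb : ℕ → ℕ → ℕ → ℚ} →
  Injective τq → (∀ i → Injective (τa i)) → (∀ i s → Injective (τb i s)) →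
  (∀ i s t → evalP (env (τq i) (τa i s) (τb i s t)) f ≡ evalP (env (τq i) (τa i s) (τb i s t)) g) → f ≈P g
dense f g {τq} {τa} {τb} injq inja injb eq ρ =
  trans (sym (evalP-cong f (env-η ρ))) (trans (all (ρ vq) (ρ va) (ρ vb)) (evalP-cong g (env-η ρ)))
  where
  all : ∀ q a b → evalP (env q a b) f ≡ evalP (env q a b) g
  all q a b = path-agreement f g (pathq a b) (pathq a b) injq (λ i →
    path-agreement f g (patha (τq i) b) (patha (τq i) b) (inja i) (λ s →
      path-agreement f g (pathb (τq i) (τa i s)) (pathb (τq i) (τa i s)) (injb i s) (eq i s) b) a) q

-- Synthetic division by u·v − w on the syntax: u^d f = (u v − w) quotient + remainder,
-- where the remainder no longer involves the variable v.
set : Var → ℚ → Env → Env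
set vq t ρ = env t (ρ va) (ρ vb)
set va t ρ = env (ρ vq) t (ρ vb)
set vb t ρ = env (ρ vq) (ρ va) t

FreeOf : Var → Poly → Set
FreeOf v f = ∀ ρ t → evalP (set v t ρ) f ≡ evalP ρ f

eval-powP : ∀ ρ f k → evalP ρ (powP f k) ≡ evalP ρ f ^ k
eval-powP ρ f zero    = refl
eval-powP ρ f (suc k) = cong (_* evalP ρ f) (eval-powP ρ f k)

FreeOf-powP : ∀ v f k → FreeOf v f → FreeOf v (powP f k)
FreeOf-powP v f zero    ff ρ t = refl
FreeOf-powP v f (suc k) ff ρ t = cong₂ _*_ (FreeOf-powP v f k ff ρ t) (ff ρ t)

var-cases : ∀ x v → x ≡ v ⊎ FreeOf v (var x)
var-cases vq vq = inj₁ refl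
var-cases vq va = inj₂ λ _ _ → refl
var-cases vq vb = inj₂ λ _ _ → refl
var-cases va vq = inj₂ λ _ _ → refl
var-cases va va = inj₁ refl
var-cases va vb = inj₂ λ _ _ → refl
var-cases vb vq = inj₂ λ _ _ → refl
var-cases vb va = inj₂ λ _ _ → refl
var-cases vb vb = inj₁ refl

record Division (v : Var) (u w f : Poly) : Set where
  field
    degree    : ℕ
    quotient  : Poly
    remainder : Poly
    free      : FreeOf v remainder
    equation  : ∀ ρ → evalP ρ u ^ degree * evalP ρ f ≡
                  (evalP ρ u * ρ v - evalP ρ w) * evalP ρ quotient + evalP ρ remainder

divide : ∀ v u w → FreeOf v u → FreeOf v w → ∀ f → Division v u w f
divide v u w fu fw (con c) = record
  { degree = 0 ; quotient = con 0ℚ ; remainder = con c ; free = λ _ _ → refl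
  ; equation = λ ρ → l (evalP ρ u * ρ v - evalP ρ w) c }
  where
  l : ∀ d c → 1ℚ * c ≡ d * 0ℚ + c
  l = solve-∀ ℚ-ring
divide v u w fu fw (var x) with var-cases x v
... | inj₁ refl = record
  { degree = 1 ; quotient = con 1ℚ ; remainder = w ; free = fw
  ; equation = λ ρ → l (evalP ρ u) (ρ v) (evalP ρ w) }
  where
  l : ∀ u v w → 1ℚ * u * v ≡ (u * v - w) * 1ℚ + w
  l = solve-∀ ℚ-ring
... | inj₂ x≢v = record
  { degree = 0 ; quotient = con 0ℚ ; remainder = var x ; free = x≢v
  ; equation = λ ρ → l (evalP ρ u * ρ v - evalP ρ w) (ρ x) }
  where
  l : ∀ d c → 1ℚ * c ≡ d * 0ℚ + c
  l = solve-∀ ℚ-ring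
divide v u w fu fw (⊖ f) = record
  { degree = D.degree ; quotient = ⊖ D.quotient ; remainder = ⊖ D.remainder ; free = λ ρ t → cong -_ (D.free ρ t)
  ; equation = λ ρ → trans (l₁ (evalP ρ u ^ D.degree) (evalP ρ f)) (trans (cong -_ (D.equation ρ))
      (l₂ (evalP ρ u * ρ v - evalP ρ w) (evalP ρ D.quotient) (evalP ρ D.remainder))) }
  where
  module D = Division (divide v u w fu fw f)
  l₁ : ∀ p f → p * - f ≡ - (p * f)
  l₁ = solve-∀ ℚ-ring
  l₂ : ∀ d q r → - (d * q + r) ≡ d * - q + - r
  l₂ = solve-∀ ℚ-ring
divide v u w fu fw (f ⊕ g) = record
  { degree = F.degree ℕ.+ G.degree
  ; quotient = powP u G.degree ⊗ F.quotient ⊕ powP u F.degree ⊗ G.quotient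
  ; remainder = powP u G.degree ⊗ F.remainder ⊕ powP u F.degree ⊗ G.remainder
  ; free = λ ρ t → cong₂ _+_ (cong₂ _*_ (FreeOf-powP v u G.degree fu ρ t) (F.free ρ t)) (cong₂ _*_ (FreeOf-powP v u F.degree fu ρ t) (G.free ρ t))
  ; equation = λ ρ → let U = evalP ρ u ; d = U * ρ v - evalP ρ w in begin
      U ^ (F.degree ℕ.+ G.degree) * (evalP ρ f + evalP ρ g)
        ≡⟨ cong (_* (evalP ρ f + evalP ρ g)) (^-+ U F.degree G.degree) ⟩
      U ^ F.degree * U ^ G.degree * (evalP ρ f + evalP ρ g)
        ≡⟨ l₁ (U ^ F.degree) (U ^ G.degree) (evalP ρ f) (evalP ρ g) ⟩
      U ^ G.degree * (U ^ F.degree * evalP ρ f) + U ^ F.degree * (U ^ G.degree * evalP ρ g)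
        ≡⟨ cong₂ (λ x y → U ^ G.degree * x + U ^ F.degree * y) (F.equation ρ) (G.equation ρ) ⟩
      U ^ G.degree * (d * evalP ρ F.quotient + evalP ρ F.remainder) + U ^ F.degree * (d * evalP ρ G.quotient + evalP ρ G.remainder)
        ≡⟨ l₂ (U ^ G.degree) (U ^ F.degree) d (evalP ρ F.quotient) (evalP ρ G.quotient) (evalP ρ F.remainder) (evalP ρ G.remainder) ⟩
      d * (U ^ G.degree * evalP ρ F.quotient + U ^ F.degree * evalP ρ G.quotient) + (U ^ G.degree * evalP ρ F.remainder + U ^ F.degree * evalP ρ G.remainder)
        ≡⟨ cong₂ (λ x y → d * (x * evalP ρ F.quotient + y * evalP ρ G.quotient) + (x * evalP ρ F.remainder + y * evalP ρ G.remainder))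
             (eval-powP ρ u G.degree) (eval-powP ρ u F.degree) ⟨
      d * (evalP ρ (powP u G.degree) * evalP ρ F.quotient + evalP ρ (powP u F.degree) * evalP ρ G.quotient)
        + (evalP ρ (powP u G.degree) * evalP ρ F.remainder + evalP ρ (powP u F.degree) * evalP ρ G.remainder) ∎ }
  where
  module F = Division (divide v u w fu fw f)
  module G = Division (divide v u w fu fw g)
  l₁ : ∀ p q f g → p * q * (f + g) ≡ q * (p * f) + p * (q * g)
  l₁ = solve-∀ ℚ-ring
  l₂ : ∀ p q d x y r s → p * (d * x + r) + q * (d * y + s) ≡ d * (p * x + q * y) + (p * r + q * s)
  l₂ = solve-∀ ℚ-ring
divide v u w fu fw (f ⊗ g) = record
  { degree = F.degree ℕ.+ G.degree
  ; quotient = F.quotient ⊗ (powP u G.degree ⊗ g) ⊕ F.remainder ⊗ G.quotient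
  ; remainder = F.remainder ⊗ G.remainder
  ; free = λ ρ t → cong₂ _*_ (F.free ρ t) (G.free ρ t)
  ; equation = λ ρ → let U = evalP ρ u ; d = U * ρ v - evalP ρ w in begin
      U ^ (F.degree ℕ.+ G.degree) * (evalP ρ f * evalP ρ g)
        ≡⟨ cong (_* (evalP ρ f * evalP ρ g)) (^-+ U F.degree G.degree) ⟩
      U ^ F.degree * U ^ G.degree * (evalP ρ f * evalP ρ g)
        ≡⟨ l₁ (U ^ F.degree) (U ^ G.degree) (evalP ρ f) (evalP ρ g) ⟩
      U ^ F.degree * evalP ρ f * (U ^ G.degree * evalP ρ g)
        ≡⟨ cong (_* (U ^ G.degree * evalP ρ g)) (F.equation ρ) ⟩
      (d * evalP ρ F.quotient + evalP ρ F.remainder) * (U ^ G.degree * evalP ρ g)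
        ≡⟨ l₂ d (evalP ρ F.quotient) (evalP ρ F.remainder) (U ^ G.degree * evalP ρ g) ⟩
      d * (evalP ρ F.quotient * (U ^ G.degree * evalP ρ g)) + evalP ρ F.remainder * (U ^ G.degree * evalP ρ g)
        ≡⟨ cong₂ (λ x y → d * (evalP ρ F.quotient * (x * evalP ρ g)) + evalP ρ F.remainder * y) (sym (eval-powP ρ u G.degree)) (G.equation ρ) ⟩
      d * (evalP ρ F.quotient * (evalP ρ (powP u G.degree) * evalP ρ g)) + evalP ρ F.remainder * (d * evalP ρ G.quotient + evalP ρ G.remainder)
        ≡⟨ l₃ d (evalP ρ F.quotient * (evalP ρ (powP u G.degree) * evalP ρ g)) (evalP ρ F.remainder) (evalP ρ G.quotient) (evalP ρ G.remainder) ⟩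
      d * (evalP ρ F.quotient * (evalP ρ (powP u G.degree) * evalP ρ g) + evalP ρ F.remainder * evalP ρ G.quotient) + evalP ρ F.remainder * evalP ρ G.remainder ∎ }
  where
  module F = Division (divide v u w fu fw f)
  module G = Division (divide v u w fu fw g)
  l₁ : ∀ p q f g → p * q * (f * g) ≡ p * f * (q * g)
  l₁ = solve-∀ ℚ-ring
  l₂ : ∀ d x r y → (d * x + r) * y ≡ d * (x * y) + r * y
  l₂ = solve-∀ ℚ-ring
  l₃ : ∀ d x r y s → d * x + r * (d * y + s) ≡ d * (x + r * y) + r * s
  l₃ = solve-∀ ℚ-ring

-- Regular functions and coprimality

base : ℕ → ℚ
base i = ι (suc (suc i))

base-injective : Injective base
base-injective eq = ℕₚ.suc-injective (ℕₚ.suc-injective (ι-injective eq))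

base-nonzero : ∀ i → base i ≢ 0ℚ
base-nonzero i = ι-suc≢0 (suc i)

^-injectiveʳ : ∀ i {k l} → base i ^ k ≡ base i ^ l → k ≡ l
^-injectiveʳ i {k} {l} eq with ℕₚ.<-cmp k l | ι-injective (trans (ι-^ (suc (suc i)) k) (trans eq (sym (ι-^ (suc (suc i)) l))))
... | tri< k<l _ _ | e = ⊥-elim (ℕₚ.<⇒≢ (ℕₚ.^-monoʳ-< (suc (suc i)) (s≤s (s≤s z≤n)) k<l) e)
... | tri≈ _ k≡l _ | _ = k≡l
... | tri> _ _ l<k | e = ⊥-elim (ℕₚ.<⇒≢ (ℕₚ.^-monoʳ-< (suc (suc i)) (s≤s (s≤s z≤n)) l<k) (sym e))

1+^-nonzero : ∀ i k → 1ℚ + base i ^ k ≢ 0ℚ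
1+^-nonzero i k eq = ι-suc≢0 (suc (suc i) ℕ.^ k) (trans (cong (1ℚ +_) (ι-^ (suc (suc i)) k)) eq)

Even Odd : ℚ → ℚ → Set
Even q w = Σ ℕ λ e → w ≡ q ^ (2 ℕ.* e)
Odd q z = Σ ℕ λ e → z ≡ q ^ suc (2 ℕ.* e) ⊎ z * q ^ suc (2 ℕ.* e) ≡ 1ℚ

Even-* : ∀ {q v w} → Even q v → Even q w → Even q (v * w)
Even-* {q} (e , refl) (f , refl) = e ℕ.+ f ,
  trans (sym (^-+ q (2 ℕ.* e) (2 ℕ.* f))) (cong (q ^_) (sym (ℕₚ.*-distribˡ-+ 2 e f)))

Even-sq : ∀ q → Even q (q * q)
Even-sq q = 1 , cong (_* q) (sym (*-identityˡ q))

Even-^ : ∀ {q w} k → Even q w → Even q (w ^ k)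
Even-^ zero    ev = 0 , refl
Even-^ (suc k) ev = Even-* (Even-^ k ev) ev

module _ (i : ℕ) where
  private
    q = base i

  Odd≢Even : ∀ {z w} → Odd q z → Even q w → z ≢ w
  Odd≢Even (e , inj₁ refl) (f , refl) eq = ℕₚ.even≢odd f e (sym (^-injectiveʳ i eq))
  Odd≢Even (e , inj₂ z*≡1) (f , refl) refl = ℕₚ.even≢odd 0 (f ℕ.+ e) (^-injectiveʳ i (trans (sym z*≡1)
    (trans (sym (^-+ q (2 ℕ.* f) (suc (2 ℕ.* e)))) (cong (q ^_) (trans (ℕₚ.+-suc (2 ℕ.* f) (2 ℕ.* e)) (cong suc (sym (ℕₚ.*-distribˡ-+ 2 f e))))))))

  Odd*Even≢1 : ∀ {z w} → Odd q z → Even q w → z * w ≢ 1ℚ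
  Odd*Even≢1 (e , inj₁ refl) (f , refl) eq = ℕₚ.even≢odd 0 (e ℕ.+ f) (sym (^-injectiveʳ i (trans
    (cong (q ^_) (cong suc (ℕₚ.*-distribˡ-+ 2 e f))) (trans (^-+ q (suc (2 ℕ.* e)) (2 ℕ.* f)) eq))))
  Odd*Even≢1 {z} (e , inj₂ z*≡1) (f , refl) eq = ℕₚ.even≢odd f e (^-injectiveʳ i
    (*-cancelˡ (nonzero-*ˡ {z} {q ^ (2 ℕ.* f)} (λ zw≡0 → 1≢0 (trans (sym eq) zw≡0))) (trans eq (sym z*≡1))))

  -- Each factor of `E` compares powers of an integer q ≥ 2 whose exponents differ in parity.
  E-nonzero : ∀ {z w} → Odd q z → Even q w → E z w ≢ 0ℚ
  E-nonzero oz ew = *-nonzero (≢⇒-≢0 (λ eq → Odd*Even≢1 oz ew (sym eq))) (≢⇒-≢0 (Odd≢Even oz ew))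

  Odd-nonzero : ∀ {z} → Odd q z → z ≢ 0ℚ
  Odd-nonzero (e , inj₁ refl) = ^-nonzero (suc (2 ℕ.* e)) (base-nonzero i)
  Odd-nonzero {z} (e , inj₂ eq) = nonzero-*ˡ {z} {q ^ suc (2 ℕ.* e)} (λ z≡0 → 1≢0 (trans (sym eq) z≡0))

  -- Since 3(2e + 1) = 2(3e + 1) + 1, the parity condition on b carries over to y = b³.
  Odd-cube : ∀ {z} → Odd q z → Odd q (z ^ 3)
  Odd-cube {z} (e , o) = f , cases o
    where
    f = suc (3 ℕ.* e)
    exponent : q ^ suc (2 ℕ.* f) ≡ (q ^ suc (2 ℕ.* e)) ^ 3
    exponent = sym (trans (^-* q (suc (2 ℕ.* e)) 3) (cong (q ^_) (lem e)))
      where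
      open +-*-Solver
      lem : ∀ e → 3 ℕ.* suc (2 ℕ.* e) ≡ suc (2 ℕ.* suc (3 ℕ.* e))
      lem = solve 1 (λ e → con 3 :* (con 1 :+ con 2 :* e) := con 1 :+ con 2 :* (con 1 :+ con 3 :* e)) refl
    cases : z ≡ q ^ suc (2 ℕ.* e) ⊎ z * q ^ suc (2 ℕ.* e) ≡ 1ℚ → z ^ 3 ≡ q ^ suc (2 ℕ.* f) ⊎ z ^ 3 * q ^ suc (2 ℕ.* f) ≡ 1ℚ
    cases (inj₁ refl) = inj₁ (sym exponent)
    cases (inj₂ eq)   = inj₂ (trans (cong (z ^ 3 *_) exponent) (trans (sym (^-distrib z (q ^ suc (2 ℕ.* e)) 3)) (cong (_^ 3) eq)))

-- Test points: q ≥ 2 an integer, a and b odd powers of q^{±1} in general position.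
-- They contain a Zariski-dense set as well as dense subsets of a = q^{±n} and b = q^{±n} (n odd).
record Admissible (ρ : Env) : Set where
  constructor admissible
  field
    index : ℕ
    q≡    : ρ vq ≡ base index
    oddA  : Odd (ρ vq) (ρ va)
    oddB  : Odd (ρ vq) (ρ vb)
    a≢b   : ρ va ≢ ρ vb
    ab≢1  : ρ va * ρ vb ≢ 1ℚ

odd : ℕ → ℕ → ℚ
odd i e = base i ^ suc (2 ℕ.* e)

odd-injective : ∀ i → Injective (odd i)
odd-injective i eq = ℕₚ.*-cancelˡ-≡ _ _ 2 (ℕₚ.suc-injective (^-injectiveʳ i eq))

odd≢odd : ∀ i {e f} → e ≢ f → odd i e ≢ odd i f
odd≢odd i e≢f eq = e≢f (odd-injective i eq)

odd*odd≢1 : ∀ i e f → odd i e * odd i f ≢ 1ℚ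
odd*odd≢1 i e f eq = ℕₚ.1+n≢0 (^-injectiveʳ i {suc (2 ℕ.* e) ℕ.+ suc (2 ℕ.* f)} {0} (trans (^-+ (base i) (suc (2 ℕ.* e)) (suc (2 ℕ.* f))) eq))

inv*≡1 : ∀ {x} → x ≢ 0ℚ → inv x * x ≡ 1ℚ
inv*≡1 {x} x≢0 = trans (*-comm (inv x) x) (*-inv x≢0)

odd-nonzero : ∀ i e → odd i e ≢ 0ℚ
odd-nonzero i e = ^-nonzero (suc (2 ℕ.* e)) (base-nonzero i)

oddOdd : ∀ i e → Odd (base i) (odd i e)
oddOdd i e = e , inj₁ refl

oddInv : ∀ i e → Odd (base i) (inv (odd i e))
oddInv i e = e , inj₂ (inv*≡1 (odd-nonzero i e))

odd≢inv : ∀ i e f → odd i e ≢ inv (odd i f)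
odd≢inv i e f eq = odd*odd≢1 i f e (trans (cong (odd i f *_) eq) (*-inv (odd-nonzero i f)))

inv*odd≢1 : ∀ i {e f} → e ≢ f → inv (odd i e) * odd i f ≢ 1ℚ
inv*odd≢1 i {e} {f} e≢f eq = odd≢odd i e≢f (*-cancelˡ (inv-nonzero (odd-nonzero i e)) (trans (inv*≡1 (odd-nonzero i e)) (sym eq)))

admissible-odd : ∀ i {e f} → e ≢ f → Admissible (env (base i) (odd i e) (odd i f))
admissible-odd i {e} {f} e≢f = admissible i refl (oddOdd i e) (oddOdd i f) (odd≢odd i e≢f) (odd*odd≢1 i e f)

admissible-invˡ : ∀ i {e f} → e ≢ f → Admissible (env (base i) (inv (odd i e)) (odd i f))
admissible-invˡ i {e} {f} e≢f = admissible i refl (oddInv i e) (oddOdd i f) (λ eq → odd≢inv i f e (sym eq)) (inv*odd≢1 i e≢f)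

admissible-invʳ : ∀ i {e f} → e ≢ f → Admissible (env (base i) (odd i e) (inv (odd i f)))
admissible-invʳ i {e} {f} e≢f = admissible i refl (oddOdd i e) (oddInv i f) (odd≢inv i e f)
  (λ eq → inv*odd≢1 i (λ f≡e → e≢f (sym f≡e)) (trans (*-comm (inv (odd i f)) (odd i e)) eq))

geometric : Poly → Poly → ℕ → Poly
geometric x y zero    = con 0ℚ
geometric x y (suc n) = powP x n ⊕ y ⊗ geometric x y n

geometric-eval : ∀ ρ x y n →
  evalP ρ x ^ n - evalP ρ y ^ n ≡ (evalP ρ x - evalP ρ y) * evalP ρ (geometric x y n)
geometric-eval ρ x y zero = sym (*-zeroʳ (evalP ρ x - evalP ρ y))
geometric-eval ρ x y (suc n) = begin
  X ^ n * X - Y ^ n * Y                       ≡⟨ l₁ (X ^ n) X (Y ^ n) Y ⟩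
  (X - Y) * X ^ n + Y * (X ^ n - Y ^ n)       ≡⟨ cong₂ (λ u v → (X - Y) * u + Y * v) (sym (eval-powP ρ x n)) (geometric-eval ρ x y n) ⟩
  (X - Y) * evalP ρ (powP x n) + Y * ((X - Y) * evalP ρ (geometric x y n))
    ≡⟨ l₂ (X - Y) (evalP ρ (powP x n)) Y (evalP ρ (geometric x y n)) ⟩
  (X - Y) * (evalP ρ (powP x n) + Y * evalP ρ (geometric x y n)) ∎
  where
  X = evalP ρ x
  Y = evalP ρ y
  l₁ : ∀ p x r y → p * x - r * y ≡ (x - y) * p + y * (p - r)
  l₁ = solve-∀ ℚ-ring
  l₂ : ∀ d p y g → d * p + y * (d * g) ≡ d * (p + y * g)
  l₂ = solve-∀ ℚ-ring

record PF (f : ℚ → ℚ) : Set where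
  constructor pf
  field
    {degree} : ℕ
    isPolyFun : PolyFun degree f

PF-+ : ∀ {f g} → PF f → PF g → PF (λ t → f t + g t)
PF-+ {f} {g} (pf {d} p) (pf {e} r) = pf (PolyFun-+ (e ℕ.+ d) (PolyFun-weaken e d p) (subst (λ m → PolyFun m g) (ℕₚ.+-comm d e) (PolyFun-weaken d e r)))

PF-* : ∀ {f g} → PF f → PF g → PF (λ t → f t * g t)
PF-* (pf {d} p) (pf {e} r) = pf (PolyFun-* d e p r)

PF-const : ∀ c → PF (λ _ → c)
PF-const c = pf (PolyFun-const 0 c)

PF-eval : ∀ f {path} → Coordinate path → PF (λ t → evalP (path t) f)
PF-eval f p = pf (proj₂ (evalP-PolyFun f p))

module Modulus (m : ℕ) where

  -- n = 4m + 3 = 2h + 1, so qⁿ is the odd power of index h. As h is odd, odd powers of even index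
  -- never equal qⁿ.
  h n : ℕ
  h = suc (2 ℕ.* m)
  n = suc (2 ℕ.* h)

  qint-n : Poly
  qint-n = sumP n (powP qP)

  -- Here a = 2 and b³ = 27 are not roots of unity, a ≠ b and ab ≠ 1, so the denominators that
  -- involve a or b stay comaximal with 1 - qⁿ after this specialisation.
  special : ℚ → Env
  special q = env q (ι 2) (ι 3)

  -- An explicit Bezout relation in place of "no common root": it multiplies, and it survives
  -- raising to a power, which is how repeated factors of the modulus are handled.
  record Comaximal (F : Poly) : Set where
    constructor comaximal
    field
      cofactor cofactor′ : Poly
      constant           : ℚ
      constant≢0         : constant ≢ 0ℚ
      bezout             : ∀ q → evalP (special q) cofactor * evalP (special q) F + evalP (special q) cofactor′ * (1ℚ - q ^ n) ≡ constant

  Comaximal-⊗ : ∀ {F G} → Comaximal F → Comaximal G → Comaximal (F ⊗ G)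
  Comaximal-⊗ {F} {G} (comaximal U V c c≢0 e) (comaximal U′ V′ c′ c′≢0 e′) =
    comaximal (U ⊗ U′) (V ⊗ (U′ ⊗ G) ⊕ (V′ ⊗ (U ⊗ F) ⊕ V ⊗ V′ ⊗ (con 1ℚ ⊕ ⊖ powP qP n))) (c * c′) (*-nonzero c≢0 c′≢0) λ q →
      trans (cong (λ w → evalP (special q) (U ⊗ U′) * evalP (special q) (F ⊗ G) + (evalP (special q) (V ⊗ (U′ ⊗ G)) + (evalP (special q) (V′ ⊗ (U ⊗ F)) + evalP (special q) (V ⊗ V′) * (1ℚ - w))) * (1ℚ - q ^ n)) (eval-powP (special q) qP n))
        (trans (l (evalP (special q) U) (evalP (special q) U′) (evalP (special q) F) (evalP (special q) G) (evalP (special q) V) (evalP (special q) V′) (q ^ n))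
        (cong₂ _*_ (e q) (e′ q)))
    where
    l : ∀ u u′ f g v v′ w → u * u′ * (f * g) + (v * (u′ * g) + (v′ * (u * f) + v * v′ * (1ℚ - w))) * (1ℚ - w) ≡
      (u * f + v * (1ℚ - w)) * (u′ * g + v′ * (1ℚ - w))
    l = solve-∀ ℚ-ring

  Comaximal-const : ∀ {F} c → c ≢ 0ℚ → (∀ q → evalP (special q) F ≡ c) → Comaximal F
  Comaximal-const c c≢0 eq = comaximal (con 1ℚ) (con 0ℚ) c c≢0 λ q → trans (cong (λ x → 1ℚ * x + 0ℚ * (1ℚ - q ^ n)) (eq q)) (l c (1ℚ - q ^ n))
    where
    l : ∀ c w → 1ℚ * c + 0ℚ * w ≡ c
    l = solve-∀ ℚ-ring

  -- c − d q^j divides c^n − d^n q^{jn}, which is congruent to c^n − d^n modulo 1 − q^n.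
  Comaximal-binomial : ∀ {F} c d j → c ^ n ≢ d ^ n → (∀ q → evalP (special q) F ≡ c - d * q ^ j) → Comaximal F
  Comaximal-binomial {F} c d j cⁿ≢dⁿ eq =
    comaximal G (⊖ (con (d ^ n) ⊗ H)) (c ^ n - d ^ n) (≢⇒-≢0 cⁿ≢dⁿ) λ q → begin
      evalP (special q) G * evalP (special q) F + - (d ^ n * evalP (special q) H) * (1ℚ - q ^ n)
        ≡⟨ cong (λ x → evalP (special q) G * x + - (d ^ n * evalP (special q) H) * (1ℚ - q ^ n)) (eq q) ⟩
      evalP (special q) G * (c - d * q ^ j) + - (d ^ n * evalP (special q) H) * (1ℚ - q ^ n)
        ≡⟨ l₁ (evalP (special q) G) (c - d * q ^ j) (d ^ n) (evalP (special q) H) (1ℚ - q ^ n) ⟩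
      (c - d * q ^ j) * evalP (special q) G - d ^ n * ((1ℚ - q ^ n) * evalP (special q) H)
        ≡⟨ cong₂ (λ x y → x - d ^ n * y) (divides-c q) (divides-1 q) ⟩
      c ^ n - d ^ n * (q ^ j) ^ n - d ^ n * (1ℚ - (q ^ j) ^ n)
        ≡⟨ l₂ (c ^ n) (d ^ n) ((q ^ j) ^ n) ⟩
      c ^ n - d ^ n ∎
    where
    G = geometric (con c) (con d ⊗ powP qP j) n
    H = geometric (con 1ℚ) (powP qP n) j
    l₁ : ∀ g x d h w → g * x + - (d * h) * w ≡ x * g - d * (w * h)
    l₁ = solve-∀ ℚ-ring
    l₂ : ∀ c d w → c - d * w - d * (1ℚ - w) ≡ c - d
    l₂ = solve-∀ ℚ-ring
    divides-c : ∀ q → (c - d * q ^ j) * evalP (special q) G ≡ c ^ n - d ^ n * (q ^ j) ^ n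
    divides-c q = trans (cong (λ x → (c - d * x) * evalP (special q) G) (sym (eval-powP (special q) qP j)))
      (trans (sym (geometric-eval (special q) (con c) (con d ⊗ powP qP j) n))
        (cong (λ x → c ^ n - x) (trans (cong (λ x → (d * x) ^ n) (eval-powP (special q) qP j)) (^-distrib d (q ^ j) n))))
    divides-1 : ∀ q → (1ℚ - q ^ n) * evalP (special q) H ≡ 1ℚ - (q ^ j) ^ n
    divides-1 q = trans (cong (λ x → (1ℚ - x) * evalP (special q) H) (sym (eval-powP (special q) qP n)))
      (trans (sym (geometric-eval (special q) (con 1ℚ) (powP qP n) j))
        (cong₂ _-_ (1^ j) (trans (cong (_^ j) (eval-powP (special q) qP n)) (trans (^-* q n j) (trans (cong (q ^_) (ℕₚ.*-comm j n)) (sym (^-* q j n)))))))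

  -- A common factor with the modulus that involves a or b would vanish at some point with a =
  -- q^{±n} or b = q^{±n}, which `nonzero` forbids; one that involves q alone is forbidden by
  -- `comax`.
  record Good (F : Poly) : Set where
    constructor good
    field
      nonzero : ∀ ρ → Admissible ρ → evalP ρ F ≢ 0ℚ
      comax   : Comaximal F

  Good-⊗ : ∀ {F G} → Good F → Good G → Good (F ⊗ G)
  Good-⊗ (good nz c) (good nz′ c′) = good (λ ρ ad → *-nonzero (nz ρ ad) (nz′ ρ ad)) (Comaximal-⊗ c c′)

  Good-1 : Good (con 1ℚ)
  Good-1 = good (λ _ _ → 1≢0) (Comaximal-const 1ℚ 1≢0 (λ _ → refl))

  Good-powP : ∀ {F} k → Good F → Good (powP F k)
  Good-powP zero    g = Good-1
  Good-powP (suc k) g = Good-⊗ (Good-powP k g) g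

  -- The localisation of the polynomial ring at the good polynomials, with its elements seen as
  -- functions on admissible points.
  record Reg (f : Env → ℚ) : Set where
    constructor reg
    field
      num den  : Poly
      good-den : Good den
      fraction : ∀ ρ → Admissible ρ → f ρ * evalP ρ den ≡ evalP ρ num

  Reg-cong : ∀ {f g} → (∀ ρ → Admissible ρ → f ρ ≡ g ρ) → Reg f → Reg g
  Reg-cong eq (reg N D g fr) = reg N D g λ ρ ad → trans (cong (_* evalP ρ D) (sym (eq ρ ad))) (fr ρ ad)

  Reg-poly : ∀ F → Reg (λ ρ → evalP ρ F)
  Reg-poly F = reg F (con 1ℚ) Good-1 λ ρ _ → *-identityʳ (evalP ρ F)

  Reg-* : ∀ {f g} → Reg f → Reg g → Reg (λ ρ → f ρ * g ρ)
  Reg-* {f} {g} (reg N D gd fr) (reg N′ D′ gd′ fr′) = reg (N ⊗ N′) (D ⊗ D′) (Good-⊗ gd gd′) λ ρ ad →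
    trans (l (f ρ) (g ρ) (evalP ρ D) (evalP ρ D′)) (cong₂ _*_ (fr ρ ad) (fr′ ρ ad))
    where
    l : ∀ f g d e → f * g * (d * e) ≡ f * d * (g * e)
    l = solve-∀ ℚ-ring

  Reg-+ : ∀ {f g} → Reg f → Reg g → Reg (λ ρ → f ρ + g ρ)
  Reg-+ {f} {g} (reg N D gd fr) (reg N′ D′ gd′ fr′) = reg (N ⊗ D′ ⊕ N′ ⊗ D) (D ⊗ D′) (Good-⊗ gd gd′) λ ρ ad →
    trans (l (f ρ) (g ρ) (evalP ρ D) (evalP ρ D′)) (cong₂ (λ x y → x * evalP ρ D′ + y * evalP ρ D) (fr ρ ad) (fr′ ρ ad))
    where
    l : ∀ f g d e → (f + g) * (d * e) ≡ f * d * e + g * e * d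
    l = solve-∀ ℚ-ring

  Reg-neg : ∀ {f} → Reg f → Reg (λ ρ → - f ρ)
  Reg-neg {f} (reg N D gd fr) = reg (⊖ N) D gd λ ρ ad → trans (l (f ρ) (evalP ρ D)) (cong -_ (fr ρ ad))
    where
    l : ∀ f d → - f * d ≡ - (f * d)
    l = solve-∀ ℚ-ring

  Reg-inv : ∀ {F} → Good F → Reg (λ ρ → inv (evalP ρ F))
  Reg-inv {F} g = reg (con 1ℚ) F g λ ρ ad → inv*≡1 (Good.nonzero g ρ ad)

  Reg-const : ∀ c → Reg (λ _ → c)
  Reg-const c = Reg-poly (con c)

  Reg-q : Reg (λ ρ → ρ vq)
  Reg-q = Reg-poly (var vq)

  Reg-^ : ∀ {f} k → Reg f → Reg (λ ρ → f ρ ^ k)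
  Reg-^ zero    r = Reg-const 1ℚ
  Reg-^ (suc k) r = Reg-* (Reg-^ k r) r

  Reg-prod : ∀ k {f : ℕ → Env → ℚ} → (∀ j → Reg (f j)) → Reg (λ ρ → prod k (λ j → f j ρ))
  Reg-prod zero    r = Reg-const 1ℚ
  Reg-prod (suc k) r = Reg-* (Reg-prod k r) (r k)

  Reg-sum : ∀ k {f : ℕ → Env → ℚ} → (∀ j → j ℕ.< k → Reg (f j)) → Reg (λ ρ → sum k (λ j → f j ρ))
  Reg-sum zero    r = Reg-const 0ℚ
  Reg-sum (suc k) r = Reg-+ (Reg-sum k (λ j j<k → r j (ℕₚ.m<n⇒m<1+n j<k))) (r k ℕₚ.≤-refl)

  sum-geometric : ∀ ρ k → (1ℚ - ρ vq) * evalP ρ (sumP k (powP qP)) ≡ 1ℚ - ρ vq ^ k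
  sum-geometric ρ zero = *-zeroʳ (1ℚ - ρ vq)
  sum-geometric ρ (suc k) = begin
    (1ℚ - q) * (S + evalP ρ (powP qP k))     ≡⟨ cong (λ x → (1ℚ - q) * (S + x)) (eval-powP ρ qP k) ⟩
    (1ℚ - q) * (S + q ^ k)                   ≡⟨ *-distribˡ-+ (1ℚ - q) S (q ^ k) ⟩
    (1ℚ - q) * S + (1ℚ - q) * q ^ k          ≡⟨ cong (_+ (1ℚ - q) * q ^ k) (sum-geometric ρ k) ⟩
    1ℚ - q ^ k + (1ℚ - q) * q ^ k            ≡⟨ l q (q ^ k) ⟩
    1ℚ - q ^ k * q                           ∎
    where
    q = ρ vq
    S = evalP ρ (sumP k (powP qP))
    l : ∀ q p → 1ℚ - p + (1ℚ - q) * p ≡ 1ℚ - p * q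
    l = solve-∀ ℚ-ring

  1-base^≢0 : ∀ i k → k ≢ 0 → 1ℚ - base i ^ k ≢ 0ℚ
  1-base^≢0 i k k≢0 = ≢⇒-≢0 (λ eq → k≢0 (sym (^-injectiveʳ i eq)))

  qint-n≢0 : ∀ i a b → evalP (env (base i) a b) qint-n ≢ 0ℚ
  qint-n≢0 i a b = nonzero-*ʳ {1ℚ - base i} (λ eq → 1-base^≢0 i n (λ ()) (trans (sym (sum-geometric (env (base i) a b) n)) eq))

  h≢even : ∀ t → h ≢ 2 ℕ.* t
  h≢even t eq = ℕₚ.even≢odd t m (sym eq)

  eval-modulus : ∀ ρ → evalP ρ (modulus n) ≡
    evalP ρ qint-n * (1ℚ - ρ va * ρ vq ^ n) * (ρ va - ρ vq ^ n) * (1ℚ - ρ vb * ρ vq ^ n) * (ρ vb - ρ vq ^ n)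
  eval-modulus ρ = cong (λ x → evalP ρ qint-n * (1ℚ - ρ va * x) * (ρ va - x) * (1ℚ - ρ vb * x) * (ρ vb - x)) (eval-powP ρ qP n)

  -- As a divisor of e, the function f is nonzero at Q and 1/Q, so both roots of (1 - tQ)(t - Q)
  -- belong to the cofactor k. Once they are divided out, f times a polynomial function is a nonzero
  -- constant.
  fibre-constant : ∀ {f g k} → PF f → PF g → PF k → ∀ {e : ℚ → ℚ} Q {c} → Q ≢ 0ℚ → Q ≢ inv Q → c ≢ 0ℚ →
    (∀ t → f t * g t ≡ e t) → e Q ≢ 0ℚ → e (inv Q) ≢ 0ℚ →
    (∀ t → f t * k t ≡ c * ((1ℚ - t * Q) * (t - Q))) → ∀ s t → f s ≡ f t
  fibre-constant {f} {g} {k} (pf {df} pf-f) _ (pf {dk} pf-k) {e} Q {c} Q≢0 Q≢iQ c≢0 fg eQ≢0 eiQ≢0 fk = constant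
    where
    iQ = inv Q
    f≢0 : ∀ {t} → e t ≢ 0ℚ → f t ≢ 0ℚ
    f≢0 {t} et≢0 = nonzero-*ˡ {f t} {g t} (λ eq → et≢0 (trans (sym (fg t)) eq))
    k-root : ∀ t → e t ≢ 0ℚ → (1ℚ - t * Q) * (t - Q) ≡ 0ℚ → k t ≡ 0ℚ
    k-root t et≢0 z = *-cancelˡ (f≢0 et≢0) (trans (fk t) (trans (cong (c *_) z) (trans (*-zeroʳ c) (sym (*-zeroʳ (f t))))))
    l₀ : ∀ Q → (1ℚ - Q * Q) * (Q - Q) ≡ 0ℚ
    l₀ = solve-∀ ℚ-ring
    kQ : k Q ≡ 0ℚ
    kQ = k-root Q eQ≢0 (l₀ Q)
    kiQ : k iQ ≡ 0ℚ
    kiQ = k-root iQ eiQ≢0 (trans (cong (λ x → (1ℚ - x) * (iQ - Q)) (inv*≡1 Q≢0)) (*-zeroˡ (iQ - Q)))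
    first = factor-root dk (PolyFun-suc dk pf-k) Q
    k₁ = proj₁ first
    pk₁ = proj₁ (proj₂ first)
    l₁ : ∀ x → x ≡ x - 0ℚ
    l₁ = solve-∀ ℚ-ring
    k≡ : ∀ t → k t ≡ (t - Q) * k₁ t
    k≡ t = trans (l₁ (k t)) (trans (cong (λ x → k t - x) (sym kQ)) (proj₂ (proj₂ first) t))
    k₁iQ : k₁ iQ ≡ 0ℚ
    k₁iQ = *-cancelˡ (≢⇒-≢0 (λ eq → Q≢iQ (sym eq))) (trans (sym (k≡ iQ)) (trans kiQ (sym (*-zeroʳ (iQ - Q)))))
    second = factor-root dk (PolyFun-suc dk pk₁) iQ
    k₂ = proj₁ second
    pk₂ = proj₁ (proj₂ second)
    k₁≡ : ∀ t → k₁ t ≡ (t - iQ) * k₂ t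
    k₁≡ t = trans (l₁ (k₁ t)) (trans (cong (λ x → k₁ t - x) (sym k₁iQ)) (proj₂ (proj₂ second) t))
    fk₂ : ∀ t → (t - Q) * (t - iQ) * (f t * k₂ t) ≡ (t - Q) * (t - iQ) * - (c * Q)
    fk₂ t = begin
      (t - Q) * (t - iQ) * (f t * k₂ t)          ≡⟨ l₂ (t - Q) (t - iQ) (f t) (k₂ t) ⟩
      f t * ((t - Q) * ((t - iQ) * k₂ t))        ≡⟨ cong (λ x → f t * ((t - Q) * x)) (k₁≡ t) ⟨
      f t * ((t - Q) * k₁ t)                     ≡⟨ cong (f t *_) (k≡ t) ⟨
      f t * k t                                  ≡⟨ fk t ⟩
      c * ((1ℚ - t * Q) * (t - Q))               ≡⟨ cong (λ x → c * ((x - t * Q) * (t - Q))) (*-inv Q≢0) ⟨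
      c * ((Q * iQ - t * Q) * (t - Q))           ≡⟨ l₃ c Q iQ t ⟩
      (t - Q) * (t - iQ) * - (c * Q)             ∎
      where
      l₂ : ∀ x y f k → x * y * (f * k) ≡ f * (x * (y * k))
      l₂ = solve-∀ ℚ-ring
      l₃ : ∀ c Q i t → c * ((Q * i - t * Q) * (t - Q)) ≡ (t - Q) * (t - i) * - (c * Q)
      l₃ = solve-∀ ℚ-ring
    -- The factor t - s cannot be cancelled at t = s; comparison at infinitely many other points
    -- suffices.
    remove : ∀ {d e f g} → PolyFun d f → PolyFun e g → ∀ s → (∀ t → (t - s) * f t ≡ (t - s) * g t) → ∀ t → f t ≡ g t
    remove {d} {e} pf-f pf-g s eq = agreement d e pf-f pf-g {λ k → s + ι (suc k)}
      (λ {k} {l} e → ℕₚ.suc-injective (ι-injective (trans (l₄ s (ι (suc k))) (trans (cong (- s +_) e) (sym (l₄ s (ι (suc l))))))))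
      (λ k → *-cancelˡ (λ z → ι-suc≢0 k (trans (l₅ s (ι (suc k))) z)) (eq (s + ι (suc k))))
      where
      l₄ : ∀ s x → x ≡ - s + (s + x)
      l₄ = solve-∀ ℚ-ring
      l₅ : ∀ s x → x ≡ s + x - s
      l₅ = solve-∀ ℚ-ring
    pfk₂ : PolyFun (df ℕ.+ dk) (λ t → f t * k₂ t)
    pfk₂ = PolyFun-* df dk pf-f pk₂
    mulId : ∀ {d f} s → PolyFun d f → PolyFun (2 ℕ.+ d) (λ t → (t - s) * f t)
    mulId {d} s p = PolyFun-* 2 d (- s , (λ _ → 1ℚ) , PolyFun-const 0 1ℚ , l₆ s) p
      where
      l₆ : ∀ s t → t - s ≡ - s + t * 1ℚ
      l₆ = solve-∀ ℚ-ring
    fk₂≡ : ∀ t → f t * k₂ t ≡ - (c * Q)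
    fk₂≡ = remove pfk₂ (PolyFun-const 0 (- (c * Q))) iQ
      (remove (mulId iQ pfk₂) (mulId iQ (PolyFun-const 0 (- (c * Q)))) Q
        (λ t → trans (sym (*-assoc (t - Q) (t - iQ) (f t * k₂ t))) (trans (fk₂ t) (*-assoc (t - Q) (t - iQ) (- (c * Q))))))
    constant : ∀ s t → f s ≡ f t
    constant = unit-constant df dk pf-f pk₂ (neg-nonzero (*-nonzero c≢0 Q≢0)) fk₂≡

  module _ {F G H D : Poly} (D-good : Good D) (FG≈D : (F ⊗ G) ≈P D) (FH≈P : (F ⊗ H) ≈P modulus n) where

    -- On a line parallel to the a-axis or the b-axis the modulus is a constant times a quadratic
    -- with the roots q^{±n}, and these two points are admissible.
    fibre : ∀ i {path} → Coordinate path → let Q = odd i h in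
      Admissible (path Q) → Admissible (path (inv Q)) → ∀ {c} → c ≢ 0ℚ →
      (∀ t → evalP (path t) (modulus n) ≡ c * ((1ℚ - t * Q) * (t - Q))) → ∀ s t → evalP (path s) F ≡ evalP (path t) F
    fibre i {path} p ad ad′ c≢0 mod≡ = fibre-constant (PF-eval F p) (PF-eval G p) (PF-eval H p)
      {λ t → evalP (path t) D} (odd i h) (odd-nonzero i h) (odd≢inv i h h) c≢0 (λ t → FG≈D (path t))
      (Good.nonzero D-good _ ad) (Good.nonzero D-good _ ad′) (λ t → trans (FH≈P (path t)) (mod≡ t))

    module _ (i t : ℕ) where

      private
        z Q c : ℚ
        -- The other coordinate is q^{4t+1}; since n is 3 modulo 4 it never equals qⁿ, and the
        -- remaining factors of the modulus form the nonzero constant c.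
        z = odd i (2 ℕ.* t)
        Q = odd i h
        c = evalP (env (base i) 0ℚ 0ℚ) qint-n * ((1ℚ - z * Q) * (z - Q))

        t≢h : 2 ℕ.* t ≢ h
        t≢h eq = h≢even t (sym eq)

        c≢0 : c ≢ 0ℚ
        c≢0 = *-nonzero (qint-n≢0 i 0ℚ 0ℚ) (*-nonzero (≢⇒-≢0 (λ eq → odd*odd≢1 i (2 ℕ.* t) h (sym eq))) (≢⇒-≢0 (odd≢odd i t≢h)))

        qint-q : ∀ a b → evalP (env (base i) a b) qint-n ≡ evalP (env (base i) 0ℚ 0ℚ) qint-n
        qint-q a b = *-cancelˡ (subst (λ x → 1ℚ - x ≢ 0ℚ) (*-identityˡ (base i)) (1-base^≢0 i 1 (λ ())))
          (trans (sum-geometric (env (base i) a b) n) (sym (sum-geometric (env (base i) 0ℚ 0ℚ) n)))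

      fibre-a : ∀ a a′ → evalP (env (base i) a z) F ≡ evalP (env (base i) a′ z) F
      fibre-a = fibre i (patha (base i) z) (admissible-odd i (h≢even t)) (admissible-invˡ i (h≢even t)) c≢0
        λ a → trans (eval-modulus (env (base i) a z)) (trans (l (evalP (env (base i) a z) qint-n) (1ℚ - a * Q) (a - Q) (1ℚ - z * Q) (z - Q))
          (cong (λ x → x * ((1ℚ - z * Q) * (z - Q)) * ((1ℚ - a * Q) * (a - Q))) (qint-q a z)))
        where
        l : ∀ s x y z w → s * x * y * z * w ≡ s * (z * w) * (x * y)
        l = solve-∀ ℚ-ring

      fibre-b : ∀ b b′ → evalP (env (base i) z b) F ≡ evalP (env (base i) z b′) F
      fibre-b = fibre i (pathb (base i) z) (admissible-odd i t≢h) (admissible-invʳ i t≢h) c≢0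
        λ b → trans (eval-modulus (env (base i) z b)) (trans (l (evalP (env (base i) z b) qint-n) (1ℚ - z * Q) (z - Q) (1ℚ - b * Q) (b - Q))
          (cong (λ x → x * ((1ℚ - z * Q) * (z - Q)) * ((1ℚ - b * Q) * (b - Q))) (qint-q z b)))
        where
        l : ∀ s x y z w → s * x * y * z * w ≡ s * (x * y) * (z * w)
        l = solve-∀ ℚ-ring

    even-odd-injective : ∀ i → Injective (λ t → odd i (2 ℕ.* t))
    even-odd-injective i eq = ℕₚ.*-cancelˡ-≡ _ _ 2 (odd-injective i eq)

    constant-in-a : ∀ a a′ q b → evalP (env q a b) F ≡ evalP (env q a′ b) F
    constant-in-a a a′ q b = path-agreement F F (pathq a b) (pathq a′ b) base-injective (λ i →
      path-agreement F F (pathb (base i) a) (pathb (base i) a′) (even-odd-injective i) (λ t → fibre-a i t a a′) b) q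

    constant-in-b : ∀ b b′ q a → evalP (env q a b) F ≡ evalP (env q a b′) F
    constant-in-b b b′ q a = path-agreement F F (pathq a b) (pathq a b′) base-injective (λ i →
      path-agreement F F (patha (base i) b) (patha (base i) b′) (even-odd-injective i) (λ t → fibre-b i t b b′) a) q

    q-part : ℚ → ℚ
    q-part q = evalP (special q) F

    eval-q-part : ∀ q a b → evalP (env q a b) F ≡ q-part q
    eval-q-part q a b = trans (constant-in-a a (ι 2) q b) (constant-in-b b (ι 3) q (ι 2))

    open Comaximal (Good.comax D-good)

    -- At a = b = 1 the modulus times 1 - q is (1 - qⁿ)⁵, hence the fifth power of the Bezout
    -- relation. In its binomial expansion every term but the last contains D, and the last contains
    -- the modulus, so F divides the whole; this is the cofactor.
    complement : ℚ → ℚ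
    complement q = evalP (special q) G * evalP (special q) cofactor * (x ^ 4 + ι 5 * (x ^ 3 * z) + ι 10 * (x * x * (z * z)) + ι 10 * (x * z ^ 3) + ι 5 * z ^ 4)
        + evalP (special q) cofactor′ ^ 5 * (evalP (env q 1ℚ 1ℚ) H * (1ℚ - q))
      where
      x = evalP (special q) cofactor * evalP (special q) D
      z = evalP (special q) cofactor′ * (1ℚ - evalP (special q) (powP qP n))

    q-part*complement : ∀ q → q-part q * complement q ≡ constant ^ 5
    q-part*complement q = begin
      φ * (g * u * R + v ^ 5 * (k * (1ℚ - q)))   ≡⟨ l₁ φ g u R (v ^ 5) k (1ℚ - q) ⟩
      u * (φ * g) * R + v ^ 5 * (φ * k * (1ℚ - q))
        ≡⟨ cong₂ (λ x y → u * x * R + v ^ 5 * (y * (1ℚ - q))) (FG≈D (special q))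
             (trans (cong (_* k) (sym (eval-q-part q 1ℚ 1ℚ))) (trans (FH≈P (env q 1ℚ 1ℚ)) (eval-modulus (env q 1ℚ 1ℚ)))) ⟩
      u * d * R + v ^ 5 * (s * (1ℚ - 1ℚ * q ^ n) * (1ℚ - q ^ n) * (1ℚ - 1ℚ * q ^ n) * (1ℚ - q ^ n) * (1ℚ - q))
        ≡⟨ cong (λ y → u * d * R + v ^ 5 * y) (l₂ s (q ^ n) (1ℚ - q)) ⟩
      u * d * R + v ^ 5 * ((1ℚ - q) * s * ((1ℚ - q ^ n) * (1ℚ - q ^ n) * (1ℚ - q ^ n) * (1ℚ - q ^ n)))
        ≡⟨ cong (λ y → u * d * R + v ^ 5 * (y * ((1ℚ - q ^ n) * (1ℚ - q ^ n) * (1ℚ - q ^ n) * (1ℚ - q ^ n)))) (sum-geometric (env q 1ℚ 1ℚ) n) ⟩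
      u * d * R + v ^ 5 * ((1ℚ - q ^ n) * ((1ℚ - q ^ n) * (1ℚ - q ^ n) * (1ℚ - q ^ n) * (1ℚ - q ^ n)))
        ≡⟨ cong (λ w → u * d * R + v ^ 5 * ((1ℚ - w) * ((1ℚ - w) * (1ℚ - w) * (1ℚ - w) * (1ℚ - w)))) (eval-powP (special q) qP n) ⟨
      u * d * R + v ^ 5 * ((1ℚ - w) * ((1ℚ - w) * (1ℚ - w) * (1ℚ - w) * (1ℚ - w)))
        ≡⟨ l₃ (u * d) v (1ℚ - w) ⟩
      (u * d + v * (1ℚ - w)) ^ 5
        ≡⟨ cong (λ y → (u * d + v * (1ℚ - y)) ^ 5) (eval-powP (special q) qP n) ⟩
      (u * d + v * (1ℚ - q ^ n)) ^ 5
        ≡⟨ cong (_^ 5) (bezout q) ⟩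
      constant ^ 5 ∎
      where
      φ = q-part q
      g = evalP (special q) G
      u = evalP (special q) cofactor
      v = evalP (special q) cofactor′
      d = evalP (special q) D
      k = evalP (env q 1ℚ 1ℚ) H
      s = evalP (env q 1ℚ 1ℚ) qint-n
      w = evalP (special q) (powP qP n)
      R = (u * d) ^ 4 + ι 5 * ((u * d) ^ 3 * (v * (1ℚ - w))) + ι 10 * (u * d * (u * d) * (v * (1ℚ - w) * (v * (1ℚ - w))))
            + ι 10 * (u * d * (v * (1ℚ - w)) ^ 3) + ι 5 * (v * (1ℚ - w)) ^ 4
      l₁ : ∀ φ g u R v k x → φ * (g * u * R + v * (k * x)) ≡ u * (φ * g) * R + v * (φ * k * x)
      l₁ = solve-∀ ℚ-ring
      l₂ : ∀ s w x → s * (1ℚ - 1ℚ * w) * (1ℚ - w) * (1ℚ - 1ℚ * w) * (1ℚ - w) * x ≡ x * s * ((1ℚ - w) * (1ℚ - w) * (1ℚ - w) * (1ℚ - w))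
      l₂ = solve-∀ ℚ-ring
      l₃ : ∀ x v w →
        x * (1ℚ * x * x * x * x + ι 5 * (1ℚ * x * x * x * (v * w)) + ι 10 * (x * x * (v * w * (v * w)))
          + ι 10 * (x * (1ℚ * (v * w) * (v * w) * (v * w))) + ι 5 * (1ℚ * (v * w) * (v * w) * (v * w) * (v * w)))
        + 1ℚ * v * v * v * v * v * (w * (w * w * w * w)) ≡
        1ℚ * (x + v * w) * (x + v * w) * (x + v * w) * (x + v * w) * (x + v * w)
      l₃ = solve-∀ ℚ-ring

    q-part-constant : ∀ s t → q-part s ≡ q-part t
    q-part-constant = unit-constant (PF.degree pφ) (PF.degree pc) (PF.isPolyFun pφ) (PF.isPolyFun pc)
      (^-nonzero 5 constant≢0) q-part*complement
      where
      sp : Coordinate special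
      sp = pathq (ι 2) (ι 3)
      pφ : PF q-part
      pφ = PF-eval F sp
      PF-^ : ∀ {f} k → PF f → PF (λ t → f t ^ k)
      PF-^ zero    p = PF-const 1ℚ
      PF-^ (suc k) p = PF-* (PF-^ k p) p
      px = PF-* (PF-eval cofactor sp) (PF-eval D sp)
      pz = PF-* (PF-eval cofactor′ sp) (PF-eval (con 1ℚ ⊕ ⊖ powP qP n) sp)
      pc : PF complement
      pc = PF-+ (PF-* (PF-* (PF-eval G sp) (PF-eval cofactor sp))
          (PF-+ (PF-+ (PF-+ (PF-+ (PF-^ 4 px) (PF-* (PF-const (ι 5)) (PF-* (PF-^ 3 px) pz)))
            (PF-* (PF-const (ι 10)) (PF-* (PF-* px px) (PF-* pz pz))))
            (PF-* (PF-const (ι 10)) (PF-* px (PF-^ 3 pz)))) (PF-* (PF-const (ι 5)) (PF-^ 4 pz))))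
        (PF-* (PF-^ 5 (PF-eval cofactor′ sp)) (PF-* (PF-eval H (pathq 1ℚ 1ℚ)) (PF-eval (con 1ℚ ⊕ ⊖ var vq) sp)))

    common-factor-unit : IsUnitP F
    common-factor-unit = q-part 0ℚ
      , nonzero-*ˡ {q-part 0ℚ} {complement 0ℚ} (λ eq → ^-nonzero 5 constant≢0 (trans (sym (q-part*complement 0ℚ)) eq))
      , λ ρ → trans (sym (evalP-cong F (env-η ρ))) (trans (eval-q-part (ρ vq) (ρ va) (ρ vb)) (q-part-constant (ρ vq) 0ℚ))

  Good⇒CoprimeP : ∀ {D} → Good D → CoprimeP D (modulus n)
  Good⇒CoprimeP D-good F (G , FG≈D) (H , FH≈P) = common-factor-unit {F} {G} {H} D-good FG≈D FH≈P

-- Reduction of the congruence to admissible points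

-- Nothing is cancelled, so wherever an expression is defined its `denᴿ` is nonzero. This matters
-- because `CongMod` quantifies over all such points.
numᴿ denᴿ : RF → Poly
numᴿ (cst c)  = con c
numᴿ (vr v)   = var v
numᴿ (f +ʳ g) = numᴿ f ⊗ denᴿ g ⊕ numᴿ g ⊗ denᴿ f
numᴿ (f *ʳ g) = numᴿ f ⊗ numᴿ g
numᴿ (-ʳ f)   = ⊖ numᴿ f
numᴿ (f /ʳ g) = numᴿ f ⊗ denᴿ g
denᴿ (cst c)  = con 1ℚ
denᴿ (vr v)   = con 1ℚ
denᴿ (f +ʳ g) = denᴿ f ⊗ denᴿ g
denᴿ (f *ʳ g) = denᴿ f ⊗ denᴿ g
denᴿ (-ʳ f)   = denᴿ f
denᴿ (f /ʳ g) = denᴿ f ⊗ numᴿ g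

evalR-fraction : ∀ ρ f {x} → evalR ρ f ≡ just x → evalP ρ (denᴿ f) ≢ 0ℚ × x * evalP ρ (denᴿ f) ≡ evalP ρ (numᴿ f)
evalR-fraction ρ (cst c) refl = 1≢0 , *-identityʳ c
evalR-fraction ρ (vr v)  refl = 1≢0 , *-identityʳ (ρ v)
evalR-fraction ρ (f +ʳ g) eq with evalR ρ f | evalR ρ g | evalR-fraction ρ f | evalR-fraction ρ g
evalR-fraction ρ (f +ʳ g) refl | just x | just y | ihf | ihg with ihf refl | ihg refl
... | df≢0 , ef | dg≢0 , eg = *-nonzero df≢0 dg≢0 , trans (l x y (evalP ρ (denᴿ f)) (evalP ρ (denᴿ g)))
        (cong₂ (λ a b → a * evalP ρ (denᴿ g) + b * evalP ρ (denᴿ f)) ef eg)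
  where
  l : ∀ x y d e → (x + y) * (d * e) ≡ x * d * e + y * e * d
  l = solve-∀ ℚ-ring
evalR-fraction ρ (f *ʳ g) eq with evalR ρ f | evalR ρ g | evalR-fraction ρ f | evalR-fraction ρ g
evalR-fraction ρ (f *ʳ g) refl | just x | just y | ihf | ihg with ihf refl | ihg refl
... | df≢0 , ef | dg≢0 , eg = *-nonzero df≢0 dg≢0 , trans (l x y (evalP ρ (denᴿ f)) (evalP ρ (denᴿ g))) (cong₂ _*_ ef eg)
  where
  l : ∀ x y d e → x * y * (d * e) ≡ x * d * (y * e)
  l = solve-∀ ℚ-ring
evalR-fraction ρ (-ʳ f) eq with evalR ρ f | evalR-fraction ρ f
evalR-fraction ρ (-ʳ f) refl | just x | ihf with ihf refl
... | df≢0 , ef = df≢0 , trans (l x (evalP ρ (denᴿ f))) (cong -_ ef)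
  where
  l : ∀ x d → - x * d ≡ - (x * d)
  l = solve-∀ ℚ-ring
evalR-fraction ρ (f /ʳ g) eq with evalR ρ f | evalR ρ g | evalR-fraction ρ f | evalR-fraction ρ g
... | just x | just y | ihf | ihg with y ≟ 0ℚ
evalR-fraction ρ (f /ʳ g) refl | just x | just y | ihf | ihg | no y≢0 with ihf refl | ihg refl
... | df≢0 , ef | dg≢0 , eg = *-nonzero df≢0 (subst (_≢ 0ℚ) eg (*-nonzero y≢0 dg≢0)) , (begin
    x * i * (Df * evalP ρ (numᴿ g))   ≡⟨ cong (λ z → x * i * (Df * z)) eg ⟨
    x * i * (Df * (y * Dg))           ≡⟨ l x i Df y Dg ⟩
    x * Df * Dg * (y * i)             ≡⟨ cong₂ (λ u v → u * Dg * v) ef (ℚₚ.*-inverseʳ y {{ℚ.≢-nonZero y≢0}}) ⟩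
    evalP ρ (numᴿ f) * Dg * 1ℚ        ≡⟨ *-identityʳ (evalP ρ (numᴿ f) * Dg) ⟩
    evalP ρ (numᴿ f) * Dg             ∎)
  where
  i = ℚ.1/_ y {{ℚ.≢-nonZero y≢0}}
  Df = evalP ρ (denᴿ f)
  Dg = evalP ρ (denᴿ g)
  l : ∀ x i d y e → x * i * (d * (y * e)) ≡ x * d * e * (y * i)
  l = solve-∀ ℚ-ring

module _ (m : ℕ) where
  open Modulus m

  Good-q : Good qP
  Good-q = good nz (Comaximal-binomial 0ℚ (- 1ℚ) 1 0≢ (λ q → l q))
    where
    nz : ∀ ρ → Admissible ρ → ρ vq ≢ 0ℚ
    nz ρ ad = subst (_≢ 0ℚ) (sym (Admissible.q≡ ad)) (base-nonzero (Admissible.index ad))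
    0≢ : 0ℚ ^ n ≢ (- 1ℚ) ^ n
    0≢ eq = ^-nonzero n (neg-nonzero 1≢0) (trans (sym eq) (*-zeroʳ (0ℚ ^ (2 ℕ.* h))))
    l : ∀ q → q ≡ 0ℚ - - 1ℚ * (1ℚ * q)
    l = solve-∀ ℚ-ring

  Qp : Poly
  Qp = powP qP n

  eval-Q : ∀ ρ → evalP ρ Qp ≡ ρ vq ^ n
  eval-Q ρ = eval-powP ρ qP n

  Q-free-a : FreeOf va Qp
  Q-free-a = FreeOf-powP va qP n (λ _ _ → refl)

  Q-free-b : FreeOf vb Qp
  Q-free-b = FreeOf-powP vb qP n (λ _ _ → refl)

  Boundary : Env → Set
  Boundary ρ = (ρ va ≡ ρ vq ^ n ⊎ ρ va * ρ vq ^ n ≡ 1ℚ) ⊎ (ρ vb ≡ ρ vq ^ n ⊎ ρ vb * ρ vq ^ n ≡ 1ℚ)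

  private
    even : ℕ → ℕ
    even t = 2 ℕ.* t
    even-inj : ∀ i → Injective (λ t → odd i (even t))
    even-inj i eq = ℕₚ.*-cancelˡ-≡ _ _ 2 (odd-injective i eq)
    ≢h : ∀ t → even t ≢ h
    ≢h t eq = h≢even t (sym eq)

  module _ (N : Poly) (N-boundary : ∀ ρ → Admissible ρ → Boundary ρ → evalP ρ N ≡ 0ℚ) where

    private
      module D₁ = Division (divide va (con 1ℚ) Qp (λ _ _ → refl) Q-free-a N)
      module D₂ = Division (divide va Qp (con 1ℚ) Q-free-a (λ _ _ → refl) D₁.quotient)
      module D₃ = Division (divide vb (con 1ℚ) Qp (λ _ _ → refl) Q-free-b D₂.quotient)
      module D₄ = Division (divide vb Qp (con 1ℚ) Q-free-b (λ _ _ → refl) D₃.quotient)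

      remainder-zero : ∀ {d f q r} p → d ≡ 0ℚ → f ≡ 0ℚ → p * f ≡ d * q + r → r ≡ 0ℚ
      remainder-zero {q = q} {r} p refl refl eq = trans (sym (trans (cong (_+ r) (*-zeroˡ q)) (+-identityˡ r))) (trans (sym eq) (*-zeroʳ p))

      quotient-zero : ∀ {d f q r} p → d ≢ 0ℚ → r ≡ 0ℚ → f ≡ 0ℚ → p * f ≡ d * q + r → q ≡ 0ℚ
      quotient-zero {d} {q = q} p d≢0 refl refl eq = *-cancelˡ d≢0 (trans (sym (+-identityʳ (d * q))) (trans (sym eq) (trans (*-zeroʳ p) (sym (*-zeroʳ d)))))

      a-Q : ∀ ρ → ρ va ≢ ρ vq ^ n → 1ℚ * ρ va - evalP ρ Qp ≢ 0ℚ
      a-Q ρ ne = ≢⇒-≢0 (λ eq → ne (trans (sym (*-identityˡ (ρ va))) (trans eq (eval-Q ρ))))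
      Qa-1 : ∀ ρ → ρ va * ρ vq ^ n ≢ 1ℚ → evalP ρ Qp * ρ va - 1ℚ ≢ 0ℚ
      Qa-1 ρ ne = ≢⇒-≢0 (λ eq → ne (trans (*-comm (ρ va) (ρ vq ^ n)) (trans (cong (_* ρ va) (sym (eval-Q ρ))) eq)))
      b-Q : ∀ ρ → ρ vb ≢ ρ vq ^ n → 1ℚ * ρ vb - evalP ρ Qp ≢ 0ℚ
      b-Q ρ ne = ≢⇒-≢0 (λ eq → ne (trans (sym (*-identityˡ (ρ vb))) (trans eq (eval-Q ρ))))

      -- The remainder is free of a, so it may be evaluated at a = qⁿ, where dividend and divisor
      -- both vanish. For the same reason any sequence serves as test values of a, while b =
      -- q^{4t+1} keeps the point admissible.
      r₁≡0 : ∀ ρ → evalP ρ D₁.remainder ≡ 0ℚ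
      r₁≡0 = dense D₁.remainder (con 0ℚ) {τa = λ _ → ι} {τb = λ i _ t → odd i (even t)} base-injective (λ _ → ι-injective) (λ i _ → even-inj i)
        λ i s t → let ρ = env (base i) (odd i h) (odd i (even t)) in
          trans (sym (D₁.free (env (base i) (ι s) (odd i (even t))) (odd i h)))
            (remainder-zero (1ℚ ^ D₁.degree) (x≡y⇒x-y≡0 (trans (*-identityˡ (odd i h)) (sym (eval-Q ρ))))
              (N-boundary ρ (admissible-odd i (h≢even t)) (inj₁ (inj₁ refl))) (D₁.equation ρ))

      -- Off a = qⁿ the divisor can be cancelled, so the quotient inherits the zeros on the rest of
      -- the boundary and can be divided by the next linear factor.
      q₁-boundary : ∀ ρ → Admissible ρ → Boundary ρ → ρ va ≢ ρ vq ^ n → evalP ρ D₁.quotient ≡ 0ℚ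
      q₁-boundary ρ ad bd ne = quotient-zero (1ℚ ^ D₁.degree) (a-Q ρ ne) (r₁≡0 ρ) (N-boundary ρ ad bd) (D₁.equation ρ)

      r₂≡0 : ∀ ρ → evalP ρ D₂.remainder ≡ 0ℚ
      r₂≡0 = dense D₂.remainder (con 0ℚ) {τa = λ _ → ι} {τb = λ i _ t → odd i (even t)} base-injective (λ _ → ι-injective) (λ i _ → even-inj i)
        λ i s t → let ρ = env (base i) (inv (odd i h)) (odd i (even t)) in
          trans (sym (D₂.free (env (base i) (ι s) (odd i (even t))) (inv (odd i h))))
            (remainder-zero (evalP ρ Qp ^ D₂.degree) (x≡y⇒x-y≡0 (trans (cong (_* inv (odd i h)) (eval-Q ρ)) (*-inv (odd-nonzero i h))))
              (q₁-boundary ρ (admissible-invˡ i (h≢even t)) (inj₁ (inj₂ (inv*≡1 (odd-nonzero i h)))) (λ eq → odd≢inv i h h (sym eq))) (D₂.equation ρ))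

      q₂-boundary : ∀ ρ → Admissible ρ → Boundary ρ → ρ va ≢ ρ vq ^ n → ρ va * ρ vq ^ n ≢ 1ℚ → evalP ρ D₂.quotient ≡ 0ℚ
      q₂-boundary ρ ad bd ne ne′ = quotient-zero (evalP ρ Qp ^ D₂.degree) (Qa-1 ρ ne′) (r₂≡0 ρ) (q₁-boundary ρ ad bd ne) (D₂.equation ρ)

      r₃≡0 : ∀ ρ → evalP ρ D₃.remainder ≡ 0ℚ
      r₃≡0 = dense D₃.remainder (con 0ℚ) {τa = λ i s → odd i (even s)} {τb = λ _ _ → ι} base-injective (λ i → even-inj i) (λ _ _ → ι-injective)
        λ i s t → let ρ = env (base i) (odd i (even s)) (odd i h) in
          trans (sym (D₃.free (env (base i) (odd i (even s)) (ι t)) (odd i h)))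
            (remainder-zero (1ℚ ^ D₃.degree) (x≡y⇒x-y≡0 (trans (*-identityˡ (odd i h)) (sym (eval-Q ρ))))
              (q₂-boundary ρ (admissible-odd i (≢h s)) (inj₂ (inj₁ refl)) (odd≢odd i (≢h s)) (odd*odd≢1 i (even s) h)) (D₃.equation ρ))

      q₃-boundary : ∀ ρ → Admissible ρ → Boundary ρ → ρ va ≢ ρ vq ^ n → ρ va * ρ vq ^ n ≢ 1ℚ → ρ vb ≢ ρ vq ^ n → evalP ρ D₃.quotient ≡ 0ℚ
      q₃-boundary ρ ad bd ne ne′ ne″ = quotient-zero (1ℚ ^ D₃.degree) (b-Q ρ ne″) (r₃≡0 ρ) (q₂-boundary ρ ad bd ne ne′) (D₃.equation ρ)

      r₄≡0 : ∀ ρ → evalP ρ D₄.remainder ≡ 0ℚ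
      r₄≡0 = dense D₄.remainder (con 0ℚ) {τa = λ i s → odd i (even s)} {τb = λ _ _ → ι} base-injective (λ i → even-inj i) (λ _ _ → ι-injective)
        λ i s t → let ρ = env (base i) (odd i (even s)) (inv (odd i h)) in
          trans (sym (D₄.free (env (base i) (odd i (even s)) (ι t)) (inv (odd i h))))
            (remainder-zero (evalP ρ Qp ^ D₄.degree) (x≡y⇒x-y≡0 (trans (cong (_* inv (odd i h)) (eval-Q ρ)) (*-inv (odd-nonzero i h))))
              (q₃-boundary ρ (admissible-invʳ i (≢h s)) (inj₂ (inj₂ (inv*≡1 (odd-nonzero i h)))) (odd≢odd i (≢h s)) (odd*odd≢1 i (even s) h)
                (λ eq → odd≢inv i h h (sym eq))) (D₄.equation ρ))

    -- The divisions by qⁿa - 1 and qⁿb - 1 cost powers of their leading coefficient qⁿ, which are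
    -- coprime to the modulus.
    boundaryUnit boundaryQuotient : Poly
    boundaryUnit = powP Qp D₄.degree ⊗ powP Qp D₂.degree
    boundaryQuotient = D₄.quotient

    boundaryUnit-good : Good boundaryUnit
    boundaryUnit-good = Good-⊗ {powP Qp D₄.degree} {powP Qp D₂.degree}
      (Good-powP {Qp} D₄.degree (Good-powP {qP} n Good-q)) (Good-powP {Qp} D₂.degree (Good-powP {qP} n Good-q))

    boundary-division : ∀ ρ → evalP ρ N * evalP ρ boundaryUnit ≡
      (1ℚ - ρ va * ρ vq ^ n) * (ρ va - ρ vq ^ n) * (1ℚ - ρ vb * ρ vq ^ n) * (ρ vb - ρ vq ^ n) * evalP ρ boundaryQuotient
    boundary-division ρ = begin
      evalP ρ N * (evalP ρ (powP Qp D₄.degree) * evalP ρ (powP Qp D₂.degree))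
        ≡⟨ cong₂ (λ x y → evalP ρ N * (x * y)) (eval-powP ρ Qp D₄.degree) (eval-powP ρ Qp D₂.degree) ⟩
      evalP ρ N * (P₄ * P₂)
        ≡⟨ cong (_* (P₄ * P₂)) (trans (sym (trans (cong (_* evalP ρ N) (1^ D₁.degree)) (*-identityˡ (evalP ρ N)))) (exact ((1ℚ * a - Q) * evalP ρ D₁.quotient) (r₁≡0 ρ) (D₁.equation ρ))) ⟩
      (1ℚ * a - Q) * evalP ρ D₁.quotient * (P₄ * P₂)
        ≡⟨ l₁ (1ℚ * a - Q) (evalP ρ D₁.quotient) P₄ P₂ ⟩
      (1ℚ * a - Q) * (P₂ * evalP ρ D₁.quotient) * P₄
        ≡⟨ cong (λ x → (1ℚ * a - Q) * x * P₄) (exact ((Q * a - 1ℚ) * evalP ρ D₂.quotient) (r₂≡0 ρ) (D₂.equation ρ)) ⟩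
      (1ℚ * a - Q) * ((Q * a - 1ℚ) * evalP ρ D₂.quotient) * P₄
        ≡⟨ cong (λ x → (1ℚ * a - Q) * ((Q * a - 1ℚ) * x) * P₄) (trans (sym (trans (cong (_* evalP ρ D₂.quotient) (1^ D₃.degree)) (*-identityˡ (evalP ρ D₂.quotient)))) (exact ((1ℚ * b - Q) * evalP ρ D₃.quotient) (r₃≡0 ρ) (D₃.equation ρ))) ⟩
      (1ℚ * a - Q) * ((Q * a - 1ℚ) * ((1ℚ * b - Q) * evalP ρ D₃.quotient)) * P₄
        ≡⟨ l₂ (1ℚ * a - Q) (Q * a - 1ℚ) (1ℚ * b - Q) (evalP ρ D₃.quotient) P₄ ⟩
      (1ℚ * a - Q) * (Q * a - 1ℚ) * (1ℚ * b - Q) * (P₄ * evalP ρ D₃.quotient)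
        ≡⟨ cong ((1ℚ * a - Q) * (Q * a - 1ℚ) * (1ℚ * b - Q) *_) (exact ((Q * b - 1ℚ) * evalP ρ D₄.quotient) (r₄≡0 ρ) (D₄.equation ρ)) ⟩
      (1ℚ * a - Q) * (Q * a - 1ℚ) * (1ℚ * b - Q) * ((Q * b - 1ℚ) * evalP ρ D₄.quotient)
        ≡⟨ l₃ a b Q (evalP ρ D₄.quotient) ⟩
      (1ℚ - a * Q) * (a - Q) * (1ℚ - b * Q) * (b - Q) * evalP ρ D₄.quotient
        ≡⟨ cong (λ x → (1ℚ - a * x) * (a - x) * (1ℚ - b * x) * (b - x) * evalP ρ D₄.quotient) (eval-Q ρ) ⟩
      (1ℚ - a * ρ vq ^ n) * (a - ρ vq ^ n) * (1ℚ - b * ρ vq ^ n) * (b - ρ vq ^ n) * evalP ρ D₄.quotient ∎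
      where
      a = ρ va
      b = ρ vb
      Q = evalP ρ Qp
      P₂ = Q ^ D₂.degree
      P₄ = Q ^ D₄.degree
      exact : ∀ {x r} y → r ≡ 0ℚ → x ≡ y + r → x ≡ y
      exact y refl eq = trans eq (+-identityʳ y)
      l₁ : ∀ x q p r → x * q * (p * r) ≡ x * (r * q) * p
      l₁ = solve-∀ ℚ-ring
      l₂ : ∀ x y z q p → x * (y * (z * q)) * p ≡ x * y * z * (p * q)
      l₂ = solve-∀ ℚ-ring
      l₃ : ∀ a b Q q → (1ℚ * a - Q) * (Q * a - 1ℚ) * (1ℚ * b - Q) * ((Q * b - 1ℚ) * q) ≡ (1ℚ - a * Q) * (a - Q) * (1ℚ - b * Q) * (b - Q) * q
      l₃ = solve-∀ ℚ-ring

  -- The boundary divisions are applied to the numerator of g, which is the difference divided by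
  -- [n]. It vanishes on the boundary because [n] is nonzero at admissible points; thus [n] never
  -- has to be shown coprime to the linear factors.
  congruence : ∀ L R (lv rv g : Env → ℚ) →
    (∀ ρ → Admissible ρ → evalR ρ L ≡ just (lv ρ)) →
    (∀ ρ → Admissible ρ → evalR ρ R ≡ just (rv ρ)) →
    Reg g → (∀ ρ → Admissible ρ → lv ρ - rv ρ ≡ evalP ρ qint-n * g ρ) →
    (∀ ρ → Admissible ρ → Boundary ρ → lv ρ ≡ rv ρ) →
    CongMod (modulus n) L R
  congruence L R lv rv g L⇓ R⇓ (reg N D D-good frac) divisible equal =
    boundaryQuotient N N-boundary , D ⊗ boundaryUnit N N-boundary
    , Good⇒CoprimeP (Good-⊗ D-good (boundaryUnit-good N N-boundary))
    , final
    where
    qint≢0 : ∀ ρ → Admissible ρ → evalP ρ qint-n ≢ 0ℚ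
    qint≢0 ρ ad = subst (_≢ 0ℚ) (evalP-cong qint-n λ { vq → sym (Admissible.q≡ ad) ; va → refl ; vb → refl })
      (qint-n≢0 (Admissible.index ad) (ρ va) (ρ vb))
    N-boundary : ∀ ρ → Admissible ρ → Boundary ρ → evalP ρ N ≡ 0ℚ
    N-boundary ρ ad bd = trans (sym (frac ρ ad)) (trans (cong (_* evalP ρ D) g≡0) (*-zeroˡ (evalP ρ D)))
      where
      g≡0 : g ρ ≡ 0ℚ
      g≡0 = *-cancelˡ (qint≢0 ρ ad) (trans (sym (divisible ρ ad)) (trans (x≡y⇒x-y≡0 (equal ρ ad bd)) (sym (*-zeroʳ (evalP ρ qint-n)))))
    B = boundaryUnit N N-boundary
    M = boundaryQuotient N N-boundary
    den num : Poly
    den = denᴿ L ⊗ denᴿ R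
    num = numᴿ L ⊗ denᴿ R ⊕ ⊖ (numᴿ R ⊗ denᴿ L)
    difference : ∀ ρ {x y} → evalR ρ L ≡ just x → evalR ρ R ≡ just y → evalP ρ den ≢ 0ℚ × (x - y) * evalP ρ den ≡ evalP ρ num
    difference ρ {x} {y} ex ey with evalR-fraction ρ L ex | evalR-fraction ρ R ey
    ... | dL≢0 , eL | dR≢0 , eR = *-nonzero dL≢0 dR≢0 ,
      trans (l x y (evalP ρ (denᴿ L)) (evalP ρ (denᴿ R))) (cong₂ (λ u v → u * evalP ρ (denᴿ R) - v * evalP ρ (denᴿ L)) eL eR)
      where
      l : ∀ x y d e → (x - y) * (d * e) ≡ x * d * e - y * e * d
      l = solve-∀ ℚ-ring
    -- The values lv and rv are known at admissible points only; cleared of denominators, the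
    -- relation extends by density to every point where both sides are defined. The test points give
    -- a an even and b an odd index, so that a ≠ b.
    polynomial-identity : (num ⊗ (D ⊗ B)) ≈P (M ⊗ modulus n ⊗ den)
    polynomial-identity = dense (num ⊗ (D ⊗ B)) (M ⊗ modulus n ⊗ den) {τa = λ i s → odd i (even s)} {τb = λ i _ t → odd i (suc (even t))}
      base-injective even-inj (λ i _ eq → ℕₚ.*-cancelˡ-≡ _ _ 2 (ℕₚ.suc-injective (odd-injective i eq)))
      λ i s t → at (env (base i) (odd i (even s)) (odd i (suc (even t)))) (admissible-odd i (ℕₚ.even≢odd s t))
      where
      at : ∀ ρ → Admissible ρ → evalP ρ num * (evalP ρ D * evalP ρ B) ≡ evalP ρ M * evalP ρ (modulus n) * evalP ρ den
      at ρ ad = begin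
        evalP ρ num * (evalP ρ D * evalP ρ B)
          ≡⟨ cong (_* (evalP ρ D * evalP ρ B)) (proj₂ (difference ρ (L⇓ ρ ad) (R⇓ ρ ad))) ⟨
        (lv ρ - rv ρ) * evalP ρ den * (evalP ρ D * evalP ρ B)
          ≡⟨ cong (λ x → x * evalP ρ den * (evalP ρ D * evalP ρ B)) (divisible ρ ad) ⟩
        evalP ρ qint-n * g ρ * evalP ρ den * (evalP ρ D * evalP ρ B)
          ≡⟨ l₁ (evalP ρ qint-n) (g ρ) (evalP ρ den) (evalP ρ D) (evalP ρ B) ⟩
        evalP ρ qint-n * (g ρ * evalP ρ D * evalP ρ B) * evalP ρ den
          ≡⟨ cong (λ x → evalP ρ qint-n * (x * evalP ρ B) * evalP ρ den) (frac ρ ad) ⟩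
        evalP ρ qint-n * (evalP ρ N * evalP ρ B) * evalP ρ den
          ≡⟨ cong (λ x → evalP ρ qint-n * x * evalP ρ den) (boundary-division N N-boundary ρ) ⟩
        evalP ρ qint-n * ((1ℚ - ρ va * ρ vq ^ n) * (ρ va - ρ vq ^ n) * (1ℚ - ρ vb * ρ vq ^ n) * (ρ vb - ρ vq ^ n) * evalP ρ M) * evalP ρ den
          ≡⟨ l₂ (evalP ρ qint-n) (1ℚ - ρ va * ρ vq ^ n) (ρ va - ρ vq ^ n) (1ℚ - ρ vb * ρ vq ^ n) (ρ vb - ρ vq ^ n) (evalP ρ M) (evalP ρ den) ⟩
        evalP ρ M * (evalP ρ qint-n * (1ℚ - ρ va * ρ vq ^ n) * (ρ va - ρ vq ^ n) * (1ℚ - ρ vb * ρ vq ^ n) * (ρ vb - ρ vq ^ n)) * evalP ρ den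
          ≡⟨ cong (λ x → evalP ρ M * x * evalP ρ den) (eval-modulus ρ) ⟨
        evalP ρ M * evalP ρ (modulus n) * evalP ρ den ∎
        where
        l₁ : ∀ s g e d b → s * g * e * (d * b) ≡ s * (g * d * b) * e
        l₁ = solve-∀ ℚ-ring
        l₂ : ∀ s x y z w m d → s * (x * y * z * w * m) * d ≡ m * (s * x * y * z * w) * d
        l₂ = solve-∀ ℚ-ring
    final : ∀ ρ x y → evalR ρ L ≡ just x → evalR ρ R ≡ just y → (x - y) * evalP ρ (D ⊗ B) ≡ evalP ρ M * evalP ρ (modulus n)
    final ρ x y ex ey = *-cancelˡ (proj₁ (difference ρ ex ey)) (begin
      evalP ρ den * ((x - y) * evalP ρ (D ⊗ B))     ≡⟨ l (evalP ρ den) (x - y) (evalP ρ (D ⊗ B)) ⟩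
      (x - y) * evalP ρ den * evalP ρ (D ⊗ B)       ≡⟨ cong (_* evalP ρ (D ⊗ B)) (proj₂ (difference ρ ex ey)) ⟩
      evalP ρ num * evalP ρ (D ⊗ B)                 ≡⟨ polynomial-identity ρ ⟩
      evalP ρ M * evalP ρ (modulus n) * evalP ρ den ≡⟨ *-comm (evalP ρ M * evalP ρ (modulus n)) (evalP ρ den) ⟩
      evalP ρ den * (evalP ρ M * evalP ρ (modulus n)) ∎)
      where
      l : ∀ d x e → d * (x * e) ≡ x * d * e
      l = solve-∀ ℚ-ring

-- q-binomial coefficients

-- rising p z L = (z; p)_L and qfactorial p L = (p; p)_L.
rising : ℚ → ℚ → ℕ → ℚ
rising p z L = prod L (λ j → 1ℚ - z * p ^ j)

qfactorial : ℚ → ℕ → ℚ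
qfactorial p L = prod L (λ j → 1ℚ - p ^ j * p)

qbinomial : ℚ → ℚ → ℕ → ℚ
qbinomial p z L = rising p z L / qfactorial p L

rising-front : ∀ p z L → rising p z (suc L) ≡ (1ℚ - z) * rising p (z * p) L
rising-front p z L = trans (prod-front L (λ j → 1ℚ - z * p ^ j))
  (cong₂ _*_ (cong (λ x → 1ℚ - x) (*-identityʳ z)) (prod-cong L (λ j _ → cong (λ x → 1ℚ - x) (l z p (p ^ j)))))
  where
  l : ∀ z p x → z * (x * p) ≡ z * p * x
  l = solve-∀ ℚ-ring

module QBinomial (p : ℚ) (nonzero : ∀ L → qfactorial p L ≢ 0ℚ) where

  binom : ℚ → ℕ → ℚ
  binom = qbinomial p

  binom-zero : ∀ z → binom z 0 ≡ 1ℚ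
  binom-zero z = *-inv 1≢0

  binom-suc : ∀ z L → (1ℚ - p ^ L * p) * binom z (suc L) ≡ (1ℚ - z * p ^ L) * binom z L
  binom-suc z L = begin
    d * (rising p z L * e * inv (F * d))           ≡⟨ cong (λ x → d * (rising p z L * e * x)) (inv-* (nonzero L) d≢0) ⟩
    d * (rising p z L * e * (inv F * inv d))       ≡⟨ l d (rising p z L) e (inv F) (inv d) ⟩
    e * (rising p z L * inv F) * (d * inv d)       ≡⟨ cong (e * (rising p z L * inv F) *_) (*-inv d≢0) ⟩
    e * (rising p z L * inv F) * 1ℚ                ≡⟨ *-identityʳ (e * (rising p z L * inv F)) ⟩
    e * (rising p z L * inv F)                     ∎
    where
    d = 1ℚ - p ^ L * p
    e = 1ℚ - z * p ^ L
    F = qfactorial p L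
    d≢0 : d ≢ 0ℚ
    d≢0 = nonzero-*ʳ {F} (nonzero (suc L))
    l : ∀ d r e f i → d * (r * e * (f * i)) ≡ e * (r * f) * (d * i)
    l = solve-∀ ℚ-ring

  -- Multiplied by 1 - p^{L+1}, it is the splitting 1 - zp^{L+1} = (1 - z) + z(1 - p^{L+1}).
  pascal : ∀ z L → binom (z * p) (suc L) ≡ binom z (suc L) + z * binom (z * p) L
  pascal z L = *-cancelˡ d≢0 (begin
    d * binom (z * p) (suc L)                     ≡⟨ binom-suc (z * p) L ⟩
    (1ℚ - z * p * p ^ L) * (r * inv F)            ≡⟨ l₁ z p (p ^ L) (r * inv F) ⟩
    (1ℚ - z) * (r * inv F) + z * d * (r * inv F)  ≡⟨ cong (_+ z * d * (r * inv F)) front ⟨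
    d * binom z (suc L) + z * d * (r * inv F)     ≡⟨ l₂ d (binom z (suc L)) z (r * inv F) ⟩
    d * (binom z (suc L) + z * binom (z * p) L)   ∎)
    where
    d = 1ℚ - p ^ L * p
    F = qfactorial p L
    r = rising p (z * p) L
    d≢0 : d ≢ 0ℚ
    d≢0 = nonzero-*ʳ {F} (nonzero (suc L))
    front : d * binom z (suc L) ≡ (1ℚ - z) * (r * inv F)
    front = begin
      d * (rising p z (suc L) * inv (F * d))        ≡⟨ cong₂ (λ x y → d * (x * y)) (rising-front p z L) (inv-* (nonzero L) d≢0) ⟩
      d * ((1ℚ - z) * r * (inv F * inv d))          ≡⟨ l₃ d (1ℚ - z) r (inv F) (inv d) ⟩
      (1ℚ - z) * (r * inv F) * (d * inv d)          ≡⟨ cong ((1ℚ - z) * (r * inv F) *_) (*-inv d≢0) ⟩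
      (1ℚ - z) * (r * inv F) * 1ℚ                   ≡⟨ *-identityʳ ((1ℚ - z) * (r * inv F)) ⟩
      (1ℚ - z) * (r * inv F)                        ∎
      where
      l₃ : ∀ d e r f i → d * (e * r * (f * i)) ≡ e * (r * f) * (d * i)
      l₃ = solve-∀ ℚ-ring
    l₁ : ∀ z p x r → (1ℚ - z * p * x) * r ≡ (1ℚ - z) * r + z * (1ℚ - x * p) * r
    l₁ = solve-∀ ℚ-ring
    l₂ : ∀ d b z r → d * b + z * d * r ≡ d * (b + z * r)
    l₂ = solve-∀ ℚ-ring

  -- By the q-binomial theorem, the coefficient of t^L in the product of (zwt; p)_∞/(wt; p)_∞ and
  -- (wt; p)_∞/(t; p)_∞.
  convolution : ℚ → ℚ → ℕ → ℚ
  convolution z w L = sum (suc L) (λ i → binom z i * w ^ i * binom w (L ℕ.∸ i))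

  -- Writing 1 - p^{L+1} = (1 - p^{L+1-i}) + p^{L+1-i}(1 - p^i), each part shortens one of the two
  -- quotients by `binom-suc`. After an index shift in the second part, the terms recombine to the
  -- same convolution at L.
  convolution-suc : ∀ z w L → (1ℚ - p ^ L * p) * convolution z w (suc L) ≡ (1ℚ - z * w * p ^ L) * convolution z w L
  convolution-suc z w L = begin
    (1ℚ - p ^ suc L) * sum (suc (suc L)) (λ i → x i * y (suc L ℕ.∸ i))
      ≡⟨ sum-*ˡ (suc (suc L)) (1ℚ - p ^ suc L) (λ i → x i * y (suc L ℕ.∸ i)) ⟨
    sum (suc (suc L)) (λ i → (1ℚ - p ^ suc L) * (x i * y (suc L ℕ.∸ i)))
      ≡⟨ sum-cong (suc (suc L)) (λ i i<2+L → split i (ℕ.s≤s⁻¹ i<2+L)) ⟩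
    sum (suc (suc L)) (λ i → A i + B i)
      ≡⟨ sum-+ (suc (suc L)) A B ⟩
    sum (suc L) A + A (suc L) + sum (suc (suc L)) B
      ≡⟨ cong₂ (λ u v → sum (suc L) A + u + v) A-last (trans (sum-front (suc L) B) (trans (cong (_+ sum (suc L) (λ i → B (suc i))) B-first) (+-identityˡ (sum (suc L) (λ i → B (suc i)))))) ⟩
    sum (suc L) A + 0ℚ + sum (suc L) (λ i → B (suc i))
      ≡⟨ cong (_+ sum (suc L) (λ i → B (suc i))) (+-identityʳ (sum (suc L) A)) ⟩
    sum (suc L) A + sum (suc L) (λ i → B (suc i))
      ≡⟨ sum-+ (suc L) A (λ i → B (suc i)) ⟨
    sum (suc L) (λ i → A i + B (suc i))
      ≡⟨ sum-cong (suc L) (λ i i<1+L → combine i (ℕ.s≤s⁻¹ i<1+L)) ⟩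
    sum (suc L) (λ i → (1ℚ - z * w * p ^ L) * (x i * y (L ℕ.∸ i)))
      ≡⟨ sum-*ˡ (suc L) (1ℚ - z * w * p ^ L) (λ i → x i * y (L ℕ.∸ i)) ⟩
    (1ℚ - z * w * p ^ L) * convolution z w L ∎
    where
    x y : ℕ → ℚ
    x i = binom z i * w ^ i
    y = binom w
    A B : ℕ → ℚ
    A i = x i * ((1ℚ - p ^ (suc L ℕ.∸ i)) * y (suc L ℕ.∸ i))
    B i = p ^ (suc L ℕ.∸ i) * ((1ℚ - p ^ i) * x i) * y (suc L ℕ.∸ i)
    split : ∀ i → i ℕ.≤ suc L → (1ℚ - p ^ suc L) * (x i * y (suc L ℕ.∸ i)) ≡ A i + B i
    split i i≤ = trans (cong (λ e → (1ℚ - e) * (x i * y (suc L ℕ.∸ i))) (trans (cong (p ^_) (sym (ℕₚ.m+[n∸m]≡n i≤))) (^-+ p i (suc L ℕ.∸ i))))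
      (l (p ^ i) (p ^ (suc L ℕ.∸ i)) (x i) (y (suc L ℕ.∸ i)))
      where
      l : ∀ a b x y → (1ℚ - a * b) * (x * y) ≡ x * ((1ℚ - b) * y) + b * ((1ℚ - a) * x) * y
      l = solve-∀ ℚ-ring
    A-last : A (suc L) ≡ 0ℚ
    A-last = trans (cong (λ k → x (suc L) * ((1ℚ - p ^ k) * y k)) (ℕₚ.n∸n≡0 (suc L))) (l (x (suc L)) (y 0))
      where
      l : ∀ x y → x * ((1ℚ - 1ℚ) * y) ≡ 0ℚ
      l = solve-∀ ℚ-ring
    B-first : B 0 ≡ 0ℚ
    B-first = l (p ^ suc L) (x 0) (y (suc L))
      where
      l : ∀ a x y → a * ((1ℚ - 1ℚ) * x) * y ≡ 0ℚ
      l = solve-∀ ℚ-ring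
    combine : ∀ i → i ℕ.≤ L → A i + B (suc i) ≡ (1ℚ - z * w * p ^ L) * (x i * y (L ℕ.∸ i))
    combine i i≤L = begin
      x i * ((1ℚ - p ^ (suc L ℕ.∸ i)) * y (suc L ℕ.∸ i)) + b * ((1ℚ - p ^ suc i) * x (suc i)) * y (L ℕ.∸ i)
        ≡⟨ cong (λ k → x i * ((1ℚ - p ^ k) * y k) + b * ((1ℚ - p ^ suc i) * x (suc i)) * y (L ℕ.∸ i)) (ℕₚ.+-∸-assoc 1 i≤L) ⟩
      x i * ((1ℚ - b * p) * y (suc (L ℕ.∸ i))) + b * ((1ℚ - p ^ suc i) * (binom z (suc i) * (w ^ i * w))) * y (L ℕ.∸ i)
        ≡⟨ cong₂ (λ u v → x i * u + b * v * y (L ℕ.∸ i)) (binom-suc w (L ℕ.∸ i))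
             (trans (sym (*-assoc (1ℚ - p ^ suc i) (binom z (suc i)) (w ^ i * w))) (cong (_* (w ^ i * w)) (binom-suc z i))) ⟩
      x i * ((1ℚ - w * b) * y (L ℕ.∸ i)) + b * ((1ℚ - z * p ^ i) * binom z i * (w ^ i * w)) * y (L ℕ.∸ i)
        ≡⟨ l (binom z i) (w ^ i) w b (y (L ℕ.∸ i)) z (p ^ i) ⟩
      (1ℚ - z * w * (p ^ i * b)) * (x i * y (L ℕ.∸ i))
        ≡⟨ cong (λ e → (1ℚ - z * w * e) * (x i * y (L ℕ.∸ i))) (trans (sym (^-+ p i (L ℕ.∸ i))) (cong (p ^_) (ℕₚ.m+[n∸m]≡n i≤L))) ⟩
      (1ℚ - z * w * p ^ L) * (x i * y (L ℕ.∸ i)) ∎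
      where
      b = p ^ (L ℕ.∸ i)
      l : ∀ f e w b y z a → f * e * ((1ℚ - w * b) * y) + b * ((1ℚ - z * a) * f * (e * w)) * y ≡ (1ℚ - z * w * (a * b)) * (f * e * y)
      l = solve-∀ ℚ-ring

  vandermonde : ∀ z w L → convolution z w L ≡ binom (z * w) L
  vandermonde z w zero = trans (cong₂ (λ a b → 0ℚ + a * 1ℚ * b) (binom-zero z) (binom-zero w)) (sym (binom-zero (z * w)))
  vandermonde z w (suc L) = *-cancelˡ d≢0 (trans (convolution-suc z w L)
    (trans (cong ((1ℚ - z * w * p ^ L) *_) (vandermonde z w L)) (sym (binom-suc (z * w) L))))
    where
    d≢0 : 1ℚ - p ^ L * p ≢ 0ℚ
    d≢0 = nonzero-*ʳ {qfactorial p L} (nonzero (suc L))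

  -- Isolating both extreme terms of the convolution of binom w with itself.
  square-root : ∀ w L → (1ℚ + w ^ suc L) * binom w (suc L) ≡
    binom (w * w) (suc L) - sum L (λ i → binom w (suc i) * w ^ suc i * binom w (L ℕ.∸ i))
  square-root w L = trans (l (w ^ suc L) (binom w (suc L)) S) (cong (_- S) (sym (begin
    binom (w * w) (suc L)
      ≡⟨ vandermonde w w (suc L) ⟨
    sum (suc L) T + T (suc L)
      ≡⟨ cong₂ _+_ (sum-front L T) (cong (λ k → binom w (suc L) * w ^ suc L * binom w k) (ℕₚ.n∸n≡0 (suc L))) ⟩
    binom w 0 * 1ℚ * binom w (suc L) + S + binom w (suc L) * w ^ suc L * binom w 0
      ≡⟨ cong (λ x → x * 1ℚ * binom w (suc L) + S + binom w (suc L) * w ^ suc L * x) (binom-zero w) ⟩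
    1ℚ * 1ℚ * binom w (suc L) + S + binom w (suc L) * w ^ suc L * 1ℚ
      ≡⟨ l′ (binom w (suc L)) S (w ^ suc L) ⟩
    (1ℚ + w ^ suc L) * binom w (suc L) + S ∎)))
    where
    T : ℕ → ℚ
    T i = binom w i * w ^ i * binom w (suc L ℕ.∸ i)
    S = sum L (λ i → binom w (suc i) * w ^ suc i * binom w (L ℕ.∸ i))
    l : ∀ e b s → (1ℚ + e) * b ≡ (1ℚ + e) * b + s - s
    l = solve-∀ ℚ-ring
    l′ : ∀ b s e → 1ℚ * 1ℚ * b + s + b * e * 1ℚ ≡ (1ℚ + e) * b + s
    l′ = solve-∀ ℚ-ring

  binom-p : ∀ L → binom p L ≡ 1ℚ
  binom-p L = /-intro (nonzero L) (trans (prod-cong L (λ j _ → cong (λ x → 1ℚ - x) (*-comm p (p ^ j)))) (sym (*-identityˡ (qfactorial p L))))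

  twoSided : ℚ → ℕ → ℕ → ℚ
  twoSided z l r = prod l (λ j → 1ℚ - z * inv p ^ suc j) * rising p z r

  twoSided-step : p ≢ 0ℚ → ∀ z l r →
    twoSided z (suc l) r / qfactorial p (suc (l ℕ.+ r)) ≡
    twoSided z l (suc r) / qfactorial p (suc (l ℕ.+ r)) - z * inv p ^ suc l * (twoSided z l r / qfactorial p (l ℕ.+ r))
  twoSided-step p≢0 z l r = begin
    D * (1ℚ - z * e) * R * inv (F * d)
      ≡⟨ l₁ D z e R (inv (F * d)) (p ^ r) ⟩
    D * (R * (1ℚ - z * p ^ r)) * inv (F * d) - z * (e - p ^ r) * (D * R) * inv (F * d)
      ≡⟨ cong (λ x → D * (R * (1ℚ - z * p ^ r)) * inv (F * d) - z * x * (D * R) * inv (F * d)) e-p ⟩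
    D * (R * (1ℚ - z * p ^ r)) * inv (F * d) - z * (e * d) * (D * R) * inv (F * d)
      ≡⟨ cong (λ x → D * (R * (1ℚ - z * p ^ r)) * inv (F * d) - z * (e * d) * (D * R) * x) (inv-* (nonzero (l ℕ.+ r)) d≢0) ⟩
    D * (R * (1ℚ - z * p ^ r)) * inv (F * d) - z * (e * d) * (D * R) * (inv F * inv d)
      ≡⟨ l₂ (D * (R * (1ℚ - z * p ^ r)) * inv (F * d)) z e d (D * R) (inv F) (inv d) ⟩
    D * (R * (1ℚ - z * p ^ r)) * inv (F * d) - z * e * (D * R * inv F) * (d * inv d)
      ≡⟨ cong (λ x → D * (R * (1ℚ - z * p ^ r)) * inv (F * d) - x) (trans (cong (z * e * (D * R * inv F) *_) (*-inv d≢0)) (*-identityʳ (z * e * (D * R * inv F)))) ⟩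
    D * (R * (1ℚ - z * p ^ r)) * inv (F * d) - z * e * (D * R * inv F) ∎
    where
    D = prod l (λ j → 1ℚ - z * inv p ^ suc j)
    R = rising p z r
    e = inv p ^ suc l
    F = qfactorial p (l ℕ.+ r)
    d = 1ℚ - p ^ (l ℕ.+ r) * p
    d≢0 : d ≢ 0ℚ
    d≢0 = nonzero-*ʳ {F} (nonzero (suc (l ℕ.+ r)))
    e-p : e - p ^ r ≡ e * d
    e-p = begin
      e - p ^ r                                 ≡⟨ cong (λ x → e - x) (*-identityˡ (p ^ r)) ⟨
      e - 1ℚ * p ^ r                            ≡⟨ cong (λ x → e - x * p ^ r) (trans (sym (^-distrib (inv p) p (suc l))) (trans (cong (_^ suc l) (inv*≡1 p≢0)) (1^ (suc l)))) ⟨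
      e - e * (p ^ l * p) * p ^ r               ≡⟨ l₃ e (p ^ l) p (p ^ r) ⟩
      e * (1ℚ - p ^ l * p ^ r * p)              ≡⟨ cong (λ x → e * (1ℚ - x * p)) (^-+ p l r) ⟨
      e * d                                     ∎
      where
      l₃ : ∀ e a p b → e - e * (a * p) * b ≡ e * (1ℚ - a * b * p)
      l₃ = solve-∀ ℚ-ring
    l₁ : ∀ D z e R i x → D * (1ℚ - z * e) * R * i ≡ D * (R * (1ℚ - z * x)) * i - z * (e - x) * (D * R) * i
    l₁ = solve-∀ ℚ-ring
    l₂ : ∀ X z e d y f i → X - z * (e * d) * y * (f * i) ≡ X - z * e * (y * f) * (d * i)
    l₂ = solve-∀ ℚ-ring

  gaussian : ℕ → ℕ → ℚ
  gaussian l k = qfactorial p (l ℕ.+ k) / (qfactorial p l * qfactorial p k)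

  gaussian-zeroˡ : ∀ k → gaussian 0 k ≡ 1ℚ
  gaussian-zeroˡ k = /-intro (*-nonzero 1≢0 (nonzero k)) (l (qfactorial p k))
    where
    l : ∀ x → x ≡ 1ℚ * (1ℚ * x)
    l = solve-∀ ℚ-ring

  gaussian-zeroʳ : ∀ l → gaussian l 0 ≡ 1ℚ
  gaussian-zeroʳ k = /-intro (*-nonzero (nonzero k) 1≢0) (trans (cong (qfactorial p) (ℕₚ.+-identityʳ k)) (l (qfactorial p k)))
    where
    l : ∀ x → x ≡ 1ℚ * (x * 1ℚ)
    l = solve-∀ ℚ-ring

  gaussian-suc : ∀ l k → gaussian (suc l) (suc k) ≡ gaussian l (suc k) + p ^ suc l * gaussian (suc l) k
  gaussian-suc l k = /-intro (*-nonzero (nonzero (suc l)) (nonzero (suc k))) (sym (begin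
    (gaussian l (suc k) + p ^ suc l * gaussian (suc l) k) * (Fl * dl * (Fk * dk))
      ≡⟨ l₁ (gaussian l (suc k)) (p ^ suc l) (gaussian (suc l) k) Fl dl Fk dk ⟩
    gaussian l (suc k) * (Fl * (Fk * dk)) * dl + p ^ suc l * (gaussian (suc l) k * (Fl * dl * Fk)) * dk
      ≡⟨ cong₂ (λ x y → x * dl + p ^ suc l * y * dk) (/-* {qfactorial p (l ℕ.+ suc k)} (*-nonzero (nonzero l) (nonzero (suc k)))) (/-* {qfactorial p (suc l ℕ.+ k)} (*-nonzero (nonzero (suc l)) (nonzero k))) ⟩
    qfactorial p (l ℕ.+ suc k) * dl + p ^ suc l * qfactorial p (suc l ℕ.+ k) * dk
      ≡⟨ cong (λ x → x * dl + p ^ suc l * qfactorial p (suc l ℕ.+ k) * dk) (cong (qfactorial p) (ℕₚ.+-suc l k)) ⟩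
    qfactorial p (suc (l ℕ.+ k)) * dl + p ^ suc l * qfactorial p (suc l ℕ.+ k) * dk
      ≡⟨ l₂ (qfactorial p (suc (l ℕ.+ k))) (p ^ suc l) (p ^ k * p) ⟩
    qfactorial p (suc (l ℕ.+ k)) * (1ℚ - p ^ suc l * p ^ suc k)
      ≡⟨ cong (λ x → qfactorial p (suc (l ℕ.+ k)) * (1ℚ - x)) (^-+ p (suc l) (suc k)) ⟨
    qfactorial p (suc (l ℕ.+ k)) * (1ℚ - p ^ (l ℕ.+ suc k) * p)
      ≡⟨ cong (λ x → qfactorial p x * (1ℚ - p ^ (l ℕ.+ suc k) * p)) (ℕₚ.+-suc l k) ⟨
    qfactorial p (suc l ℕ.+ suc k) ∎))
    where
    Fl = qfactorial p l
    Fk = qfactorial p k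
    dl = 1ℚ - p ^ l * p
    dk = 1ℚ - p ^ k * p
    l₁ : ∀ g e g′ Fl dl Fk dk → (g + e * g′) * (Fl * dl * (Fk * dk)) ≡ g * (Fl * (Fk * dk)) * dl + e * (g′ * (Fl * dl * Fk)) * dk
    l₁ = solve-∀ ℚ-ring
    l₂ : ∀ F x y → F * (1ℚ - x) + x * F * (1ℚ - y) ≡ F * (1ℚ - x * y)
    l₂ = solve-∀ ℚ-ring

-- Divisibility of the interpolation coefficients

prod-const : ∀ k x → prod k (λ _ → x) ≡ x ^ k
prod-const zero    x = refl
prod-const (suc k) x = cong (_* x) (prod-const k x)

prod-skip : ∀ i l g → prod (i ℕ.+ suc l) (λ j → skip i j (g j)) ≡ prod i g * prod l (λ t → g (i ℕ.+ suc t))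
prod-skip i l g = begin
  prod (i ℕ.+ suc l) G                                          ≡⟨ prod-+ i (suc l) G ⟩
  prod i G * prod (suc l) (λ t → G (i ℕ.+ t))                   ≡⟨ cong₂ _*_ (prod-cong i (λ j j<i → skip-≢ (g j) (λ i≡j → ℕₚ.<⇒≢ j<i (sym i≡j)))) (prod-front l (λ t → G (i ℕ.+ t))) ⟩
  prod i g * (G (i ℕ.+ 0) * prod l (λ t → G (i ℕ.+ suc t)))     ≡⟨ cong₂ (λ x y → prod i g * (x * y)) middle (prod-cong l (λ t _ → skip-≢ (g (i ℕ.+ suc t)) (λ eq → ℕₚ.m≢1+m+n i (trans eq (ℕₚ.+-suc i t))))) ⟩
  prod i g * (1ℚ * prod l (λ t → g (i ℕ.+ suc t)))              ≡⟨ cong (prod i g *_) (*-identityˡ (prod l (λ t → g (i ℕ.+ suc t)))) ⟩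
  prod i g * prod l (λ t → g (i ℕ.+ suc t))                     ∎
  where
  G : ℕ → ℚ
  G j = skip i j (g j)
  middle : G (i ℕ.+ 0) ≡ 1ℚ
  middle = trans (cong G (ℕₚ.+-identityʳ i)) (skip-≡ i (g i))

prod-unskip : ∀ i l g → g i * prod (i ℕ.+ suc l) (λ j → skip i j (g j)) ≡ prod (i ℕ.+ suc l) g
prod-unskip i l g = begin
  g i * prod (i ℕ.+ suc l) (λ j → skip i j (g j))               ≡⟨ cong (g i *_) (prod-skip i l g) ⟩
  g i * (prod i g * prod l (λ t → g (i ℕ.+ suc t)))             ≡⟨ l₁ (g i) (prod i g) (prod l (λ t → g (i ℕ.+ suc t))) ⟩
  prod i g * (g i * prod l (λ t → g (i ℕ.+ suc t)))             ≡⟨ cong (λ k → prod i g * (g k * prod l (λ t → g (i ℕ.+ suc t)))) (ℕₚ.+-identityʳ i) ⟨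
  prod i g * (g (i ℕ.+ 0) * prod l (λ t → g (i ℕ.+ suc t)))     ≡⟨ cong (prod i g *_) (prod-front l (λ t → g (i ℕ.+ t))) ⟨
  prod i g * prod (suc l) (λ t → g (i ℕ.+ t))                   ≡⟨ prod-+ i (suc l) g ⟨
  prod (i ℕ.+ suc l) g                                          ∎
  where
  l₁ : ∀ x y z → x * (y * z) ≡ y * (x * z)
  l₁ = solve-∀ ℚ-ring

skip-* : ∀ i j x y → skip i j (x * y) ≡ skip i j x * skip i j y
skip-* i j x y with i ℕ.≟ j
... | yes _ = refl
... | no  _ = refl

module Kappa (q : ℚ) (q≢0 : q ≢ 0ℚ) where

  s p : ℚ
  s = q * q
  p = q * q * q * q

  u pl : ℕ → ℚ
  u j = q * s ^ j
  pl j = q * q * q * q * (s ^ j * s ^ j)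

  p^ : ∀ j → p ^ j ≡ s ^ j * s ^ j
  p^ j = trans (cong (_^ j) (l q)) (^-distrib s s j)
    where
    l : ∀ q → q * q * q * q ≡ q * q * (q * q)
    l = solve-∀ ℚ-ring

  pl≡ : ∀ j → pl j ≡ p ^ suc j
  pl≡ j = trans (*-comm p (s ^ j * s ^ j)) (cong (_* p) (sym (p^ j)))

  p≢0 : p ≢ 0ℚ
  p≢0 = *-nonzero (*-nonzero (*-nonzero q≢0 q≢0) q≢0) q≢0

  u≢0 : ∀ j → u j ≢ 0ℚ
  u≢0 j = *-nonzero q≢0 (^-nonzero j (*-nonzero q≢0 q≢0))

  qfactorial-p : ∀ L → qfactorial p L ≡ qfactorial s L * prod L (λ j → 1ℚ + s ^ j * s)
  qfactorial-p L = trans (prod-cong L (λ j _ → trans (cong (λ x → 1ℚ - x * p) (p^ j)) (l (s ^ j) q)))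
    (prod-* L (λ j → 1ℚ - s ^ j * s) (λ j → 1ℚ + s ^ j * s))
    where
    l : ∀ x q → 1ℚ - x * x * (q * q * q * q) ≡ (1ℚ - x * (q * q)) * (1ℚ + x * (q * q))
    l = solve-∀ ℚ-ring

  module _ (nonzero : ∀ L → qfactorial p L ≢ 0ℚ) where

    nonzero-s : ∀ L → qfactorial s L ≢ 0ℚ
    nonzero-s L = nonzero-*ˡ {qfactorial s L} {prod L (λ j → 1ℚ + s ^ j * s)} (λ eq → nonzero L (trans (qfactorial-p L) eq))

    open QBinomial p nonzero using (twoSided)

    module _ (i l : ℕ) where

      N n : ℕ
      N = i ℕ.+ l
      n = i ℕ.+ suc l

      n≡ : n ≡ suc N
      n≡ = ℕₚ.+-suc i l

      -- Signed powers of q, split off the products over the poles and over the nodes.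
      U W : ℚ
      U = prod N (λ j → - p ^ suc j)
      W = prod i (λ j → - u j) * u i ^ l

      nodeProduct : ℚ
      nodeProduct = prod n (λ j → skip i j (E (u i) (u j)))

      -- The pole p^{j+1} contributes factors at the exponents j + 1 and -(j + 1) of p; the extra 1
      -- - u fills the gap at exponent 0, so that all exponents from -N to N occur.
      pole-product : (1ℚ - u i) * prod N (λ j → E (u i) (pl j)) ≡ U * twoSided (u i) N n
      pole-product = begin
        (1ℚ - u i) * prod N (λ j → E (u i) (pl j))
          ≡⟨ cong ((1ℚ - u i) *_) (trans (prod-cong N (λ j _ → factor j)) (trans (prod-* N (λ j → - p ^ suc j * A j) B) (cong (_* prod N B) (prod-* N (λ j → - p ^ suc j) A)))) ⟩
        (1ℚ - u i) * (U * prod N A * prod N B)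
          ≡⟨ l₁ (1ℚ - u i) U (prod N A) (prod N B) ⟩
        U * (prod N A * ((1ℚ - u i) * prod N B))
          ≡⟨ cong (λ x → U * (prod N A * x)) (rising-front p (u i) N) ⟨
        U * (prod N A * rising p (u i) (suc N))
          ≡⟨ cong (λ k → U * (prod N A * rising p (u i) k)) n≡ ⟨
        U * twoSided (u i) N n ∎
        where
        A B : ℕ → ℚ
        A j = 1ℚ - u i * inv p ^ suc j
        B j = 1ℚ - u i * p * p ^ j
        l₁ : ∀ x u a b → x * (u * a * b) ≡ u * (a * (x * b))
        l₁ = solve-∀ ℚ-ring
        factor : ∀ j → E (u i) (pl j) ≡ - p ^ suc j * A j * B j
        factor j = begin
          (1ℚ - u i * pl j) * (u i - pl j)
            ≡⟨ cong (λ x → (1ℚ - u i * x) * (u i - x)) (pl≡ j) ⟩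
          (1ℚ - u i * (p ^ j * p)) * (u i - p ^ suc j)
            ≡⟨ cong (λ x → (1ℚ - u i * (p ^ j * p)) * (x - p ^ suc j)) (trans (cong (u i *_) cancel) (*-identityʳ (u i))) ⟨
          (1ℚ - u i * (p ^ j * p)) * (u i * (p ^ suc j * inv p ^ suc j) - p ^ suc j)
            ≡⟨ l₂ (u i) (p ^ j) p (p ^ suc j) (inv p ^ suc j) ⟩
          - p ^ suc j * A j * B j ∎
          where
          cancel : p ^ suc j * inv p ^ suc j ≡ 1ℚ
          cancel = trans (sym (^-distrib p (inv p) (suc j))) (trans (cong (_^ suc j) (*-inv p≢0)) (1^ (suc j)))
          l₂ : ∀ u x p y z → (1ℚ - u * (x * p)) * (u * (y * z) - y) ≡ - y * (1ℚ - u * z) * (1ℚ - u * p * x)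
          l₂ = solve-∀ ℚ-ring

      -- The factor 1 - u_i² supplies the omitted j = i among the 1 - u_i u_j, which then extend (s;
      -- s)_i to (s; s)_{i+n}. The differences u_i - u_j yield (s; s)_i from j < i and (s; s)_l from
      -- j > i; the two (s; s)_i cancel.
      node-product : (1ℚ - u i * u i) * nodeProduct ≡ W * (qfactorial s l * qfactorial s (i ℕ.+ n))
      node-product = *-cancelˡ (nonzero-s i) (begin
        qfactorial s i * ((1ℚ - u i * u i) * nodeProduct)
          ≡⟨ cong (λ x → qfactorial s i * ((1ℚ - u i * u i) * x)) (trans (prod-cong n (λ j _ → skip-* i j (1ℚ - u i * u j) (u i - u j))) (prod-* n (λ j → skip i j (1ℚ - u i * u j)) (λ j → skip i j (u i - u j)))) ⟩
        qfactorial s i * ((1ℚ - u i * u i) * (prod n (λ j → skip i j (1ℚ - u i * u j)) * prod n (λ j → skip i j (u i - u j))))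
          ≡⟨ l₁ (qfactorial s i) (1ℚ - u i * u i) (prod n (λ j → skip i j (1ℚ - u i * u j))) (prod n (λ j → skip i j (u i - u j))) ⟩
        qfactorial s i * ((1ℚ - u i * u i) * prod n (λ j → skip i j (1ℚ - u i * u j))) * prod n (λ j → skip i j (u i - u j))
          ≡⟨ cong₂ (λ x y → qfactorial s i * x * y) (prod-unskip i l (λ j → 1ℚ - u i * u j)) (prod-skip i l (λ j → u i - u j)) ⟩
        qfactorial s i * prod n (λ j → 1ℚ - u i * u j) * (prod i (λ j → u i - u j) * prod l (λ t → u i - u (i ℕ.+ suc t)))
          ≡⟨ cong₂ _*_ (trans (cong (qfactorial s i *_) (prod-cong n (λ j _ → product j))) (sym (prod-+ i n (λ j → 1ℚ - s ^ j * s)))) (cong₂ _*_ below above) ⟩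
        qfactorial s (i ℕ.+ n) * (prod i (λ j → - u j) * qfactorial s i * (u i ^ l * qfactorial s l))
          ≡⟨ l₂ (qfactorial s (i ℕ.+ n)) (prod i (λ j → - u j)) (qfactorial s i) (u i ^ l) (qfactorial s l) ⟩
        qfactorial s i * (W * (qfactorial s l * qfactorial s (i ℕ.+ n))) ∎)
        where
        l₁ : ∀ f x a b → f * (x * (a * b)) ≡ f * (x * a) * b
        l₁ = solve-∀ ℚ-ring
        l₂ : ∀ F w f v g → F * (w * f * (v * g)) ≡ f * (w * v * (g * F))
        l₂ = solve-∀ ℚ-ring
        product : ∀ j → 1ℚ - u i * u j ≡ 1ℚ - s ^ (i ℕ.+ j) * s
        product j = cong (λ x → 1ℚ - x) (trans (l₃ q (s ^ i) (s ^ j)) (cong (_* s) (sym (^-+ s i j))))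
          where
          l₃ : ∀ q x y → q * x * (q * y) ≡ x * y * (q * q)
          l₃ = solve-∀ ℚ-ring
        below : prod i (λ j → u i - u j) ≡ prod i (λ j → - u j) * qfactorial s i
        below = begin
          prod i (λ j → u i - u j)                                  ≡⟨ prod-cong i lower ⟩
          prod i (λ j → - u j * (1ℚ - s ^ (i ℕ.∸ j)))               ≡⟨ prod-* i (λ j → - u j) (λ j → 1ℚ - s ^ (i ℕ.∸ j)) ⟩
          prod i (λ j → - u j) * prod i (λ j → 1ℚ - s ^ (i ℕ.∸ j))  ≡⟨ cong (prod i (λ j → - u j) *_) (prod-reverse i (λ k → 1ℚ - s ^ k)) ⟩
          prod i (λ j → - u j) * qfactorial s i                     ∎
          where
          lower : ∀ j → j ℕ.< i → u i - u j ≡ - u j * (1ℚ - s ^ (i ℕ.∸ j))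
          lower j j<i = trans (cong (λ k → q * k - u j) (trans (cong (s ^_) (sym (ℕₚ.m+[n∸m]≡n (ℕₚ.<⇒≤ j<i)))) (^-+ s j (i ℕ.∸ j))))
            (l₄ q (s ^ j) (s ^ (i ℕ.∸ j)))
            where
            l₄ : ∀ q x y → q * (x * y) - q * x ≡ - (q * x) * (1ℚ - y)
            l₄ = solve-∀ ℚ-ring
        above : prod l (λ t → u i - u (i ℕ.+ suc t)) ≡ u i ^ l * qfactorial s l
        above = begin
          prod l (λ t → u i - u (i ℕ.+ suc t))        ≡⟨ prod-cong l (λ t _ → upper t) ⟩
          prod l (λ t → u i * (1ℚ - s ^ t * s))       ≡⟨ prod-* l (λ _ → u i) (λ t → 1ℚ - s ^ t * s) ⟩
          prod l (λ _ → u i) * qfactorial s l         ≡⟨ cong (_* qfactorial s l) (prod-const l (u i)) ⟩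
          u i ^ l * qfactorial s l                    ∎
          where
          upper : ∀ t → u i - u (i ℕ.+ suc t) ≡ u i * (1ℚ - s ^ t * s)
          upper t = trans (cong (λ x → u i - q * x) (^-+ s i (suc t))) (l₅ q (s ^ i) (s ^ t * s))
            where
            l₅ : ∀ q x y → q * x - q * (x * y) ≡ q * x * (1ℚ - y)
            l₅ = solve-∀ ℚ-ring

      b₁ b₂ bracket : ℚ
      b₁ = twoSided (u i) N n / qfactorial p (N ℕ.+ n)
      b₂ = twoSided (u i) N (suc n) / qfactorial p (N ℕ.+ suc n)
      bracket = (1ℚ + p ^ n) * b₂ - u i * b₁

      -- 1 − u = (1 − u p^n) − u (1 − p^n): the first term lengthens the rising factorial
      -- by one factor, so both terms contain 1 − p^n.
      extract : (1ℚ - u i) * twoSided (u i) N n ≡ qfactorial p (N ℕ.+ n) * (1ℚ - p ^ n) * bracket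
      extract = begin
        (1ℚ - u i) * T
          ≡⟨ l₁ (u i) D (rising p (u i) n) (p ^ n) ⟩
        T⁺ - u i * (1ℚ - p ^ n) * T
          ≡⟨ cong₂ (λ x y → x - u i * (1ℚ - p ^ n) * y) (sym (/-* {T⁺} (nonzero (N ℕ.+ suc n)))) (sym (/-* {T} (nonzero (N ℕ.+ n)))) ⟩
        b₂ * qfactorial p (N ℕ.+ suc n) - u i * (1ℚ - p ^ n) * (b₁ * F)
          ≡⟨ cong (λ x → b₂ * x - u i * (1ℚ - p ^ n) * (b₁ * F)) last ⟩
        b₂ * (F * (1ℚ - p ^ n * p ^ n)) - u i * (1ℚ - p ^ n) * (b₁ * F)
          ≡⟨ l₂ b₂ F (p ^ n) (u i) b₁ ⟩
        F * (1ℚ - p ^ n) * bracket ∎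
        where
        F = qfactorial p (N ℕ.+ n)
        D = prod N (λ j → 1ℚ - u i * inv p ^ suc j)
        T T⁺ : ℚ
        T = twoSided (u i) N n
        T⁺ = twoSided (u i) N (suc n)
        last : qfactorial p (N ℕ.+ suc n) ≡ F * (1ℚ - p ^ n * p ^ n)
        last = trans (cong (qfactorial p) (ℕₚ.+-suc N n))
          (cong (λ x → F * (1ℚ - x)) (trans (cong (λ k → p ^ k) (cong (ℕ._+ n) (sym n≡))) (^-+ p n n)))
        l₁ : ∀ u d r x → (1ℚ - u) * (d * r) ≡ d * (r * (1ℚ - u * x)) - u * (1ℚ - x) * (d * r)
        l₁ = solve-∀ ℚ-ring
        l₂ : ∀ c F x u b → c * (F * (1ℚ - x * x)) - u * (1ℚ - x) * (b * F) ≡ F * (1ℚ - x) * ((1ℚ + x) * c - u * b)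
        l₂ = solve-∀ ℚ-ring

      open QBinomial s nonzero-s using (gaussian)

      cofactor : ℚ
      cofactor = U * (1ℚ + u i) * gaussian l (i ℕ.+ n) * prod (N ℕ.+ n) (λ j → 1ℚ + s ^ j * s)
        * ((1ℚ + q ^ n) * (1ℚ + q ^ n * q ^ n)) * bracket

      -- Since p = s², (p; p)_{2n-1} is (s; s)_{2n-1} times factors 1 + s^j, and (s; s)_{2n-1} is a
      -- Gaussian coefficient times the factorials of the node product. The factor 1 - qⁿ comes from
      -- 1 - pⁿ = (1 - qⁿ)(1 + qⁿ)(1 + q^{2n}).
      kappa : nodeProduct ≢ 0ℚ →
        prod N (λ j → E (u i) (pl j)) * (1ℚ - u i) * inv nodeProduct * W ≡ (1ℚ - q ^ n) * cofactor
      kappa np≢0 = *-cancelˡ (*-nonzero (nonzero-s l) (nonzero-s (i ℕ.+ n))) (begin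
        G * (P * (1ℚ - u i) * inv nodeProduct * W)
          ≡⟨ l₁ G P (1ℚ - u i) (inv nodeProduct) W ⟩
        (1ℚ - u i) * P * inv nodeProduct * (W * G)
          ≡⟨ cong₂ (λ x y → x * inv nodeProduct * y) pole-product (sym node-product) ⟩
        U * T * inv nodeProduct * ((1ℚ - u i * u i) * nodeProduct)
          ≡⟨ l₂ U T (inv nodeProduct) (u i) nodeProduct ⟩
        U * (1ℚ + u i) * ((1ℚ - u i) * T) * (nodeProduct * inv nodeProduct)
          ≡⟨ cong₂ (λ x y → U * (1ℚ + u i) * x * y) extract (*-inv np≢0) ⟩
        U * (1ℚ + u i) * (qfactorial p (N ℕ.+ n) * (1ℚ - p ^ n) * bracket) * 1ℚ
          ≡⟨ cong₂ (λ x y → U * (1ℚ + u i) * (x * (1ℚ - y) * bracket) * 1ℚ) (trans (qfactorial-p (N ℕ.+ n)) (cong (_* Π) total)) p^n ⟩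
        U * (1ℚ + u i) * (gaussian l (i ℕ.+ n) * G * Π * (1ℚ - q ^ n * q ^ n * q ^ n * q ^ n) * bracket) * 1ℚ
          ≡⟨ l₃ U (1ℚ + u i) (gaussian l (i ℕ.+ n)) G Π (q ^ n) bracket ⟩
        G * ((1ℚ - q ^ n) * cofactor) ∎)
        where
        G = qfactorial s l * qfactorial s (i ℕ.+ n)
        P = prod N (λ j → E (u i) (pl j))
        T = twoSided (u i) N n
        Π = prod (N ℕ.+ n) (λ j → 1ℚ + s ^ j * s)
        total : qfactorial s (N ℕ.+ n) ≡ gaussian l (i ℕ.+ n) * G
        total = trans (cong (qfactorial s) (trans (cong (ℕ._+ n) (ℕₚ.+-comm i l)) (ℕₚ.+-assoc l i n)))
          (sym (/-* {qfactorial s (l ℕ.+ (i ℕ.+ n))} (*-nonzero (nonzero-s l) (nonzero-s (i ℕ.+ n)))))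
        p^n : p ^ n ≡ q ^ n * q ^ n * q ^ n * q ^ n
        p^n = trans (^-distrib (q * q * q) q n) (cong (_* q ^ n) (trans (^-distrib (q * q) q n) (cong (_* q ^ n) (^-distrib q q n))))
        l₁ : ∀ G P x i W → G * (P * x * i * W) ≡ x * P * i * (W * G)
        l₁ = solve-∀ ℚ-ring
        l₂ : ∀ U T i u n → U * T * i * ((1ℚ - u * u) * n) ≡ U * (1ℚ + u) * ((1ℚ - u) * T) * (n * i)
        l₂ = solve-∀ ℚ-ring
        l₃ : ∀ U x g G Π z b → U * x * (g * G * Π * (1ℚ - z * z * z * z) * b) * 1ℚ ≡
          G * ((1ℚ - z) * (U * x * g * Π * ((1ℚ + z) * (1ℚ + z * z)) * b))
        l₃ = solve-∀ ℚ-ring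

-- Units, integral q-binomials and divisibility by 1 - qⁿ.

module _ (m : ℕ) where
  open Modulus m

  Qs Qp⁴ : Env → ℚ
  Qs ρ = ρ vq * ρ vq
  Qp⁴ ρ = ρ vq * ρ vq * ρ vq * ρ vq

  Reg-s : Reg Qs
  Reg-s = Reg-* Reg-q Reg-q

  Reg-p : Reg Qp⁴
  Reg-p = Reg-* (Reg-* (Reg-* Reg-q Reg-q) Reg-q) Reg-q

  q-nonzero : ∀ {ρ} → Admissible ρ → ρ vq ≢ 0ℚ
  q-nonzero {ρ} ad = Good.nonzero (Good-q m) ρ ad

  power-≢1 : ∀ {ρ} → Admissible ρ → ∀ k → 1ℚ - ρ vq ^ suc k ≢ 0ℚ
  power-≢1 ad k = subst (λ x → 1ℚ - x ^ suc k ≢ 0ℚ) (sym (Admissible.q≡ ad)) (1-base^≢0 (Admissible.index ad) (suc k) (λ ()))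

  qfactorial-nonzero : ∀ {ρ} → Admissible ρ → ∀ L → qfactorial (Qp⁴ ρ) L ≢ 0ℚ
  qfactorial-nonzero {ρ} ad L = prod-nonzero L λ j _ → subst (λ x → 1ℚ - x ≢ 0ℚ) (exponent j) (power-≢1 ad (3 ℕ.+ j ℕ.* 4))
    where
    q = ρ vq
    l : ∀ q → 1ℚ * q * q * q * q ≡ q * q * q * q
    l = solve-∀ ℚ-ring
    exponent : ∀ j → q ^ suc (3 ℕ.+ j ℕ.* 4) ≡ Qp⁴ ρ ^ j * Qp⁴ ρ
    exponent j = trans (sym (^-* q 4 (suc j))) (cong (_^ suc j) (l q))

  -- As n is odd, (-1)ⁿ ≠ 1, so 1 + q^k is comaximal with 1 - qⁿ.
  Good-1+q^ : ∀ k → Good (con 1ℚ ⊕ powP qP k)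
  Good-1+q^ k = good nz (Comaximal-binomial 1ℚ (- 1ℚ) k 1≢ λ q → trans (cong (1ℚ +_) (eval-powP (special q) qP k)) (l (q ^ k)))
    where
    nz : ∀ ρ → Admissible ρ → 1ℚ + evalP ρ (powP qP k) ≢ 0ℚ
    nz ρ ad = subst (λ x → 1ℚ + x ≢ 0ℚ) (trans (cong (_^ k) (sym (Admissible.q≡ ad))) (sym (eval-powP ρ qP k))) (1+^-nonzero (Admissible.index ad) k)
    l : ∀ x → 1ℚ + x ≡ 1ℚ - - 1ℚ * x
    l = solve-∀ ℚ-ring
    -1^ : ∀ k → (- 1ℚ) ^ (2 ℕ.* k) ≡ 1ℚ
    -1^ k = trans (cong ((- 1ℚ) ^_) (ℕₚ.*-comm 2 k)) (trans (sym (^-* (- 1ℚ) 2 k)) (1^ k))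
    1≢ : 1ℚ ^ n ≢ (- 1ℚ) ^ n
    1≢ eq with trans (sym (1^ n)) (trans eq (cong (_* - 1ℚ) (-1^ h)))
    ... | ()

  record Unit (f : Env → ℚ) : Set where
    constructor unit
    field
      nonzero : ∀ ρ → Admissible ρ → f ρ ≢ 0ℚ
      reg-inv : Reg (λ ρ → inv (f ρ))

  Unit-q : Unit (λ ρ → ρ vq)
  Unit-q = unit (λ ρ ad → q-nonzero ad) (Reg-inv (Good-q m))

  Unit-* : ∀ {f g} → Unit f → Unit g → Unit (λ ρ → f ρ * g ρ)
  Unit-* {f} {g} (unit nf rf) (unit ng rg) = unit (λ ρ ad → *-nonzero (nf ρ ad) (ng ρ ad))
    (Reg-cong (λ ρ ad → sym (inv-* (nf ρ ad) (ng ρ ad))) (Reg-* rf rg))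

  Unit-const : ∀ c → c ≢ 0ℚ → Unit (λ _ → c)
  Unit-const c c≢0 = unit (λ _ _ → c≢0) (Reg-const (inv c))

  Unit-neg : ∀ {f} → Unit f → Unit (λ ρ → - f ρ)
  Unit-neg {f} (unit nf rf) = unit (λ ρ ad → neg-nonzero (nf ρ ad))
    (Reg-cong (λ ρ ad → *-cancelˡ (neg-nonzero (nf ρ ad)) (trans (l (f ρ) (inv (f ρ))) (trans (*-inv (nf ρ ad)) (sym (*-inv (neg-nonzero (nf ρ ad))))))) (Reg-neg rf))
    where
    l : ∀ x y → - x * - y ≡ x * y
    l = solve-∀ ℚ-ring

  Unit-^ : ∀ {f} k → Unit f → Unit (λ ρ → f ρ ^ k)
  Unit-^ zero    u = Unit-const 1ℚ 1≢0
  Unit-^ (suc k) u = Unit-* (Unit-^ k u) u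

  Unit-prod : ∀ k {f : ℕ → Env → ℚ} → (∀ j → Unit (f j)) → Unit (λ ρ → prod k (λ j → f j ρ))
  Unit-prod zero    u = Unit-const 1ℚ 1≢0
  Unit-prod (suc k) u = Unit-* (Unit-prod k u) (u k)

  Unit-s : Unit Qs
  Unit-s = Unit-* Unit-q Unit-q

  Unit-p : Unit Qp⁴
  Unit-p = Unit-* (Unit-* (Unit-* Unit-q Unit-q) Unit-q) Unit-q

  -- Not automatic: (p; p)_L shares factors with 1 - qⁿ and is not an allowed denominator, so
  -- regularity of the quotient means that these factors cancel.
  Integral : (Env → ℚ) → Set
  Integral z = ∀ L → Reg (λ ρ → qbinomial (Qp⁴ ρ) (z ρ) L)

  Integral-cong : ∀ {z w} → (∀ ρ → z ρ ≡ w ρ) → Integral z → Integral w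
  Integral-cong eq r L = Reg-cong (λ ρ _ → cong (λ x → qbinomial (Qp⁴ ρ) x L) (eq ρ)) (r L)

  Reg-- : ∀ {f g} → Reg f → Reg g → Reg (λ ρ → f ρ - g ρ)
  Reg-- rf rg = Reg-+ rf (Reg-neg rg)

  Integral-zero : ∀ (z : Env → ℚ) → Reg (λ ρ → qbinomial (Qp⁴ ρ) (z ρ) 0)
  Integral-zero z = Reg-cong (λ ρ ad → sym (QBinomial.binom-zero (Qp⁴ ρ) (qfactorial-nonzero ad) (z ρ))) (Reg-const 1ℚ)

  Integral-up : ∀ {z} → Reg z → Integral z → Integral (λ ρ → z ρ * Qp⁴ ρ)
  Integral-up {z} rz r zero    = Integral-zero (λ ρ → z ρ * Qp⁴ ρ)
  Integral-up {z} rz r (suc L) = Reg-cong (λ ρ ad → sym (QBinomial.pascal (Qp⁴ ρ) (qfactorial-nonzero ad) (z ρ) L))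
    (Reg-+ (r (suc L)) (Reg-* rz (Integral-up rz r L)))

  Integral-* : ∀ {z w} → Reg w → Integral z → Integral w → Integral (λ ρ → z ρ * w ρ)
  Integral-* {z} {w} rw r r′ L = Reg-cong (λ ρ ad → QBinomial.vandermonde (Qp⁴ ρ) (qfactorial-nonzero ad) (z ρ) (w ρ) L)
    (Reg-sum (suc L) (λ i _ → Reg-* (Reg-* (r i) (Reg-^ i rw)) (r′ (L ℕ.∸ i))))

  -- `square-root` expresses the quotient at w through the one at w² and shorter ones at w, at the
  -- price of dividing by 1 + w^{L+1}.
  Integral-√ : ∀ {w} → Reg w → (∀ L → Unit (λ ρ → 1ℚ + w ρ ^ suc L)) → Integral (λ ρ → w ρ * w ρ) → Integral w
  Integral-√ {w} rw 1+w r L = upTo L L ℕₚ.≤-refl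
    where
    -- The bound N makes the course-of-values recursion structural.
    upTo : ∀ N L → L ℕ.≤ N → Reg (λ ρ → qbinomial (Qp⁴ ρ) (w ρ) L)
    upTo N       zero    _         = Integral-zero w
    upTo (suc N) (suc L) (s≤s L≤N) = Reg-cong
      (λ ρ ad → trans (*-comm (inv (1ℚ + w ρ ^ suc L)) _) (/-intro (Unit.nonzero (1+w L) ρ ad)
          (trans (sym (QBinomial.square-root (Qp⁴ ρ) (qfactorial-nonzero ad) (w ρ) L)) (*-comm (1ℚ + w ρ ^ suc L) (qbinomial (Qp⁴ ρ) (w ρ) (suc L))))))
      (Reg-* (Unit.reg-inv (1+w L)) (Reg-- (r (suc L)) (Reg-sum L (λ i i<L →
        Reg-* (Reg-* (upTo N (suc i) (ℕₚ.≤-trans i<L L≤N)) (Reg-^ (suc i) rw)) (upTo N (L ℕ.∸ i) (ℕₚ.≤-trans (ℕₚ.m∸n≤m L i) L≤N))))))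

  Integral-p : Integral Qp⁴
  Integral-p L = Reg-cong (λ ρ ad → sym (QBinomial.binom-p (Qp⁴ ρ) (qfactorial-nonzero ad) L)) (Reg-const 1ℚ)

  Unit-1+q^ : ∀ k → Unit (λ ρ → 1ℚ + ρ vq ^ k)
  Unit-1+q^ k = unit (λ ρ ad → subst (λ x → 1ℚ + x ≢ 0ℚ) (eval-powP ρ qP k) (Good.nonzero (Good-1+q^ k) ρ ad))
    (Reg-cong (λ ρ _ → cong (λ x → inv (1ℚ + x)) (eval-powP ρ qP k)) (Reg-inv (Good-1+q^ k)))

  Unit-cong : ∀ {f g} → (∀ ρ → f ρ ≡ g ρ) → Unit f → Unit g
  Unit-cong eq (unit nz r) = unit (λ ρ ad → subst (_≢ 0ℚ) (eq ρ) (nz ρ ad)) (Reg-cong (λ ρ _ → cong inv (eq ρ)) r)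

  s^ : ∀ q k → (q * q) ^ k ≡ q ^ (k ℕ.* 2)
  s^ q k = trans (cong (_^ k) (cong (_* q) (sym (*-identityˡ q)))) (^-* q 2 k)

  Integral-s : Integral Qs
  Integral-s = Integral-√ Reg-s (λ L → Unit-cong (λ ρ → cong (1ℚ +_) (sym (s^ (ρ vq) (suc L)))) (Unit-1+q^ (suc L ℕ.* 2)))
    (Integral-cong (λ ρ → l (ρ vq)) Integral-p)
    where
    l : ∀ q → q * q * q * q ≡ q * q * (q * q)
    l = solve-∀ ℚ-ring

  -- Two square roots lead from p = q⁴, where every quotient is 1, through q² to q.
  Integral-q : Integral (λ ρ → ρ vq)
  Integral-q = Integral-√ Reg-q (λ L → Unit-1+q^ (suc L)) Integral-s

  Reg-u : ∀ i → Reg (λ ρ → ρ vq * Qs ρ ^ i)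
  Reg-u i = Reg-* Reg-q (Reg-^ i Reg-s)

  -- Multiplication by p = q⁴ raises i by two, so q and q³ = q · q² serve as starting points; the
  -- second needs Vandermonde.
  Integral-u : ∀ i → Integral (λ ρ → ρ vq * Qs ρ ^ i)
  Integral-u zero = Integral-cong (λ ρ → sym (*-identityʳ (ρ vq))) (Integral-q)
  Integral-u (suc zero) = Integral-cong (λ ρ → cong (ρ vq *_) (sym (*-identityˡ (Qs ρ)))) (Integral-* {λ ρ → ρ vq} {Qs} Reg-s Integral-q Integral-s)
  Integral-u (suc (suc i)) = Integral-cong (λ ρ → l (ρ vq) (Qs ρ ^ i)) (Integral-up (Reg-u i) (Integral-u i))
    where
    l : ∀ q x → q * x * (q * q * q * q) ≡ q * (x * (q * q) * (q * q))
    l = solve-∀ ℚ-ring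

  -- Here r stays general, because the step for suc l uses l together with both r and suc r.
  Reg-twoSided : ∀ {z} → Reg z → Integral z → ∀ l r →
    Reg (λ ρ → (prod l (λ j → 1ℚ - z ρ * inv (Qp⁴ ρ) ^ suc j) * rising (Qp⁴ ρ) (z ρ) r) / qfactorial (Qp⁴ ρ) (l ℕ.+ r))
  Reg-twoSided {z} rz int zero r = Reg-cong (λ ρ _ → cong (_/ qfactorial (Qp⁴ ρ) r) (sym (*-identityˡ (rising (Qp⁴ ρ) (z ρ) r)))) (int r)
  Reg-twoSided {z} rz int (suc l) r = Reg-cong
    (λ ρ ad → sym (QBinomial.twoSided-step (Qp⁴ ρ) (qfactorial-nonzero ad) (Unit.nonzero Unit-p ρ ad) (z ρ) l r))
    (Reg-- (Reg-cong (λ ρ _ → cong (λ k → QBinomial-twoSided ρ l (suc r) / qfactorial (Qp⁴ ρ) k) (ℕₚ.+-suc l r)) (Reg-twoSided rz int l (suc r)))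
      (Reg-* (Reg-* rz (Reg-^ (suc l) (Unit.reg-inv Unit-p))) (Reg-twoSided rz int l r)))
    where
    QBinomial-twoSided : Env → ℕ → ℕ → ℚ
    QBinomial-twoSided ρ l r = prod l (λ j → 1ℚ - z ρ * inv (Qp⁴ ρ) ^ suc j) * rising (Qp⁴ ρ) (z ρ) r

  s-factorial-nonzero : ∀ {ρ} → Admissible ρ → ∀ L → qfactorial (Qs ρ) L ≢ 0ℚ
  s-factorial-nonzero {ρ} ad = Kappa.nonzero-s (ρ vq) (q-nonzero ad) (qfactorial-nonzero ad)

  Reg-gaussian : ∀ l k → Reg (λ ρ → qfactorial (Qs ρ) (l ℕ.+ k) / (qfactorial (Qs ρ) l * qfactorial (Qs ρ) k))
  Reg-gaussian zero    k       = Reg-cong (λ ρ ad → sym (QBinomial.gaussian-zeroˡ (Qs ρ) (s-factorial-nonzero ad) k)) (Reg-const 1ℚ)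
  Reg-gaussian (suc l) zero    = Reg-cong (λ ρ ad → sym (QBinomial.gaussian-zeroʳ (Qs ρ) (s-factorial-nonzero ad) (suc l))) (Reg-const 1ℚ)
  Reg-gaussian (suc l) (suc k) = Reg-cong (λ ρ ad → sym (QBinomial.gaussian-suc (Qs ρ) (s-factorial-nonzero ad) l k))
    (Reg-+ (Reg-gaussian l (suc k)) (Reg-* (Reg-^ (suc l) Reg-s) (Reg-gaussian (suc l) k)))

  -- `Kappa.kappa` with the monomial W divided out; W is a unit, so the cofactor remains regular.
  kappa-divisible : ∀ i l → i ℕ.+ suc l ≡ n → Σ (Env → ℚ) λ g → Reg g × (∀ ρ → Admissible ρ →
    (∀ j → j ℕ.< n → i ≢ j → E (ρ vq * Qs ρ ^ i) (ρ vq * Qs ρ ^ j) ≢ 0ℚ) →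
    prod (i ℕ.+ l) (λ j → E (ρ vq * Qs ρ ^ i) (ρ vq * ρ vq * ρ vq * ρ vq * (Qs ρ ^ j * Qs ρ ^ j))) * (1ℚ - ρ vq * Qs ρ ^ i)
      * inv (prod n (λ j → skip i j (E (ρ vq * Qs ρ ^ i) (ρ vq * Qs ρ ^ j)))) ≡
    (1ℚ - ρ vq ^ n) * g ρ)
  kappa-divisible i l eq = g , reg-g , value
    where
    k = i ℕ.+ suc l
    u : ℕ → Env → ℚ
    u j ρ = ρ vq * Qs ρ ^ j
    W : Env → ℚ
    W ρ = prod i (λ j → - u j ρ) * u i ρ ^ l
    Unit-u : ∀ j → Unit (u j)
    Unit-u j = Unit-* Unit-q (Unit-^ j Unit-s)
    Unit-W : Unit W
    Unit-W = Unit-* (Unit-prod i (λ j → Unit-neg (Unit-u j))) (Unit-^ l (Unit-u i))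
    T : Env → ℕ → ℚ
    T ρ r = (prod (i ℕ.+ l) (λ j → 1ℚ - u i ρ * inv (Qp⁴ ρ) ^ suc j) * rising (Qp⁴ ρ) (u i ρ) r) / qfactorial (Qp⁴ ρ) (i ℕ.+ l ℕ.+ r)
    X : Env → ℚ
    X ρ = prod (i ℕ.+ l) (λ j → - Qp⁴ ρ ^ suc j) * (1ℚ + u i ρ)
      * (qfactorial (Qs ρ) (l ℕ.+ (i ℕ.+ k)) / (qfactorial (Qs ρ) l * qfactorial (Qs ρ) (i ℕ.+ k)))
      * prod (i ℕ.+ l ℕ.+ k) (λ j → 1ℚ + Qs ρ ^ j * Qs ρ)
      * ((1ℚ + ρ vq ^ k) * (1ℚ + ρ vq ^ k * ρ vq ^ k)) * ((1ℚ + Qp⁴ ρ ^ k) * T ρ (suc k) - u i ρ * T ρ k)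
    1+ : ∀ {f} → Reg f → Reg (λ ρ → 1ℚ + f ρ)
    1+ = Reg-+ (Reg-const 1ℚ)
    reg-X : Reg X
    reg-X = Reg-* (Reg-* (Reg-* (Reg-* (Reg-* (Reg-prod (i ℕ.+ l) (λ j → Reg-neg (Reg-^ (suc j) Reg-p))) (1+ (Reg-u i)))
        (Reg-gaussian l (i ℕ.+ k))) (Reg-prod (i ℕ.+ l ℕ.+ k) (λ j → 1+ (Reg-* (Reg-^ j Reg-s) Reg-s))))
        (Reg-* (1+ (Reg-^ k Reg-q)) (1+ (Reg-* (Reg-^ k Reg-q) (Reg-^ k Reg-q)))))
      (Reg-- (Reg-* (1+ (Reg-^ k Reg-p)) (Reg-twoSided (Reg-u i) (Integral-u i) (i ℕ.+ l) (suc k)))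
        (Reg-* (Reg-u i) (Reg-twoSided (Reg-u i) (Integral-u i) (i ℕ.+ l) k)))
    g : Env → ℚ
    g ρ = X ρ * inv (W ρ)
    reg-g : Reg g
    reg-g = Reg-* reg-X (Unit.reg-inv Unit-W)
    value : ∀ ρ → Admissible ρ → (∀ j → j ℕ.< n → i ≢ j → E (u i ρ) (u j ρ) ≢ 0ℚ) →
      prod (i ℕ.+ l) (λ j → E (u i ρ) (ρ vq * ρ vq * ρ vq * ρ vq * (Qs ρ ^ j * Qs ρ ^ j))) * (1ℚ - u i ρ)
        * inv (prod n (λ j → skip i j (E (u i ρ) (u j ρ)))) ≡ (1ℚ - ρ vq ^ n) * g ρ
    value ρ ad distinct = trans (cong (λ r → lhs′ * inv (prod r (λ j → skip i j (E (u i ρ) (u j ρ))))) (sym eq))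
      (trans (*-cancelˡ W≢0 (begin
        W ρ * (lhs′ * inv np)                   ≡⟨ *-comm (W ρ) (lhs′ * inv np) ⟩
        lhs′ * inv np * W ρ                     ≡⟨ Kappa.kappa (ρ vq) (q-nonzero ad) (qfactorial-nonzero ad) i l np≢0 ⟩
        (1ℚ - ρ vq ^ k) * X ρ                   ≡⟨ trans (cong ((1ℚ - ρ vq ^ k) * X ρ *_) (*-inv W≢0)) (*-identityʳ ((1ℚ - ρ vq ^ k) * X ρ)) ⟨
        (1ℚ - ρ vq ^ k) * X ρ * (W ρ * inv (W ρ)) ≡⟨ l₁ (1ℚ - ρ vq ^ k) (X ρ) (W ρ) (inv (W ρ)) ⟩
        W ρ * ((1ℚ - ρ vq ^ k) * g ρ)           ∎))
        (cong (λ r → (1ℚ - ρ vq ^ r) * g ρ) eq))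
      where
      W≢0 = Unit.nonzero Unit-W ρ ad
      np = prod k (λ j → skip i j (E (u i ρ) (u j ρ)))
      lhs′ = prod (i ℕ.+ l) (λ j → E (u i ρ) (ρ vq * ρ vq * ρ vq * ρ vq * (Qs ρ ^ j * Qs ρ ^ j))) * (1ℚ - u i ρ)
      np≢0 : np ≢ 0ℚ
      np≢0 = prod-nonzero k λ j j<k → nz j (subst (j ℕ.<_) eq j<k)
        where
        nz : ∀ j → j ℕ.< n → skip i j (E (u i ρ) (u j ρ)) ≢ 0ℚ
        nz j j<n with i ℕ.≟ j
        ... | yes _  = 1≢0
        ... | no i≢j = distinct j j<n i≢j
      l₁ : ∀ a x w v → a * x * (w * v) ≡ w * (a * (x * v))
      l₁ = solve-∀ ℚ-ring

-- Evaluation at the nodes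

safeDiv-just : ∀ x {y} → y ≢ 0ℚ → safeDiv x y ≡ just (x / y)
safeDiv-just x {y} y≢0 with y ≟ 0ℚ
... | yes y≡0 = ⊥-elim (y≢0 y≡0)
... | no _    = refl

-- Wrapping the equation in a record lets Agda infer the expression and its value.
record _⊢_⇓_ (ρ : Env) (f : RF) (x : ℚ) : Set where
  constructor ev
  field
    eval : evalR ρ f ≡ just x

infix 4 _⊢_⇓_

module _ {ρ : Env} where

  ⇓-≡ : ∀ {f x y} → x ≡ y → ρ ⊢ f ⇓ x → ρ ⊢ f ⇓ y
  ⇓-≡ refl e = e

  ⇓-1 : ρ ⊢ oneR ⇓ 1ℚ
  ⇓-1 = ev refl

  ⇓-vr : ∀ v → ρ ⊢ vr v ⇓ ρ v
  ⇓-vr v = ev refl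

  ⇓-+ : ∀ {f g x y} → ρ ⊢ f ⇓ x → ρ ⊢ g ⇓ y → ρ ⊢ f +ʳ g ⇓ x + y
  ⇓-+ (ev ef) (ev eg) = ev (trans (cong (_>>= _) ef) (cong (_>>= _) eg))

  ⇓-* : ∀ {f g x y} → ρ ⊢ f ⇓ x → ρ ⊢ g ⇓ y → ρ ⊢ f *ʳ g ⇓ x * y
  ⇓-* (ev ef) (ev eg) = ev (trans (cong (_>>= _) ef) (cong (_>>= _) eg))

  ⇓-neg : ∀ {f x} → ρ ⊢ f ⇓ x → ρ ⊢ -ʳ f ⇓ - x
  ⇓-neg (ev ef) = ev (cong (_>>= _) ef)

  ⇓-- : ∀ {f g x y} → ρ ⊢ f ⇓ x → ρ ⊢ g ⇓ y → ρ ⊢ f -ʳ g ⇓ x - y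
  ⇓-- ef eg = ⇓-+ ef (⇓-neg eg)

  ⇓-/ : ∀ {f g x y} → y ≢ 0ℚ → ρ ⊢ f ⇓ x → ρ ⊢ g ⇓ y → ρ ⊢ f /ʳ g ⇓ x / y
  ⇓-/ {x = x} y≢0 (ev ef) (ev eg) = ev (trans (cong (_>>= _) ef) (trans (cong (_>>= _) eg) (safeDiv-just x y≢0)))

  ⇓-pow : ∀ {f x} k → ρ ⊢ f ⇓ x → ρ ⊢ powR f k ⇓ x ^ k
  ⇓-pow zero    ef = ⇓-1
  ⇓-pow (suc k) ef = ⇓-* (⇓-pow k ef) ef

  ⇓-prod : ∀ k {f : ℕ → RF} {x : ℕ → ℚ} → (∀ j → ρ ⊢ f j ⇓ x j) → ρ ⊢ prodR k f ⇓ prod k x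
  ⇓-prod zero    e = ⇓-1
  ⇓-prod (suc k) e = ⇓-* (⇓-prod k e) (e k)

  ⇓-sum : ∀ k {f : ℕ → RF} {x : ℕ → ℚ} → (∀ j → ρ ⊢ f j ⇓ x j) → ρ ⊢ sumR k f ⇓ sum k x
  ⇓-sum zero    e = ev refl
  ⇓-sum (suc k) e = ⇓-+ (⇓-sum k e) (e k)

  ⇓-poch : ∀ {f g x y} k → ρ ⊢ f ⇓ x → ρ ⊢ g ⇓ y → ρ ⊢ poch f g k ⇓ prod k (λ j → 1ℚ - x * y ^ j)
  ⇓-poch k ef eg = ⇓-prod k (λ j → ⇓-- ⇓-1 (⇓-* ef (⇓-pow j eg)))

-- Merges the Pochhammer factors at aw and w/a; the additional a clears the denominator of the
-- second.
E-split : ∀ {a} w Z → a ≢ 0ℚ → (1ℚ - a * w * Z) * (1ℚ - w / a * Z) * a ≡ E a (w * Z)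
E-split {a} w Z a≢0 = begin
  (1ℚ - a * w * Z) * (1ℚ - w * inv a * Z) * a            ≡⟨ l₁ a w Z (inv a) ⟩
  (1ℚ - a * (w * Z)) * (a - w * Z * (a * inv a))         ≡⟨ cong (λ x → (1ℚ - a * (w * Z)) * (a - x)) (trans (cong (w * Z *_) (*-inv a≢0)) (*-identityʳ (w * Z))) ⟩
  E a (w * Z)                                            ∎
  where
  l₁ : ∀ a w Z i → (1ℚ - a * w * Z) * (1ℚ - w * i * Z) * a ≡ (1ℚ - a * (w * Z)) * (a - w * Z * (a * i))
  l₁ = solve-∀ ℚ-ring

E-reciprocal : ∀ {a a′} u → a * a′ ≡ 1ℚ → E a′ u * (a * a) ≡ E a u
E-reciprocal {a} {a′} u eq = begin
  (1ℚ - a′ * u) * (a′ - u) * (a * a)           ≡⟨ l₁ a a′ u ⟩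
  (a - a * a′ * u) * (a * a′ - a * u)          ≡⟨ cong (λ x → (a - x * u) * (x - a * u)) eq ⟩
  (a - 1ℚ * u) * (1ℚ - a * u)                  ≡⟨ l₂ a u ⟩
  (1ℚ - a * u) * (a - u)                       ∎
  where
  l₁ : ∀ a b u → (1ℚ - b * u) * (b - u) * (a * a) ≡ (a - a * b * u) * (a * b - a * u)
  l₁ = solve-∀ ℚ-ring
  l₂ : ∀ a u → (a - 1ℚ * u) * (1ℚ - a * u) ≡ (1ℚ - a * u) * (a - u)
  l₂ = solve-∀ ℚ-ring

-- Replacing a by 1/a divides numerator and denominator of every ratio by a².
partialSum-ratios : ∀ q {a a′ y y′} c N → (∀ Z → ratioNum q a′ y′ Z * c ≡ ratioNum q a y Z) → (∀ Z → ratioDen q a′ y′ Z * c ≡ ratioDen q a y Z) →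
  (∀ k → ratioDen q a y ((q * q) ^ k) ≢ 0ℚ) → (∀ k → ratioDen q a′ y′ ((q * q) ^ k) ≢ 0ℚ) →
  partialSum q a y N ≡ partialSum q a′ y′ N
partialSum-ratios q {a} {a′} {y} {y′} c N num≡ den≡ d≢0 d′≢0 =
  sum-cong N λ k _ → cong ((1ℚ - q * ((q * q) ^ k * (q * q) ^ k * (q * q) ^ k)) *_) (prod-cong k λ j _ → ratio ((q * q) ^ j) (d≢0 j) (d′≢0 j))
  where
  l : ∀ n c d → n * c * d ≡ n * (d * c)
  l = solve-∀ ℚ-ring
  ratio : ∀ Z → ratioDen q a y Z ≢ 0ℚ → ratioDen q a′ y′ Z ≢ 0ℚ → ratioNum q a y Z / ratioDen q a y Z ≡ ratioNum q a′ y′ Z / ratioDen q a′ y′ Z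
  ratio Z d≢0 d′≢0 = /-cross {ratioNum q a y Z} {z = ratioNum q a′ y′ Z} d≢0 d′≢0
    (trans (cong (_* ratioDen q a′ y′ Z) (sym (num≡ Z))) (trans (l (ratioNum q a′ y′ Z) c (ratioDen q a′ y′ Z)) (cong (ratioNum q a′ y′ Z *_) (den≡ Z))))

partialSum-reciprocalˡ : ∀ q {a a′} y N → a * a′ ≡ 1ℚ →
  (∀ k → ratioDen q a y ((q * q) ^ k) ≢ 0ℚ) → (∀ k → ratioDen q a′ y ((q * q) ^ k) ≢ 0ℚ) →
  partialSum q a y N ≡ partialSum q a′ y N
partialSum-reciprocalˡ q {a} {a′} y N eq = partialSum-ratios q {a} {a′} {y} {y} (a * a) N
  (λ Z → move (q * q * (1ℚ - q * q * (Z * Z))) (q * Z) (E y (q * (Z * Z)))) (λ Z → move (1ℚ - q * q * q * q * (Z * Z)) (q * q * q * q * (Z * Z)) (E y (q * q * Z)))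
  where
  l : ∀ x e f s → x * e * f * s ≡ x * (e * s) * f
  l = solve-∀ ℚ-ring
  move : ∀ x u f → x * E a′ u * f * (a * a) ≡ x * E a u * f
  move x u f = trans (l x (E a′ u) f (a * a)) (cong (λ e → x * e * f) (E-reciprocal {a} {a′} u eq))

partialSum-reciprocalʳ : ∀ q a {y y′} N → y * y′ ≡ 1ℚ →
  (∀ k → ratioDen q a y ((q * q) ^ k) ≢ 0ℚ) → (∀ k → ratioDen q a y′ ((q * q) ^ k) ≢ 0ℚ) →
  partialSum q a y N ≡ partialSum q a y′ N
partialSum-reciprocalʳ q a {y} {y′} N eq = partialSum-ratios q {a} {a} {y} {y′} (y * y) N
  (λ Z → move (q * q * (1ℚ - q * q * (Z * Z)) * E a (q * Z)) (q * (Z * Z))) (λ Z → move ((1ℚ - q * q * q * q * (Z * Z)) * E a (q * q * q * q * (Z * Z))) (q * q * Z))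
  where
  move : ∀ x u → x * E y′ u * (y * y) ≡ x * E y u
  move x u = trans (*-assoc x (E y′ u) (y * y)) (cong (x *_) (E-reciprocal {y} {y′} u eq))

-- Up to the factors [2i+1] and [4i+1], the values of the sum at a = q^{2i+1} and at y = q^{4i+1}.
closedA : ℚ → ℚ → ℕ → ℚ
closedA q y zero          = 1ℚ
closedA q y (suc zero)    = - q * (E y 1ℚ / E y (q * q))
closedA q y (suc (suc i)) = closedA q y i * (E y (q * q * (q * q) ^ i) / E y (q * q * q * q * (q * q) ^ i))

closedY : ℚ → ℚ → ℕ → ℚ
closedY q a i = prod i (λ j → E a (q * q * ((q * q) ^ j * (q * q) ^ j)) / E a (q * q * q * q * ((q * q) ^ j * (q * q) ^ j)))

-- Brings the recursion with step two into the shape of the quotient of (b³, 1/b³; q⁴) by (q²/b³,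
-- b³q²; q⁴) on the right-hand side.
closedA-odd : ∀ q y k → closedA q y (suc (k ℕ.* 2)) ≡
  - q * prod (suc k) (λ j → E y ((q * q) ^ j * (q * q) ^ j) / E y (q * q * ((q * q) ^ j * (q * q) ^ j)))
closedA-odd q y zero = cong (- q *_) (trans (cong₂ (λ x z → E y x / E y z) (sym (*-identityˡ 1ℚ)) (sym (*-identityʳ (q * q)))) (sym (*-identityˡ (E y (1ℚ * 1ℚ) / E y (q * q * (1ℚ * 1ℚ))))))
closedA-odd q y (suc k) = begin
  closedA q y (suc (k ℕ.* 2)) * (E y (q * q * (Z₂ * (q * q))) / E y (q * q * q * q * (Z₂ * (q * q))))
    ≡⟨ cong₂ (λ x z → closedA q y (suc (k ℕ.* 2)) * (E y x / E y z))
         (trans (cong (λ x → q * q * (x * (q * q))) Z₂≡) (l₁ q Zk)) (trans (cong (λ x → q * q * q * q * (x * (q * q))) Z₂≡) (l₂ q Zk)) ⟩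
  closedA q y (suc (k ℕ.* 2)) * last
    ≡⟨ cong (_* last) (closedA-odd q y k) ⟩
  - q * prod (suc k) f * last
    ≡⟨ *-assoc (- q) (prod (suc k) f) last ⟩
  - q * prod (suc (suc k)) f ∎
  where
  f : ℕ → ℚ
  f j = E y ((q * q) ^ j * (q * q) ^ j) / E y (q * q * ((q * q) ^ j * (q * q) ^ j))
  Zk = (q * q) ^ k
  Z₂ = (q * q) ^ (k ℕ.* 2)
  last = f (suc k)
  Z₂≡ : Z₂ ≡ Zk * Zk
  Z₂≡ = trans (sym (^-* (q * q) 2 k)) (trans (cong (_^ k) (l₀ (q * q))) (^-distrib (q * q) (q * q) k))
    where
    l₀ : ∀ x → 1ℚ * x * x ≡ x * x
    l₀ = solve-∀ ℚ-ring
  l₁ : ∀ q z → q * q * (z * z * (q * q)) ≡ z * (q * q) * (z * (q * q))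
  l₁ = solve-∀ ℚ-ring
  l₂ : ∀ q z → q * q * q * q * (z * z * (q * q)) ≡ q * q * (z * (q * q) * (z * (q * q)))
  l₂ = solve-∀ ℚ-ring

module Values (m : ℕ) (ρ : Env) (ad : Admissible ρ) where
  open Modulus m

  q : ℚ
  q = ρ vq

  Z u pl : ℕ → ℚ
  Z k = (q * q) ^ k
  u j = q * Z j
  pl j = q * q * q * q * (Z j * Z j)

  q≢0 : q ≢ 0ℚ
  q≢0 = q-nonzero m ad

  E≢0 : ∀ {z w} → Odd q z → Even q w → E z w ≢ 0ℚ
  E≢0 {z} {w} oz ew = E-nonzero (Admissible.index ad) (subst (λ q → Odd q z) (Admissible.q≡ ad) oz) (subst (λ q → Even q w) (Admissible.q≡ ad) ew)

  odd≢0 : ∀ {z} → Odd q z → z ≢ 0ℚ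
  odd≢0 {z} oz = Odd-nonzero (Admissible.index ad) (subst (λ q → Odd q z) (Admissible.q≡ ad) oz)

  odd-cube : ∀ {z} → Odd q z → Odd q (z ^ 3)
  odd-cube {z} oz = subst (λ q → Odd q (z ^ 3)) (sym (Admissible.q≡ ad)) (Odd-cube (Admissible.index ad) (subst (λ q → Odd q z) (Admissible.q≡ ad) oz))

  even-qq : Even q (q * q)
  even-qq = Even-sq q

  even-Z : ∀ k → Even q (Z k)
  even-Z k = Even-^ k even-qq

  even-q⁴ : Even q (q * q * q * q)
  even-q⁴ = subst (Even q) (l q) (Even-* even-qq even-qq)
    where
    l : ∀ q → q * q * (q * q) ≡ q * q * q * q
    l = solve-∀ ℚ-ring

  even-ZZ : ∀ k → Even q (Z k * Z k)
  even-ZZ k = Even-* (even-Z k) (even-Z k)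

  even-pl : ∀ k → Even q (pl k)
  even-pl k = Even-* even-q⁴ (even-ZZ k)

  q*even : ∀ {w} → Even q w → Odd q (q * w)
  q*even (e , refl) = e , inj₁ (*-comm q (q ^ (2 ℕ.* e)))

  odd-u : ∀ j → Odd q (u j)
  odd-u j = q*even (even-Z j)

  q^≢1 : ∀ k → 1ℚ - q ^ suc k ≢ 0ℚ
  q^≢1 = power-≢1 m ad

  1-q≢0 : 1ℚ - q ≢ 0ℚ
  1-q≢0 = subst (λ x → 1ℚ - x ≢ 0ℚ) (*-identityˡ q) (q^≢1 0)

  even*≢1 : ∀ {w} → Even q w → 1ℚ - q * q * w ≢ 0ℚ
  even*≢1 (e , refl) = subst (λ x → 1ℚ - x ≢ 0ℚ) (l q (q ^ (2 ℕ.* e))) (q^≢1 (suc (2 ℕ.* e)))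
    where
    l : ∀ q x → x * q * q ≡ q * q * x
    l = solve-∀ ℚ-ring

  odd≢1 : ∀ {w} → Even q w → 1ℚ - q * w ≢ 0ℚ
  odd≢1 (e , refl) = subst (λ x → 1ℚ - x ≢ 0ℚ) (*-comm (q ^ (2 ℕ.* e)) q) (q^≢1 (2 ℕ.* e))

  1-pl≢0 : ∀ k → 1ℚ - pl k ≢ 0ℚ
  1-pl≢0 k = subst (λ x → 1ℚ - x ≢ 0ℚ) (l q (Z k * Z k)) (even*≢1 (Even-* even-qq (even-ZZ k)))
    where
    l : ∀ q x → q * q * (q * q * x) ≡ q * q * q * q * x
    l = solve-∀ ℚ-ring

  ratioDen≢0 : ∀ {a y} → Odd q a → Odd q y → ∀ k → ratioDen q a y (Z k) ≢ 0ℚ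
  ratioDen≢0 oa oy k = *-nonzero (*-nonzero (1-pl≢0 k) (E≢0 oa (even-pl k))) (E≢0 oy (Even-* even-qq (even-Z k)))

  term-zero : ∀ a y {k} j → j ℕ.< k → ratioNum q a y (Z j) ≡ 0ℚ → term q a y k ≡ 0ℚ
  term-zero a y j j<k eq = prod-zero _ j j<k (trans (cong (_/ ratioDen q a y (Z j)) eq) (*-zeroˡ (inv (ratioDen q a y (Z j)))))

  weight : ℕ → ℚ
  weight k = 1ℚ - q * (Z k * Z k * Z k)

  -- At y = q the first ratio vanishes and only the summand k = 0 survives; every further i is one
  -- shift y ↦ yq⁴.
  partialSum-y : ∀ {a} → Odd q a → ∀ N i → suc i ℕ.≤ N →
    partialSum q a (q * (Z i * Z i)) N ≡ (1ℚ - q * (Z i * Z i)) * closedY q a i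
  partialSum-y {a} oa (suc N) zero _ = begin
    partialSum q a y (suc N)
      ≡⟨ sum-front N (λ k → weight k * term q a y k) ⟩
    weight 0 * 1ℚ + sum N (λ k → weight (suc k) * term q a y (suc k))
      ≡⟨ cong (weight 0 * 1ℚ +_) (sum-zero N (λ k _ → trans (cong (weight (suc k) *_) (term-zero a y {suc k} 0 (s≤s z≤n) numerator)) (*-zeroʳ (weight (suc k))))) ⟩
    weight 0 * 1ℚ + 0ℚ
      ≡⟨ l q ⟩
    (1ℚ - q * (1ℚ * 1ℚ)) * 1ℚ ∎
    where
    y = q * (1ℚ * 1ℚ)
    numerator : ratioNum q a y (Z 0) ≡ 0ℚ
    numerator = l₀ (q * q * (1ℚ - q * q * (1ℚ * 1ℚ)) * E a (q * 1ℚ)) (q * (1ℚ * 1ℚ))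
      where
      l₀ : ∀ x y → x * ((1ℚ - y * y) * (y - y)) ≡ 0ℚ
      l₀ = solve-∀ ℚ-ring
    l : ∀ q → (1ℚ - q * (1ℚ * 1ℚ * 1ℚ)) * 1ℚ + 0ℚ ≡ (1ℚ - q * (1ℚ * 1ℚ)) * 1ℚ
    l = solve-∀ ℚ-ring
  partialSum-y {a} oa N (suc i) i+2≤N = *-cancelˡ (*-nonzero 1-y≢0 (E≢0 oa ev-e′)) (begin
    (1ℚ - y) * S.e′ * partialSum q a (q * (Z (suc i) * Z (suc i))) N
      ≡⟨ cong (λ x → (1ℚ - y) * S.e′ * partialSum q a x N) (sym y⁺≡) ⟩
    (1ℚ - y) * S.e′ * partialSum q a S.y⁺ N
      ≡⟨ S.shift q≢0 N (λ k _ → ratioDen≢0 oa oy k) (λ k _ → ratioDen≢0 oa oy⁺ k) (λ k _ → u≢0 k (q * q)) κ≢0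
           (subst (λ x → 1ℚ - y * x ≢ 0ℚ) (cong (q * q *_) (*-identityʳ (Z N))) (u≢0′ N)) B≡0 ⟩
    (1ℚ - y * S.q⁴) * E a (y * q) * partialSum q a y N
      ≡⟨ cong ((1ℚ - y * S.q⁴) * E a (y * q) *_) (partialSum-y oa N i (ℕₚ.<⇒≤ i+2≤N)) ⟩
    (1ℚ - y * S.q⁴) * E a (y * q) * ((1ℚ - y) * closedY q a i)
      ≡⟨ l₁ (1ℚ - y * S.q⁴) (E a (y * q)) (1ℚ - y) (closedY q a i) ⟩
    (1ℚ - y) * (1ℚ - y * S.q⁴) * closedY q a i * E a (y * q)
      ≡⟨ cong ((1ℚ - y) * (1ℚ - y * S.q⁴) * closedY q a i *_) (/-* {E a (y * q)} (E≢0 oa ev-e′)) ⟨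
    (1ℚ - y) * (1ℚ - y * S.q⁴) * closedY q a i * (E a (y * q) / S.e′ * S.e′)
      ≡⟨ l₂ (1ℚ - y) (1ℚ - y * S.q⁴) (closedY q a i) (E a (y * q) / S.e′) S.e′ ⟩
    (1ℚ - y) * S.e′ * ((1ℚ - y * S.q⁴) * (closedY q a i * (E a (y * q) / S.e′)))
      ≡⟨ cong₂ (λ x z → (1ℚ - y) * S.e′ * ((1ℚ - x) * (closedY q a i * z))) y⁺≡ (cong₂ (λ x z → E a x / E a z) (l₃ q (Z i)) (l₄ q (Z i))) ⟩
    (1ℚ - y) * S.e′ * ((1ℚ - q * (Z (suc i) * Z (suc i))) * closedY q a (suc i)) ∎)
    where
    y = q * (Z i * Z i)
    module S = ShiftY q a y
    oy : Odd q y
    oy = q*even (even-ZZ i)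
    y⁺≡ : S.y⁺ ≡ q * (Z (suc i) * Z (suc i))
    y⁺≡ = l q (Z i)
      where
      l : ∀ q z → q * (z * z) * (q * q * q * q) ≡ q * (z * (q * q) * (z * (q * q)))
      l = solve-∀ ℚ-ring
    oy⁺ : Odd q S.y⁺
    oy⁺ = subst (Odd q) (sym y⁺≡) (q*even (even-ZZ (suc i)))
    1-y≢0 : 1ℚ - y ≢ 0ℚ
    1-y≢0 = odd≢1 (even-ZZ i)
    ev-e′ : Even q (y * (q * q * q))
    ev-e′ = subst (Even q) (l q (Z i * Z i)) (Even-* (Even-* even-qq even-qq) (even-ZZ i))
      where
      l : ∀ q x → q * q * (q * q) * x ≡ q * x * (q * q * q)
      l = solve-∀ ℚ-ring
    u≢0 : ∀ k c → 1ℚ - y * (q * q * (Z k * (q * q))) ≢ 0ℚ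
    u≢0 k c = subst (λ x → 1ℚ - x ≢ 0ℚ) (l q (Z i * Z i) (Z k)) (odd≢1 (Even-* (Even-* (even-ZZ i) (even-Z k)) (Even-* even-qq even-qq)))
      where
      l : ∀ q x z → q * (x * z * (q * q * (q * q))) ≡ q * x * (q * q * (z * (q * q)))
      l = solve-∀ ℚ-ring
    u≢0′ : ∀ k → 1ℚ - y * (q * q * (Z k * 1ℚ)) ≢ 0ℚ
    u≢0′ k = subst (λ x → 1ℚ - x ≢ 0ℚ) (l q (Z i * Z i) (Z k)) (odd≢1 (Even-* (Even-* (even-ZZ i) (even-Z k)) even-qq))
      where
      l : ∀ q x z → q * (x * z * (q * q)) ≡ q * x * (q * q * (z * 1ℚ))
      l = solve-∀ ℚ-ring
    κ≢0 : S.κ ≢ 0ℚ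
    κ≢0 = *-nonzero (subst (λ x → 1ℚ - x ≢ 0ℚ) (l q (Z i * Z i)) (even*≢1 (even-ZZ i)))
      (λ eq → subst (λ x → 1ℚ - x ≢ 0ℚ) (l′ q (Z i * Z i)) (even*≢1 (Even-* even-qq (even-ZZ i)))
        (trans (l″ (y * (q * q * q))) (cong -_ eq)))
      where
      l : ∀ q x → q * q * x ≡ q * x * q
      l = solve-∀ ℚ-ring
      l′ : ∀ q x → q * q * (q * q * x) ≡ q * x * (q * q * q)
      l′ = solve-∀ ℚ-ring
      l″ : ∀ x → 1ℚ - x ≡ - (x - 1ℚ)
      l″ = solve-∀ ℚ-ring
    -- The factor yq³ - Z² vanishes at index i + 1, where both terms are q^{4i+4}; this is where i +
    -- 2 ≤ N enters.
    B≡0 : S.B N ≡ 0ℚ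
    B≡0 = prod-zero N (suc i) i+2≤N (trans (cong (λ x → (1ℚ - q * q * (Z (suc i) * Z (suc i))) * E a (q * Z (suc i)) * ((1ℚ - y * (q * (Z (suc i) * Z (suc i)))) * x) / S.dB (Z (suc i))) (l q (Z i)))
      (l′ ((1ℚ - q * q * (Z (suc i) * Z (suc i))) * E a (q * Z (suc i))) (1ℚ - y * (q * (Z (suc i) * Z (suc i)))) (inv (S.dB (Z (suc i))))))
      where
      l : ∀ q z → q * (z * z) * (q * q * q) - z * (q * q) * (z * (q * q)) ≡ 0ℚ
      l = solve-∀ ℚ-ring
      l′ : ∀ x y z → x * (y * 0ℚ) * z ≡ 0ℚ
      l′ = solve-∀ ℚ-ring
    l₁ : ∀ x e y w → x * e * (y * w) ≡ y * x * w * e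
    l₁ = solve-∀ ℚ-ring
    l₂ : ∀ y x w r e → y * x * w * (r * e) ≡ y * e * (x * (w * r))
    l₂ = solve-∀ ℚ-ring
    l₃ : ∀ q z → q * (z * z) * q ≡ q * q * (z * z)
    l₃ = solve-∀ ℚ-ring
    l₄ : ∀ q z → q * (z * z) * (q * q * q) ≡ q * q * q * q * (z * z)
    l₄ = solve-∀ ℚ-ring

  -- The shift a ↦ aq⁴ raises i by two, so two initial values are computed directly: at a = q one
  -- summand survives, at a = q³ two.
  partialSum-a : ∀ {y} → Odd q y → ∀ N i → suc i ℕ.≤ N →
    partialSum q (u i) y N ≡ (1ℚ - u i) * closedA q y i
  partialSum-a {y} oy (suc N) zero _ = begin
    partialSum q (u 0) y (suc N)
      ≡⟨ sum-front N (λ k → weight k * term q (u 0) y k) ⟩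
    weight 0 * 1ℚ + sum N (λ k → weight (suc k) * term q (u 0) y (suc k))
      ≡⟨ cong (weight 0 * 1ℚ +_) (sum-zero N (λ k _ → trans (cong (weight (suc k) *_) (term-zero (u 0) y {suc k} 0 (s≤s z≤n) numerator)) (*-zeroʳ (weight (suc k))))) ⟩
    weight 0 * 1ℚ + 0ℚ
      ≡⟨ l q ⟩
    (1ℚ - q * 1ℚ) * 1ℚ ∎
    where
    numerator : ratioNum q (u 0) y (Z 0) ≡ 0ℚ
    numerator = l₀ (q * q * (1ℚ - q * q * (1ℚ * 1ℚ))) (q * 1ℚ) (E y (q * (1ℚ * 1ℚ)))
      where
      l₀ : ∀ x y z → x * ((1ℚ - y * y) * (y - y)) * z ≡ 0ℚ
      l₀ = solve-∀ ℚ-ring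
    l : ∀ q → (1ℚ - q * (1ℚ * 1ℚ * 1ℚ)) * 1ℚ + 0ℚ ≡ (1ℚ - q * 1ℚ) * 1ℚ
    l = solve-∀ ℚ-ring
  partialSum-a {y} oy (suc (suc N)) (suc zero) _ = begin
    partialSum q (u 1) y (suc (suc N))
      ≡⟨ trans (sum-front (suc N) T) (cong (T 0 +_) (sum-front N (λ k → T (suc k)))) ⟩
    T 0 + (T 1 + sum N (λ k → T (suc (suc k))))
      ≡⟨ cong (λ x → T 0 + (T 1 + x)) (sum-zero N (λ k _ → trans (cong (weight (suc (suc k)) *_) (term-zero (u 1) y {suc (suc k)} 1 (s≤s (s≤s z≤n)) numerator)) (*-zeroʳ (weight (suc (suc k)))))) ⟩
    weight 0 * 1ℚ + (weight 1 * (1ℚ * (num * (inv den))) + 0ℚ)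
      ≡⟨ *-cancelˡ den≢0 (begin
           den * (weight 0 * 1ℚ + (weight 1 * (1ℚ * (num * inv den)) + 0ℚ))
             ≡⟨ l₁ den (weight 0) (weight 1) num (inv den) ⟩
           weight 0 * den + weight 1 * num * (den * inv den)
             ≡⟨ cong (λ x → weight 0 * den + weight 1 * num * x) (*-inv den≢0) ⟩
           weight 0 * den + weight 1 * num * 1ℚ
             ≡⟨ l₂ q y ⟩
           (1ℚ - u 1) * - q * E y 1ℚ * D′ * 1ℚ
             ≡⟨ cong ((1ℚ - u 1) * - q * E y 1ℚ * D′ *_) (*-inv e₂≢0) ⟨
           (1ℚ - u 1) * - q * E y 1ℚ * D′ * (E y (q * q) * inv (E y (q * q)))
             ≡⟨ l₃ (1ℚ - u 1) (- q) (E y 1ℚ) D′ (E y (q * q)) (inv (E y (q * q))) ⟩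
           D′ * E y (q * q) * ((1ℚ - u 1) * (- q * (E y 1ℚ * inv (E y (q * q)))))
             ≡⟨ cong (λ x → D′ * E y x * ((1ℚ - u 1) * closedA q y 1)) (*-identityʳ (q * q)) ⟨
           den * ((1ℚ - u 1) * closedA q y 1) ∎) ⟩
    (1ℚ - u 1) * closedA q y 1 ∎
    where
    T : ℕ → ℚ
    T k = weight k * term q (u 1) y k
    num = ratioNum q (u 1) y (Z 0)
    den = ratioDen q (u 1) y (Z 0)
    D′ = (1ℚ - q * q * q * q * (1ℚ * 1ℚ)) * E (u 1) (q * q * q * q * (1ℚ * 1ℚ))
    den≢0 : den ≢ 0ℚ
    den≢0 = ratioDen≢0 (odd-u 1) oy 0
    e₂≢0 : E y (q * q) ≢ 0ℚ
    e₂≢0 = E≢0 oy even-qq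
    numerator : ratioNum q (u 1) y (Z 1) ≡ 0ℚ
    numerator = l₀ (q * q * (1ℚ - q * q * (Z 1 * Z 1))) (u 1) (E y (q * (Z 1 * Z 1)))
      where
      l₀ : ∀ x y z → x * ((1ℚ - y * y) * (y - y)) * z ≡ 0ℚ
      l₀ = solve-∀ ℚ-ring
    l₁ : ∀ d w₀ w₁ n i → d * (w₀ * 1ℚ + (w₁ * (1ℚ * (n * i)) + 0ℚ)) ≡ w₀ * d + w₁ * n * (d * i)
    l₁ = solve-∀ ℚ-ring
    l₂ : ∀ q y →
      (1ℚ - q * (1ℚ * 1ℚ * 1ℚ)) * ((1ℚ - q * q * q * q * (1ℚ * 1ℚ)) *
        ((1ℚ - q * (1ℚ * (q * q)) * (q * q * q * q * (1ℚ * 1ℚ))) * (q * (1ℚ * (q * q)) - q * q * q * q * (1ℚ * 1ℚ))) *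
        ((1ℚ - y * (q * q * 1ℚ)) * (y - q * q * 1ℚ)))
      + (1ℚ - q * (1ℚ * (q * q) * (1ℚ * (q * q)) * (1ℚ * (q * q)))) *
        (q * q * (1ℚ - q * q * (1ℚ * 1ℚ)) * ((1ℚ - q * (1ℚ * (q * q)) * (q * 1ℚ)) * (q * (1ℚ * (q * q)) - q * 1ℚ)) *
          ((1ℚ - y * (q * (1ℚ * 1ℚ))) * (y - q * (1ℚ * 1ℚ)))) * 1ℚ ≡
      (1ℚ - q * (1ℚ * (q * q))) * - q * ((1ℚ - y * 1ℚ) * (y - 1ℚ)) *
        ((1ℚ - q * q * q * q * (1ℚ * 1ℚ)) *
          ((1ℚ - q * (1ℚ * (q * q)) * (q * q * q * q * (1ℚ * 1ℚ))) * (q * (1ℚ * (q * q)) - q * q * q * q * (1ℚ * 1ℚ)))) * 1ℚ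
    l₂ = solve-∀ ℚ-ring
    l₃ : ∀ x y z d e i → x * y * z * d * (e * i) ≡ d * e * (x * (y * (z * i)))
    l₃ = solve-∀ ℚ-ring
  partialSum-a oy (suc zero) (suc zero) (s≤s ())
  partialSum-a {y} oy N (suc (suc i)) i+3≤N = *-cancelˡ (*-nonzero 1-A≢0 (E≢0 oy ev-e′)) (begin
    (1ℚ - A) * S.e′ * partialSum q (u (suc (suc i))) y N
      ≡⟨ cong (λ x → (1ℚ - A) * S.e′ * partialSum q x y N) (sym A⁺≡) ⟩
    (1ℚ - A) * S.e′ * partialSum q S.A⁺ y N
      ≡⟨ S.shift q≢0 N (λ k _ → ratioDen≢0 (odd-u i) oy k) (λ k _ → ratioDen≢0 oA⁺ oy k) κ≢0 B≡0 ⟩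
    (1ℚ - A * S.q⁴) * S.e * partialSum q A y N
      ≡⟨ cong ((1ℚ - A * S.q⁴) * S.e *_) (partialSum-a oy N i (ℕₚ.<⇒≤ (ℕₚ.<⇒≤ i+3≤N))) ⟩
    (1ℚ - A * S.q⁴) * S.e * ((1ℚ - A) * closedA q y i)
      ≡⟨ l₁ (1ℚ - A * S.q⁴) S.e (1ℚ - A) (closedA q y i) ⟩
    (1ℚ - A) * (1ℚ - A * S.q⁴) * closedA q y i * S.e
      ≡⟨ cong ((1ℚ - A) * (1ℚ - A * S.q⁴) * closedA q y i *_) (/-* {S.e} (E≢0 oy ev-e′)) ⟨
    (1ℚ - A) * (1ℚ - A * S.q⁴) * closedA q y i * (S.e / S.e′ * S.e′)
      ≡⟨ l₂ (1ℚ - A) (1ℚ - A * S.q⁴) (closedA q y i) (S.e / S.e′) S.e′ ⟩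
    (1ℚ - A) * S.e′ * ((1ℚ - A * S.q⁴) * (closedA q y i * (S.e / S.e′)))
      ≡⟨ cong₂ (λ x z → (1ℚ - A) * S.e′ * ((1ℚ - x) * (closedA q y i * z))) A⁺≡ (cong₂ (λ x z → E y x / E y z) (l₃ q (Z i)) (l₄ q (Z i))) ⟩
    (1ℚ - A) * S.e′ * ((1ℚ - u (suc (suc i))) * closedA q y (suc (suc i))) ∎)
    where
    A = u i
    module S = ShiftA q A y
    A⁺≡ : S.A⁺ ≡ u (suc (suc i))
    A⁺≡ = l q (Z i)
      where
      l : ∀ q z → q * z * (q * q * q * q) ≡ q * (z * (q * q) * (q * q))
      l = solve-∀ ℚ-ring
    oA⁺ : Odd q S.A⁺
    oA⁺ = subst (Odd q) (sym A⁺≡) (odd-u (suc (suc i)))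
    1-A≢0 : 1ℚ - A ≢ 0ℚ
    1-A≢0 = odd≢1 (even-Z i)
    ev-e′ : Even q (A * (q * q * q))
    ev-e′ = subst (Even q) (l q (Z i)) (Even-* (Even-* even-qq even-qq) (even-Z i))
      where
      l : ∀ q x → q * q * (q * q) * x ≡ q * x * (q * q * q)
      l = solve-∀ ℚ-ring
    κ≢0 : S.κ ≢ 0ℚ
    κ≢0 = *-nonzero
      (λ eq → subst (λ x → 1ℚ - x ≢ 0ℚ) (l′ q (Z i)) (even*≢1 (Even-* even-qq (even-Z i))) (trans (l″ (A * (q * q * q))) (cong -_ eq)))
      (λ eq → subst (λ x → 1ℚ - x ≢ 0ℚ) (l q (Z i)) (even*≢1 (even-Z i)) (trans (l″ (A * q)) (cong -_ eq)))
      where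
      l : ∀ q x → q * q * x ≡ q * x * q
      l = solve-∀ ℚ-ring
      l′ : ∀ q x → q * q * (q * q * x) ≡ q * x * (q * q * q)
      l′ = solve-∀ ℚ-ring
      l″ : ∀ x → 1ℚ - x ≡ - (x - 1ℚ)
      l″ = solve-∀ ℚ-ring
    -- The factor Aq³ - Z vanishes at index i + 2, where both terms are q^{2i+4}.
    B≡0 : S.B N ≡ 0ℚ
    B≡0 = prod-zero N (suc (suc i)) i+3≤N (trans (cong (λ x → (1ℚ - q * q * (Z₂ * Z₂)) * (1ℚ - A * q * Z₂) * x * E y (q * (Z₂ * Z₂)) / S.dB Z₂) (l q (Z i)))
      (l′ ((1ℚ - q * q * (Z₂ * Z₂)) * (1ℚ - A * q * Z₂)) (E y (q * (Z₂ * Z₂))) (inv (S.dB Z₂))))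
      where
      Z₂ = Z (suc (suc i))
      l : ∀ q z → q * z * (q * q * q) - z * (q * q) * (q * q) ≡ 0ℚ
      l = solve-∀ ℚ-ring
      l′ : ∀ x y z → x * 0ℚ * y * z ≡ 0ℚ
      l′ = solve-∀ ℚ-ring
    l₁ : ∀ x e y w → x * e * (y * w) ≡ y * x * w * e
    l₁ = solve-∀ ℚ-ring
    l₂ : ∀ y x w r e → y * x * w * (r * e) ≡ y * e * (x * (w * r))
    l₂ = solve-∀ ℚ-ring
    l₃ : ∀ q z → q * z * q ≡ q * q * z
    l₃ = solve-∀ ℚ-ring
    l₄ : ∀ q z → q * z * (q * q * q) ≡ q * q * q * q * z
    l₄ = solve-∀ ℚ-ring

-- Values of both sides

prod-telescope : ∀ k (t : ℕ → ℚ) → (∀ j → t j ≢ 0ℚ) → prod k (λ j → t (suc j) / t j) ≡ t k / t 0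
prod-telescope zero    t t≢0 = sym (*-inv (t≢0 0))
prod-telescope (suc k) t t≢0 = begin
  prod k (λ j → t (suc j) / t j) * (t (suc k) / t k)   ≡⟨ cong (_* (t (suc k) / t k)) (prod-telescope k t t≢0) ⟩
  t k * inv (t 0) * (t (suc k) * inv (t k))            ≡⟨ l (t k) (inv (t 0)) (t (suc k)) (inv (t k)) ⟩
  t (suc k) * inv (t 0) * (t k * inv (t k))            ≡⟨ cong (t (suc k) * inv (t 0) *_) (*-inv (t≢0 k)) ⟩
  t (suc k) * inv (t 0) * 1ℚ                           ≡⟨ *-identityʳ (t (suc k) * inv (t 0)) ⟩
  t (suc k) / t 0                                      ∎
  where
  l : ∀ a b c d → a * b * (c * d) ≡ c * b * (a * d)
  l = solve-∀ ℚ-ring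

prod-*³ : ∀ k f₁ f₂ f₃ → prod k f₁ * prod k f₂ * prod k f₃ ≡ prod k (λ j → f₁ j * f₂ j * f₃ j)
prod-*³ k f₁ f₂ f₃ = sym (trans (prod-* k (λ j → f₁ j * f₂ j) f₃) (cong (_* prod k f₃) (prod-* k f₁ f₂)))

prod-*⁵ : ∀ k f₁ f₂ f₃ f₄ f₅ → prod k f₁ * prod k f₂ * prod k f₃ * prod k f₄ * prod k f₅ ≡ prod k (λ j → f₁ j * f₂ j * f₃ j * f₄ j * f₅ j)
prod-*⁵ k f₁ f₂ f₃ f₄ f₅ = trans (cong (λ x → x * prod k f₄ * prod k f₅) (prod-*³ k f₁ f₂ f₃)) (prod-*³ k (λ j → f₁ j * f₂ j * f₃ j) f₄ f₅)

-- A Chinese remainder weight: 0 modulo (1 - cqⁿ)(c - qⁿ) and 1 modulo (1 - dqⁿ)(d - qⁿ).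
thetaR : ℕ → RF → RF → RF
thetaR n c d =
  ((oneR -ʳ c *ʳ powR qR n) *ʳ (c -ʳ powR qR n) *ʳ ((-ʳ oneR) -ʳ powR d 2 +ʳ d *ʳ powR qR n))
    /ʳ ((d -ʳ c) *ʳ (oneR -ʳ d *ʳ c))

-- The right-hand side with the two integer quotients by 4 as parameters, so that closed expressions
-- in m can replace them.
rhsAt : ℕ → ℕ → ℕ → RF
rhsAt n M K =
  thetaR n aR bR
  *ʳ ((poch (powR qR 5) q4 M *ʳ poch (aR *ʳ q2) q4 M *ʳ poch (q2 /ʳ aR) q4 M)
      /ʳ (poch qR q4 M *ʳ poch (q4 /ʳ aR) q4 M *ʳ poch (aR *ʳ q4) q4 M))
  +ʳ
  thetaR n bR aR
  *ʳ ((poch (powR qR 3) q4 K *ʳ poch b3 q4 K *ʳ poch (oneR /ʳ b3) q4 K)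
      /ʳ (poch (oneR /ʳ qR) q4 K *ʳ poch (q2 /ʳ b3) q4 K *ʳ poch (b3 *ʳ q2) q4 K))

module Evaluation (m : ℕ) (ρ : Env) (ad : Admissible ρ) where
  open Modulus m
  open Values m ρ ad

  a b y s₂ s₄ Q : ℚ
  a = ρ va
  b = ρ vb
  y = b ^ 3
  s₂ = q ^ 2
  s₄ = q ^ 4
  Q = q ^ n

  oa : Odd q a
  oa = Admissible.oddA ad
  ob : Odd q b
  ob = Admissible.oddB ad
  oy : Odd q y
  oy = odd-cube ob
  a≢0 : a ≢ 0ℚ
  a≢0 = odd≢0 oa
  b≢0 : b ≢ 0ℚ
  b≢0 = odd≢0 ob
  y≢0 : y ≢ 0ℚ
  y≢0 = odd≢0 oy

  s₂≡ : s₂ ≡ q * q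
  s₂≡ = cong (_* q) (*-identityˡ q)

  s₄≡ : s₄ ≡ q * q * q * q
  s₄≡ = cong (λ x → x * q * q * q) (*-identityˡ q)

  s₂^ : ∀ j → s₂ ^ j ≡ Z j
  s₂^ j = cong (_^ j) s₂≡

  s₄^ : ∀ j → s₄ ^ j ≡ Z j * Z j
  s₄^ j = trans (cong (_^ j) s₄≡) (Kappa.p^ q q≢0 j)

  ⇓-q : ρ ⊢ qR ⇓ q
  ⇓-q = ⇓-vr vq
  ⇓-a : ρ ⊢ aR ⇓ a
  ⇓-a = ⇓-vr va
  ⇓-b : ρ ⊢ bR ⇓ b
  ⇓-b = ⇓-vr vb
  ⇓-q2 : ρ ⊢ q2 ⇓ s₂
  ⇓-q2 = ⇓-pow 2 ⇓-q
  ⇓-q4 : ρ ⊢ q4 ⇓ s₄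
  ⇓-q4 = ⇓-pow 4 ⇓-q
  ⇓-b3 : ρ ⊢ b3 ⇓ y
  ⇓-b3 = ⇓-pow 3 ⇓-b

  module Summand (k : ℕ) where

    numFactor denFactor : ℚ → ℚ → ℚ → ℚ → ℚ
    numFactor t f P R = (1ℚ - a * q * P) * (1ℚ - q / a * P) * (1ℚ - t * R) * (1ℚ - y * q * R) * (1ℚ - q / y * R)
    denFactor t f P R = (1ℚ - f * R) * (1ℚ - f / a * R) * (1ℚ - a * f * R) * (1ℚ - t / y * P) * (1ℚ - y * t * P)

    Nf Df : ℕ → ℚ
    Nf j = numFactor s₂ s₄ (s₂ ^ j) (s₄ ^ j)
    Df j = denFactor s₂ s₄ (s₂ ^ j) (s₄ ^ j)

    Nf≡ : ∀ j → Nf j * (a * y) * (q * q) ≡ ratioNum q a y (Z j)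
    Nf≡ j = begin
      Nf j * (a * y) * (q * q)
        ≡⟨ cong₂ (λ P R → numFactor s₂ s₄ P R * (a * y) * (q * q)) (s₂^ j) (s₄^ j) ⟩
      numFactor s₂ s₄ P R * (a * y) * (q * q)
        ≡⟨ cong (λ t → numFactor t s₄ P R * (a * y) * (q * q)) s₂≡ ⟩
      numFactor (q * q) s₄ P R * (a * y) * (q * q)
        ≡⟨ l (1ℚ - a * q * P) (1ℚ - q / a * P) (1ℚ - q * q * R) (1ℚ - y * q * R) (1ℚ - q / y * R) a y (q * q) ⟩
      q * q * (1ℚ - q * q * R) * ((1ℚ - a * q * P) * (1ℚ - q / a * P) * a) * ((1ℚ - y * q * R) * (1ℚ - q / y * R) * y)
        ≡⟨ cong₂ (λ x z → q * q * (1ℚ - q * q * R) * x * z) (E-split q P a≢0) (E-split q R y≢0) ⟩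
      ratioNum q a y (Z j) ∎
      where
      P = Z j
      R = Z j * Z j
      l : ∀ x₁ x₂ x₃ x₄ x₅ a y s → x₁ * x₂ * x₃ * x₄ * x₅ * (a * y) * s ≡ s * x₃ * (x₁ * x₂ * a) * (x₄ * x₅ * y)
      l = solve-∀ ℚ-ring

    Df≡ : ∀ j → Df j * (a * y) ≡ ratioDen q a y (Z j)
    Df≡ j = begin
      Df j * (a * y)
        ≡⟨ cong₂ (λ P R → denFactor s₂ s₄ P R * (a * y)) (s₂^ j) (s₄^ j) ⟩
      denFactor s₂ s₄ P R * (a * y)
        ≡⟨ cong₂ (λ t f → denFactor t f P R * (a * y)) s₂≡ s₄≡ ⟩
      denFactor (q * q) q⁴ P R * (a * y)
        ≡⟨ l (1ℚ - q⁴ * R) (1ℚ - q⁴ / a * R) (1ℚ - a * q⁴ * R) (1ℚ - q * q / y * P) (1ℚ - y * (q * q) * P) a y ⟩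
      (1ℚ - q⁴ * R) * ((1ℚ - a * q⁴ * R) * (1ℚ - q⁴ / a * R) * a) * ((1ℚ - y * (q * q) * P) * (1ℚ - q * q / y * P) * y)
        ≡⟨ cong₂ (λ x z → (1ℚ - q⁴ * R) * x * z) (E-split q⁴ R a≢0) (E-split (q * q) P y≢0) ⟩
      ratioDen q a y (Z j) ∎
      where
      q⁴ = q * q * q * q
      P = Z j
      R = Z j * Z j
      l : ∀ x₁ x₂ x₃ x₄ x₅ a y → x₁ * x₂ * x₃ * x₄ * x₅ * (a * y) ≡ x₁ * (x₃ * x₂ * a) * (x₅ * x₄ * y)
      l = solve-∀ ℚ-ring

    Df≢0 : ∀ j → Df j ≢ 0ℚ
    Df≢0 j = nonzero-*ˡ {Df j} {a * y} (λ eq → ratioDen≢0 oa oy j (trans (sym (Df≡ j)) eq))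

    PN PD : ℚ
    PN = prod k Nf
    PD = prod k Df

    q^2k : q ^ (2 ℕ.* k) ≡ Z k
    q^2k = trans (sym (^-* q k 2)) (trans (l (q ^ k)) (sym (^-distrib q q k)))
      where
      l : ∀ x → 1ℚ * x * x ≡ x * x
      l = solve-∀ ℚ-ring

    ratio≡term : PN / PD * q ^ (2 ℕ.* k) ≡ term q a y k
    ratio≡term = begin
      PN * inv PD * q ^ (2 ℕ.* k)     ≡⟨ cong (PN * inv PD *_) q^2k ⟩
      PN * inv PD * Z k               ≡⟨ l₁ PN (inv PD) (Z k) ⟩
      PN * Z k / PD                   ≡⟨ /-cross {PN * Z k} {PD} {prod k (λ j → ratioNum q a y (Z j))} (prod-nonzero k (λ j _ → Df≢0 j)) (prod-nonzero k (λ j _ → ratioDen≢0 oa oy j)) cross ⟩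
      prod k (λ j → ratioNum q a y (Z j)) / prod k (λ j → ratioDen q a y (Z j))
                                      ≡⟨ prod-/ k (λ j _ → ratioDen≢0 oa oy j) ⟨
      term q a y k                    ∎
      where
      c = (a * y) ^ k
      l₁ : ∀ n i z → n * i * z ≡ n * z * i
      l₁ = solve-∀ ℚ-ring
      num≡ : prod k (λ j → ratioNum q a y (Z j)) ≡ PN * c * Z k
      num≡ = trans (prod-cong k (λ j _ → sym (Nf≡ j))) (trans (prod-* k (λ j → Nf j * (a * y)) (λ _ → q * q))
        (cong₂ _*_ (trans (prod-* k Nf (λ _ → a * y)) (cong (PN *_) (prod-const k (a * y)))) (prod-const k (q * q))))
      den≡ : prod k (λ j → ratioDen q a y (Z j)) ≡ PD * c
      den≡ = trans (prod-cong k (λ j _ → sym (Df≡ j))) (trans (prod-* k Df (λ _ → a * y)) (cong (PD *_) (prod-const k (a * y))))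
      cross : PN * Z k * prod k (λ j → ratioDen q a y (Z j)) ≡ prod k (λ j → ratioNum q a y (Z j)) * PD
      cross = trans (cong (PN * Z k *_) den≡) (trans (l₂ PN (Z k) PD c) (cong (_* PD) (sym num≡)))
        where
        l₂ : ∀ n z d c → n * z * (d * c) ≡ n * c * z * d
        l₂ = solve-∀ ℚ-ring

    q^6k+1 : 1ℚ - q ^ (6 ℕ.* k ℕ.+ 1) ≡ weight k
    q^6k+1 = cong (λ x → 1ℚ - x) (trans (^-+ q (6 ℕ.* k) 1) (trans (cong (_* (1ℚ * q)) (sym (^-* q k 6)))
      (trans (l (q ^ k) q) (cong (λ z → q * (z * z * z)) (sym (^-distrib q q k))))))
      where
      l : ∀ x q → 1ℚ * x * x * x * x * x * x * (1ℚ * q) ≡ q * (x * x * (x * x) * (x * x))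
      l = solve-∀ ℚ-ring

    summand-⇓ : ρ ⊢ summand k ⇓ inv (1ℚ - q) * (weight k * term q a y k)
    summand-⇓ = ⇓-≡ value (⇓-* (⇓-*
        (⇓-/ 1-q≢0 (⇓-- ⇓-1 (⇓-pow (6 ℕ.* k ℕ.+ 1) ⇓-q)) (⇓-- ⇓-1 ⇓-q))
        (⇓-/ (prod-nonzero k (λ j _ → Df≢0 j))
          (⇓-≡ (prod-*⁵ k f₁ f₂ f₃ f₄ f₅) (⇓-* (⇓-* (⇓-* (⇓-* (⇓-poch k (⇓-* ⇓-a ⇓-q) ⇓-q2) (⇓-poch k (⇓-/ a≢0 ⇓-q ⇓-a) ⇓-q2))
            (⇓-poch k ⇓-q2 ⇓-q4)) (⇓-poch k (⇓-* ⇓-b3 ⇓-q) ⇓-q4)) (⇓-poch k (⇓-/ y≢0 ⇓-q ⇓-b3) ⇓-q4)))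
          (⇓-≡ (prod-*⁵ k g₁ g₂ g₃ g₄ g₅) (⇓-* (⇓-* (⇓-* (⇓-* (⇓-poch k ⇓-q4 ⇓-q4) (⇓-poch k (⇓-/ a≢0 ⇓-q4 ⇓-a) ⇓-q4))
            (⇓-poch k (⇓-* ⇓-a ⇓-q4) ⇓-q4)) (⇓-poch k (⇓-/ y≢0 ⇓-q2 ⇓-b3) ⇓-q2)) (⇓-poch k (⇓-* ⇓-b3 ⇓-q2) ⇓-q2)))))
      (⇓-pow (2 ℕ.* k) ⇓-q))
      where
      f₁ f₂ f₃ f₄ f₅ g₁ g₂ g₃ g₄ g₅ : ℕ → ℚ
      f₁ j = 1ℚ - a * q * s₂ ^ j
      f₂ j = 1ℚ - q / a * s₂ ^ j
      f₃ j = 1ℚ - s₂ * s₄ ^ j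
      f₄ j = 1ℚ - y * q * s₄ ^ j
      f₅ j = 1ℚ - q / y * s₄ ^ j
      g₁ j = 1ℚ - s₄ * s₄ ^ j
      g₂ j = 1ℚ - s₄ / a * s₄ ^ j
      g₃ j = 1ℚ - a * s₄ * s₄ ^ j
      g₄ j = 1ℚ - s₂ / y * s₂ ^ j
      g₅ j = 1ℚ - y * s₂ * s₂ ^ j
      value : (1ℚ - q ^ (6 ℕ.* k ℕ.+ 1)) / (1ℚ - q) * (PN / PD) * q ^ (2 ℕ.* k) ≡ inv (1ℚ - q) * (weight k * term q a y k)
      value = trans (l (1ℚ - q ^ (6 ℕ.* k ℕ.+ 1)) (inv (1ℚ - q)) (PN / PD) (q ^ (2 ℕ.* k)))
        (cong₂ (λ x z → inv (1ℚ - q) * (x * z)) q^6k+1 ratio≡term)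
        where
        l : ∀ w i r z → w * i * r * z ≡ i * (w * (r * z))
        l = solve-∀ ℚ-ring

  lhsValue : ℚ
  lhsValue = inv (1ℚ - q) * partialSum q a y n

  lhs-⇓ : ρ ⊢ lhs n ⇓ lhsValue
  lhs-⇓ = ⇓-≡ (sum-*ˡ n (inv (1ℚ - q)) (λ k → weight k * term q a y k)) (⇓-sum n (λ k → Summand.summand-⇓ k))

  M K : ℕ
  M = 2 ℕ.+ 3 ℕ.* m
  K = suc m

  Q≡u : Q ≡ u h
  Q≡u = trans (*-comm (q ^ (2 ℕ.* h)) q) (cong (q *_) (trans (cong (q ^_) (ℕₚ.*-comm 2 h)) (sym (s^ m q h))))

  -- Because 3n = 4M + 1, the point b = qⁿ makes y = b³ the node of index M of `partialSum-y`.
  Q³≡ : Q ^ 3 ≡ q * (Z M * Z M)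
  Q³≡ = begin
    Q ^ 3                        ≡⟨ ^-* q n 3 ⟩
    q ^ (3 ℕ.* n)                ≡⟨ cong (q ^_) (lem m) ⟩
    q ^ (M ℕ.* 2 ℕ.+ M ℕ.* 2) * q ≡⟨ cong (_* q) (^-+ q (M ℕ.* 2) (M ℕ.* 2)) ⟩
    q ^ (M ℕ.* 2) * q ^ (M ℕ.* 2) * q ≡⟨ cong (λ x → x * x * q) (s^ m q M) ⟨
    Z M * Z M * q                ≡⟨ *-comm (Z M * Z M) q ⟩
    q * (Z M * Z M)              ∎
    where
    open +-*-Solver
    lem : ∀ m → 3 ℕ.* suc (2 ℕ.* suc (2 ℕ.* m)) ≡ suc ((2 ℕ.+ 3 ℕ.* m) ℕ.* 2 ℕ.+ (2 ℕ.+ 3 ℕ.* m) ℕ.* 2)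
    lem = solve 1 (λ m → con 3 :* (con 1 :+ con 2 :* (con 1 :+ con 2 :* m)) :=
      con 1 :+ ((con 2 :+ con 3 :* m) :* con 2 :+ (con 2 :+ con 3 :* m) :* con 2)) refl

  qQ≡ : q * Q ≡ Z K * Z K
  qQ≡ = begin
    q * Q                          ≡⟨ *-comm q Q ⟩
    q ^ suc n                      ≡⟨ cong (q ^_) (lem m) ⟩
    q ^ (K ℕ.* 2 ℕ.+ K ℕ.* 2)      ≡⟨ ^-+ q (K ℕ.* 2) (K ℕ.* 2) ⟩
    q ^ (K ℕ.* 2) * q ^ (K ℕ.* 2)  ≡⟨ cong (λ x → x * x) (s^ m q K) ⟨
    Z K * Z K                      ∎
    where
    open +-*-Solver
    lem : ∀ m → suc (suc (2 ℕ.* suc (2 ℕ.* m))) ≡ suc m ℕ.* 2 ℕ.+ suc m ℕ.* 2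
    lem = solve 1 (λ m → con 2 :+ con 2 :* (con 1 :+ con 2 :* m) := (con 1 :+ m) :* con 2 :+ (con 1 :+ m) :* con 2) refl

  θ : ℚ → ℚ → ℚ
  θ c d = ((1ℚ - c * Q) * (c - Q) * (- 1ℚ - d ^ 2 + d * Q)) / ((d - c) * (1ℚ - d * c))

  module First where

    f₁ f₂ f₃ g₁ g₂ g₃ F G t : ℕ → ℚ
    f₁ j = 1ℚ - q ^ 5 * s₄ ^ j
    f₂ j = 1ℚ - a * s₂ * s₄ ^ j
    f₃ j = 1ℚ - s₂ / a * s₄ ^ j
    g₁ j = 1ℚ - q * s₄ ^ j
    g₂ j = 1ℚ - s₄ / a * s₄ ^ j
    g₃ j = 1ℚ - a * s₄ * s₄ ^ j
    F j = f₁ j * f₂ j * f₃ j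
    G j = g₁ j * g₂ j * g₃ j
    t j = 1ℚ - q * (Z j * Z j)

    t≢0 : ∀ j → t j ≢ 0ℚ
    t≢0 j = odd≢1 (even-ZZ j)

    F≡ : ∀ j → F j * a ≡ t (suc j) * E a (q * q * (Z j * Z j))
    F≡ j = begin
      f₁ j * f₂ j * f₃ j * a
        ≡⟨ *-assoc³ (f₁ j) (f₂ j) (f₃ j) a ⟩
      f₁ j * (f₂ j * f₃ j * a)
        ≡⟨ cong₂ _*_ (cong (λ x → 1ℚ - x) (trans (cong (q ^ 5 *_) (s₄^ j)) (l q (Z j))))
             (trans (cong₂ (λ c R → (1ℚ - a * c * R) * (1ℚ - c / a * R) * a) s₂≡ (s₄^ j)) (E-split (q * q) (Z j * Z j) a≢0)) ⟩
      t (suc j) * E a (q * q * (Z j * Z j)) ∎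
      where
      *-assoc³ : ∀ x y z a → x * y * z * a ≡ x * (y * z * a)
      *-assoc³ = solve-∀ ℚ-ring
      l : ∀ q z → 1ℚ * q * q * q * q * q * (z * z) ≡ q * (z * (q * q) * (z * (q * q)))
      l = solve-∀ ℚ-ring

    G≡ : ∀ j → G j * a ≡ t j * E a (pl j)
    G≡ j = begin
      g₁ j * g₂ j * g₃ j * a
        ≡⟨ *-assoc³ (g₁ j) (g₂ j) (g₃ j) a ⟩
      g₁ j * (g₃ j * g₂ j * a)
        ≡⟨ cong₂ _*_ (cong (λ x → 1ℚ - q * x) (s₄^ j))
             (trans (cong₂ (λ c R → (1ℚ - a * c * R) * (1ℚ - c / a * R) * a) s₄≡ (s₄^ j)) (E-split (q * q * q * q) (Z j * Z j) a≢0)) ⟩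
      t j * E a (pl j) ∎
      where
      *-assoc³ : ∀ x y z a → x * y * z * a ≡ x * (z * y * a)
      *-assoc³ = solve-∀ ℚ-ring

    tE≢0 : ∀ j → t j * E a (pl j) ≢ 0ℚ
    tE≢0 j = *-nonzero (t≢0 j) (E≢0 oa (even-pl j))

    G≢0 : ∀ j → G j ≢ 0ℚ
    G≢0 j = nonzero-*ˡ {G j} {a} (λ eq → tE≢0 j (trans (sym (G≡ j)) eq))

    -- The part free of a, (q⁵; q⁴)_M/(q; q⁴)_M, telescopes; the remaining factors pair into the
    -- ratios of `closedY`.
    ratio : prod M F / prod M G ≡ (1ℚ - q * (Z M * Z M)) / (1ℚ - q) * closedY q a M
    ratio = begin
      prod M F / prod M G
        ≡⟨ prod-/ M (λ j _ → G≢0 j) ⟨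
      prod M (λ j → F j / G j)
        ≡⟨ prod-cong M (λ j _ → factor j) ⟩
      prod M (λ j → t (suc j) / t j * (E a (q * q * (Z j * Z j)) / E a (pl j)))
        ≡⟨ prod-* M (λ j → t (suc j) / t j) (λ j → E a (q * q * (Z j * Z j)) / E a (pl j)) ⟩
      prod M (λ j → t (suc j) / t j) * closedY q a M
        ≡⟨ cong (_* closedY q a M) (prod-telescope M t t≢0) ⟩
      t M / t 0 * closedY q a M
        ≡⟨ cong (λ x → t M / (1ℚ - x) * closedY q a M) (*-identityʳ q) ⟩
      (1ℚ - q * (Z M * Z M)) / (1ℚ - q) * closedY q a M ∎
      where
      factor : ∀ j → F j / G j ≡ t (suc j) / t j * (E a (q * q * (Z j * Z j)) / E a (pl j))
      factor j = trans (/-cross {F j} {G j} {t (suc j) * E a (q * q * (Z j * Z j))} {t j * E a (pl j)} (G≢0 j) (tE≢0 j)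
          (trans (cong (F j *_) (sym (G≡ j))) (trans (l (F j) (G j) a) (cong (_* G j) (F≡ j)))))
        (sym (/-*-/ {t (suc j)} {t j} {E a (q * q * (Z j * Z j))} {E a (pl j)} (t≢0 j) (E≢0 oa (even-pl j))))
        where
        l : ∀ f g a → f * (g * a) ≡ f * a * g
        l = solve-∀ ℚ-ring

  module Second where

    f₁ f₂ f₃ g₁ g₂ g₃ F G t e : ℕ → ℚ
    f₁ j = 1ℚ - q ^ 3 * s₄ ^ j
    f₂ j = 1ℚ - y * s₄ ^ j
    f₃ j = 1ℚ - 1ℚ / y * s₄ ^ j
    g₁ j = 1ℚ - 1ℚ / q * s₄ ^ j
    g₂ j = 1ℚ - s₂ / y * s₄ ^ j
    g₃ j = 1ℚ - y * s₂ * s₄ ^ j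
    F j = f₁ j * f₂ j * f₃ j
    G j = g₁ j * g₂ j * g₃ j
    t j = 1ℚ - inv q * (Z j * Z j)
    e j = E y (Z j * Z j) / E y (q * q * (Z j * Z j))

    even-e : ∀ j → Even q (q * q * (Z j * Z j))
    even-e j = Even-* even-qq (even-ZZ j)

    -- Multiplied by q it becomes q - q^{4j}, a factor of E(q, q^{4j}), which is nonzero by parity.
    t≢0 : ∀ j → t j ≢ 0ℚ
    t≢0 j = nonzero-*ʳ {q} (λ eq → nonzero-*ʳ {1ℚ - q * (Z j * Z j)} (E≢0 odd-q (even-ZZ j))
      (trans (sym (trans (l q (inv q) (Z j * Z j)) (trans (cong (λ x → q - x * (Z j * Z j)) (*-inv q≢0)) (cong (λ x → q - x) (*-identityˡ (Z j * Z j)))))) eq))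
      where
      odd-q : Odd q q
      odd-q = subst (Odd q) (*-identityʳ q) (odd-u 0)
      l : ∀ q i x → q * (1ℚ - i * x) ≡ q - q * i * x
      l = solve-∀ ℚ-ring

    F≡ : ∀ j → F j * y ≡ t (suc j) * E y (Z j * Z j)
    F≡ j = begin
      f₁ j * f₂ j * f₃ j * y
        ≡⟨ l₀ (q ^ 3 * s₄ ^ j) y (s₄ ^ j) (inv y) ⟩
      f₁ j * ((1ℚ - y * 1ℚ * s₄ ^ j) * (1ℚ - 1ℚ / y * s₄ ^ j) * y)
        ≡⟨ cong₂ _*_ (cong (λ x → 1ℚ - x) first) (trans (E-split 1ℚ (s₄ ^ j) y≢0) (cong (E y) (trans (*-identityˡ (s₄ ^ j)) (s₄^ j)))) ⟩
      t (suc j) * E y (Z j * Z j) ∎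
      where
      l₀ : ∀ x y r i → (1ℚ - x) * (1ℚ - y * r) * (1ℚ - 1ℚ * i * r) * y ≡ (1ℚ - x) * ((1ℚ - y * 1ℚ * r) * (1ℚ - 1ℚ * i * r) * y)
      l₀ = solve-∀ ℚ-ring
      first : q ^ 3 * s₄ ^ j ≡ inv q * (Z (suc j) * Z (suc j))
      first = begin
        q ^ 3 * s₄ ^ j                             ≡⟨ cong (q ^ 3 *_) (s₄^ j) ⟩
        1ℚ * q * q * q * (Z j * Z j)               ≡⟨ cong (λ x → x * q * q * q * (Z j * Z j)) (*-inv q≢0) ⟨
        q * inv q * q * q * q * (Z j * Z j)        ≡⟨ l q (inv q) (Z j) ⟩
        inv q * (Z (suc j) * Z (suc j))            ∎
        where
        l : ∀ q i z → q * i * q * q * q * (z * z) ≡ i * (z * (q * q) * (z * (q * q)))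
        l = solve-∀ ℚ-ring

    G≡ : ∀ j → G j * y ≡ t j * E y (q * q * (Z j * Z j))
    G≡ j = begin
      g₁ j * g₂ j * g₃ j * y
        ≡⟨ l₀ (g₁ j) (g₂ j) (g₃ j) y ⟩
      g₁ j * (g₃ j * g₂ j * y)
        ≡⟨ cong₂ _*_ (cong₂ (λ c x → 1ℚ - c * x) (*-identityˡ (inv q)) (s₄^ j))
             (trans (cong₂ (λ c R → (1ℚ - y * c * R) * (1ℚ - c / y * R) * y) s₂≡ (s₄^ j)) (E-split (q * q) (Z j * Z j) y≢0)) ⟩
      t j * E y (q * q * (Z j * Z j)) ∎
      where
      l₀ : ∀ x y z a → x * y * z * a ≡ x * (z * y * a)
      l₀ = solve-∀ ℚ-ring

    tE≢0 : ∀ j → t j * E y (q * q * (Z j * Z j)) ≢ 0ℚ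
    tE≢0 j = *-nonzero (t≢0 j) (E≢0 oy (even-e j))

    G≢0 : ∀ j → G j ≢ 0ℚ
    G≢0 j = nonzero-*ˡ {G j} {y} (λ eq → tE≢0 j (trans (sym (G≡ j)) eq))

    -- Since 4K - 1 = n, the numerator is 1 - qⁿ; the denominator 1 - 1/q is -(1 - q)/q, which
    -- produces the -q that `closedA` carries at odd indices.
    end : t K / t 0 ≡ (1ℚ - Q) / (1ℚ - q) * - q
    end = /-intro (t≢0 0) (begin
      1ℚ - inv q * (Z K * Z K)
        ≡⟨ cong (λ x → 1ℚ - inv q * x) qQ≡ ⟨
      1ℚ - inv q * (q * Q)
        ≡⟨ l₁ (inv q) q Q ⟩
      1ℚ - inv q * q * Q
        ≡⟨ cong (λ x → 1ℚ - x * Q) (inv*≡1 q≢0) ⟩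
      1ℚ - 1ℚ * Q
        ≡⟨ l₂ Q ⟩
      (1ℚ - Q) * 1ℚ
        ≡⟨ cong ((1ℚ - Q) *_) (*-inv 1-q≢0) ⟨
      (1ℚ - Q) * ((1ℚ - q) * inv (1ℚ - q))
        ≡⟨ l₃ (1ℚ - Q) q (inv (1ℚ - q)) ⟩
      (1ℚ - Q) * inv (1ℚ - q) * (- q + 1ℚ)
        ≡⟨ cong (λ x → (1ℚ - Q) * inv (1ℚ - q) * (- q + x)) (inv*≡1 q≢0) ⟨
      (1ℚ - Q) * inv (1ℚ - q) * (- q + inv q * q)
        ≡⟨ l₄ ((1ℚ - Q) * inv (1ℚ - q)) q (inv q) ⟩
      (1ℚ - Q) / (1ℚ - q) * - q * t 0 ∎)
      where
      l₁ : ∀ i q Q → 1ℚ - i * (q * Q) ≡ 1ℚ - i * q * Q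
      l₁ = solve-∀ ℚ-ring
      l₂ : ∀ Q → 1ℚ - 1ℚ * Q ≡ (1ℚ - Q) * 1ℚ
      l₂ = solve-∀ ℚ-ring
      l₃ : ∀ x q i → x * ((1ℚ - q) * i) ≡ x * i * (- q + 1ℚ)
      l₃ = solve-∀ ℚ-ring
      l₄ : ∀ x q i → x * (- q + i * q) ≡ x * - q * (1ℚ - i * (1ℚ * 1ℚ))
      l₄ = solve-∀ ℚ-ring

    v≡ : closedA q y h ≡ - q * prod K e
    v≡ = trans (cong (λ k → closedA q y (suc k)) (ℕₚ.*-comm 2 m)) (closedA-odd q y m)

    ratio : prod K F / prod K G ≡ (1ℚ - Q) / (1ℚ - q) * closedA q y h
    ratio = begin
      prod K F / prod K G
        ≡⟨ prod-/ K (λ j _ → G≢0 j) ⟨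
      prod K (λ j → F j / G j)
        ≡⟨ prod-cong K (λ j _ → factor j) ⟩
      prod K (λ j → t (suc j) / t j * e j)
        ≡⟨ prod-* K (λ j → t (suc j) / t j) e ⟩
      prod K (λ j → t (suc j) / t j) * prod K e
        ≡⟨ cong (_* prod K e) (trans (prod-telescope K t t≢0) end) ⟩
      (1ℚ - Q) / (1ℚ - q) * - q * prod K e
        ≡⟨ *-assoc ((1ℚ - Q) / (1ℚ - q)) (- q) (prod K e) ⟩
      (1ℚ - Q) / (1ℚ - q) * (- q * prod K e)
        ≡⟨ cong ((1ℚ - Q) / (1ℚ - q) *_) v≡ ⟨
      (1ℚ - Q) / (1ℚ - q) * closedA q y h ∎
      where
      factor : ∀ j → F j / G j ≡ t (suc j) / t j * e j
      factor j = trans (/-cross {F j} {G j} {t (suc j) * E y (Z j * Z j)} {t j * E y (q * q * (Z j * Z j))} (G≢0 j) (tE≢0 j)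
          (trans (cong (F j *_) (sym (G≡ j))) (trans (l (F j) (G j) y) (cong (_* G j) (F≡ j)))))
        (sym (/-*-/ {t (suc j)} {t j} {E y (Z j * Z j)} {E y (q * q * (Z j * Z j))} (t≢0 j) (E≢0 oy (even-e j))))
        where
        l : ∀ f g a → f * (g * a) ≡ f * a * g
        l = solve-∀ ℚ-ring

  rhsValue : ℚ
  rhsValue = θ a b * ((1ℚ - q * (Z M * Z M)) / (1ℚ - q) * closedY q a M) + θ b a * ((1ℚ - Q) / (1ℚ - q) * closedA q y h)

  b-a≢0 : b - a ≢ 0ℚ
  b-a≢0 = ≢⇒-≢0 (λ eq → Admissible.a≢b ad (sym eq))
  a-b≢0 : a - b ≢ 0ℚ
  a-b≢0 = ≢⇒-≢0 (Admissible.a≢b ad)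
  1-ab≢0 : 1ℚ - a * b ≢ 0ℚ
  1-ab≢0 = ≢⇒-≢0 (λ eq → Admissible.ab≢1 ad (sym eq))
  1-ba≢0 : 1ℚ - b * a ≢ 0ℚ
  1-ba≢0 = subst (λ x → 1ℚ - x ≢ 0ℚ) (*-comm a b) 1-ab≢0

  theta-⇓ : ∀ {c d x z} → ρ ⊢ c ⇓ x → ρ ⊢ d ⇓ z → (z - x) * (1ℚ - z * x) ≢ 0ℚ → ρ ⊢ thetaR n c d ⇓ θ x z
  theta-⇓ ec ed nz = ⇓-/ nz
    (⇓-* (⇓-* (⇓-- ⇓-1 (⇓-* ec qn-⇓)) (⇓-- ec qn-⇓)) (⇓-+ (⇓-- (⇓-neg ⇓-1) (⇓-pow 2 ed)) (⇓-* ed qn-⇓)))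
    (⇓-* (⇓-- ed ec) (⇓-- ⇓-1 (⇓-* ed ec)))
    where
    qn-⇓ : ρ ⊢ powR qR n ⇓ Q
    qn-⇓ = ⇓-pow n ⇓-q

  rhs-⇓ : ρ ⊢ rhsAt n M K ⇓ rhsValue
  rhs-⇓ = ⇓-+
    (⇓-* (theta-⇓ ⇓-a ⇓-b (*-nonzero b-a≢0 1-ba≢0)) (⇓-≡ First.ratio (⇓-/ (prod-nonzero M (λ j _ → First.G≢0 j))
      (⇓-≡ (prod-*³ M First.f₁ First.f₂ First.f₃)
        (⇓-* (⇓-* (⇓-poch M (⇓-pow 5 ⇓-q) ⇓-q4) (⇓-poch M (⇓-* ⇓-a ⇓-q2) ⇓-q4)) (⇓-poch M (⇓-/ a≢0 ⇓-q2 ⇓-a) ⇓-q4)))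
      (⇓-≡ (prod-*³ M First.g₁ First.g₂ First.g₃)
        (⇓-* (⇓-* (⇓-poch M ⇓-q ⇓-q4) (⇓-poch M (⇓-/ a≢0 ⇓-q4 ⇓-a) ⇓-q4)) (⇓-poch M (⇓-* ⇓-a ⇓-q4) ⇓-q4))))))
    (⇓-* (theta-⇓ ⇓-b ⇓-a (*-nonzero a-b≢0 1-ab≢0)) (⇓-≡ Second.ratio (⇓-/ (prod-nonzero K (λ j _ → Second.G≢0 j))
      (⇓-≡ (prod-*³ K Second.f₁ Second.f₂ Second.f₃)
        (⇓-* (⇓-* (⇓-poch K (⇓-pow 3 ⇓-q) ⇓-q4) (⇓-poch K ⇓-b3 ⇓-q4)) (⇓-poch K (⇓-/ y≢0 ⇓-1 ⇓-b3) ⇓-q4)))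
      (⇓-≡ (prod-*³ K Second.g₁ Second.g₂ Second.g₃)
        (⇓-* (⇓-* (⇓-poch K (⇓-/ q≢0 ⇓-1 ⇓-q) ⇓-q4) (⇓-poch K (⇓-/ y≢0 ⇓-q2 ⇓-b3) ⇓-q4)) (⇓-poch K (⇓-* ⇓-b3 ⇓-q2) ⇓-q4))))))

  θ-zero : ∀ c d → c ≡ Q ⊎ c * Q ≡ 1ℚ → θ c d ≡ 0ℚ
  θ-zero c d boundary = trans (cong (λ x → x * (- 1ℚ - d ^ 2 + d * Q) * inv ((d - c) * (1ℚ - d * c))) (vanish boundary))
    (l (- 1ℚ - d ^ 2 + d * Q) (inv ((d - c) * (1ℚ - d * c))))
    where
    l : ∀ x i → 0ℚ * x * i ≡ 0ℚ
    l = solve-∀ ℚ-ring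
    vanish : c ≡ Q ⊎ c * Q ≡ 1ℚ → (1ℚ - c * Q) * (c - Q) ≡ 0ℚ
    vanish (inj₁ c≡Q) = trans (cong ((1ℚ - c * Q) *_) (x≡y⇒x-y≡0 c≡Q)) (*-zeroʳ (1ℚ - c * Q))
    vanish (inj₂ cQ≡1) = trans (cong (_* (c - Q)) (x≡y⇒x-y≡0 (sym cQ≡1))) (*-zeroˡ (c - Q))

  -- The factor -1 - d² + dQ is -1 at d = Q and -d² at d = 1/Q, exactly what turns E(c, Q) into E(d,
  -- c) in each case.
  θ-one : ∀ c d → (d - c) * (1ℚ - d * c) ≢ 0ℚ → d ≡ Q ⊎ d * Q ≡ 1ℚ → θ c d ≡ 1ℚ
  θ-one c d nz (inj₁ d≡Q) = /-intro nz (begin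
    (1ℚ - c * Q) * (c - Q) * (- 1ℚ - d ^ 2 + d * Q)   ≡⟨ cong (λ Q → (1ℚ - c * Q) * (c - Q) * (- 1ℚ - d ^ 2 + d * Q)) d≡Q ⟨
    (1ℚ - c * d) * (c - d) * (- 1ℚ - d ^ 2 + d * d)   ≡⟨ l c d ⟩
    1ℚ * ((d - c) * (1ℚ - d * c))                     ∎)
    where
    l : ∀ c d → (1ℚ - c * d) * (c - d) * (- 1ℚ - 1ℚ * d * d + d * d) ≡ 1ℚ * ((d - c) * (1ℚ - d * c))
    l = solve-∀ ℚ-ring
  θ-one c d nz (inj₂ dQ≡1) = /-intro nz (begin
    (1ℚ - c * Q) * (c - Q) * (- 1ℚ - d ^ 2 + d * Q)                ≡⟨ cong (λ x → (1ℚ - c * Q) * (c - Q) * (- 1ℚ - d ^ 2 + x)) dQ≡1 ⟩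
    (1ℚ - c * Q) * (c - Q) * (- 1ℚ - d ^ 2 + 1ℚ)                   ≡⟨ l₁ c d Q ⟩
    (d - c * (d * Q)) * (d * Q - d * c)                            ≡⟨ cong (λ x → (d - c * x) * (x - d * c)) dQ≡1 ⟩
    (d - c * 1ℚ) * (1ℚ - d * c)                                    ≡⟨ l₂ c d ⟩
    1ℚ * ((d - c) * (1ℚ - d * c))                                  ∎)
    where
    l₁ : ∀ c d Q → (1ℚ - c * Q) * (c - Q) * (- 1ℚ - 1ℚ * d * d + 1ℚ) ≡ (d - c * (d * Q)) * (d * Q - d * c)
    l₁ = solve-∀ ℚ-ring
    l₂ : ∀ c d → (d - c * 1ℚ) * (1ℚ - d * c) ≡ 1ℚ * ((d - c) * (1ℚ - d * c))
    l₂ = solve-∀ ℚ-ring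

  odd-Q : Odd q Q
  odd-Q = h , inj₁ refl

  h<n : suc h ℕ.≤ n
  h<n = s≤s (ℕₚ.m≤m+n h (1 ℕ.* h))

  M<n : suc M ℕ.≤ n
  M<n = subst (suc M ℕ.≤_) (lem m) (ℕₚ.m≤m+n (suc M) m)
    where
    open +-*-Solver
    lem : ∀ m → suc (2 ℕ.+ 3 ℕ.* m) ℕ.+ m ≡ suc (2 ℕ.* suc (2 ℕ.* m))
    lem = solve 1 (λ m → con 3 :+ con 3 :* m :+ m := con 1 :+ con 2 :* (con 1 :+ con 2 :* m)) refl

  -- On each boundary one weight θ is 0 and the other 1, which selects the closed form of that
  -- boundary; the case of exponent -n reduces to n by reciprocity.
  boundary-equality : Boundary m ρ → lhsValue ≡ rhsValue
  boundary-equality (inj₁ a-boundary) = begin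
    inv (1ℚ - q) * partialSum q a y n
      ≡⟨ cong (inv (1ℚ - q) *_) (trans (to-Q a-boundary) (trans (cong (λ x → partialSum q x y n) Q≡u) (partialSum-a oy n h h<n))) ⟩
    inv (1ℚ - q) * ((1ℚ - u h) * closedA q y h)
      ≡⟨ cong (λ x → inv (1ℚ - q) * ((1ℚ - x) * closedA q y h)) Q≡u ⟨
    inv (1ℚ - q) * ((1ℚ - Q) * closedA q y h)
      ≡⟨ l (inv (1ℚ - q)) (1ℚ - Q) (closedA q y h) X ⟩
    0ℚ * X + 1ℚ * ((1ℚ - Q) / (1ℚ - q) * closedA q y h)
      ≡⟨ cong₂ (λ x z → x * X + z * ((1ℚ - Q) / (1ℚ - q) * closedA q y h)) (θ-zero a b a-boundary) (θ-one b a (*-nonzero a-b≢0 1-ab≢0) a-boundary) ⟨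
    rhsValue ∎
    where
    X = (1ℚ - q * (Z M * Z M)) / (1ℚ - q) * closedY q a M
    l : ∀ i x v X → i * (x * v) ≡ 0ℚ * X + 1ℚ * (x * i * v)
    l = solve-∀ ℚ-ring
    to-Q : a ≡ Q ⊎ a * Q ≡ 1ℚ → partialSum q a y n ≡ partialSum q Q y n
    to-Q (inj₁ eq) = cong (λ x → partialSum q x y n) eq
    to-Q (inj₂ eq) = partialSum-reciprocalˡ q {a} {Q} y n eq (ratioDen≢0 oa oy) (ratioDen≢0 odd-Q oy)
  boundary-equality (inj₂ b-boundary) = begin
    inv (1ℚ - q) * partialSum q a y n
      ≡⟨ cong (inv (1ℚ - q) *_) (trans (to-Q b-boundary) (trans (cong (λ x → partialSum q a x n) Q³≡) (partialSum-y oa n M M<n))) ⟩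
    inv (1ℚ - q) * ((1ℚ - q * (Z M * Z M)) * closedY q a M)
      ≡⟨ l (inv (1ℚ - q)) (1ℚ - q * (Z M * Z M)) (closedY q a M) X ⟩
    1ℚ * ((1ℚ - q * (Z M * Z M)) / (1ℚ - q) * closedY q a M) + 0ℚ * X
      ≡⟨ cong₂ (λ x z → x * ((1ℚ - q * (Z M * Z M)) / (1ℚ - q) * closedY q a M) + z * X) (θ-one a b (*-nonzero b-a≢0 1-ba≢0) b-boundary) (θ-zero b a b-boundary) ⟨
    rhsValue ∎
    where
    X = (1ℚ - Q) / (1ℚ - q) * closedA q y h
    l : ∀ i x v X → i * (x * v) ≡ 1ℚ * (x * i * v) + 0ℚ * X
    l = solve-∀ ℚ-ring
    to-Q : b ≡ Q ⊎ b * Q ≡ 1ℚ → partialSum q a y n ≡ partialSum q a (Q ^ 3) n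
    to-Q (inj₁ eq) = cong (λ x → partialSum q a (x ^ 3) n) eq
    to-Q (inj₂ eq) = partialSum-reciprocalʳ q a {y} {Q ^ 3} n (trans (sym (^-distrib b Q 3)) (trans (cong (_^ 3) eq) (1^ 3)))
      (ratioDen≢0 oa oy) (ratioDen≢0 oa (odd-cube odd-Q))

  distinct : ∀ i j → i ≢ j → E (u i) (u j) ≢ 0ℚ
  distinct i j i≢j = subst (_≢ 0ℚ) (cong₂ E (u≡ i) (u≡ j))
    (*-nonzero (≢⇒-≢0 (λ eq → odd*odd≢1 (Admissible.index ad) i j (sym eq))) (≢⇒-≢0 (odd≢odd (Admissible.index ad) i≢j)))
    where
    u≡ : ∀ k → odd (Admissible.index ad) k ≡ u k
    u≡ k = trans (cong (_^ suc (2 ℕ.* k)) (sym (Admissible.q≡ ad))) (trans (*-comm (q ^ (2 ℕ.* k)) q) (cong (q *_) (trans (cong (q ^_) (ℕₚ.*-comm 2 k)) (sym (s^ m q k)))))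

  open Lagrange u using (ℓ)

  -- There are 2h = n - 1 poles against n nodes. The factor 1 - u i of the value at the i-th node is
  -- grouped with the poles and the node product, since only together are they divisible by 1 - qⁿ
  -- with a regular cofactor.
  interpolated : poles q y (2 ℕ.* h) a * partialSum q a y n ≡
    sum n (λ i → poles q y (2 ℕ.* h) (u i) * (1ℚ - u i) * inv (prod n (λ j → skip i j (E (u i) (u j)))) * (closedA q y i * prod n (λ j → skip i j (E a (u j)))))
  interpolated = trans
    (partialSum-interpolation q y (2 ℕ.* h) (λ i j _ _ → distinct i j) (λ j _ → *-nonzero (1-pl≢0 j) (E≢0 oy (Even-* even-qq (even-Z j))))
      (λ i j _ _ → E≢0 (odd-u i) (even-pl j)) a (λ j _ → E≢0 oa (even-pl j)))
    (sum-cong n λ i i<n → begin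
      poles q y (2 ℕ.* h) (u i) * partialSum q (u i) y n * ℓ n i a
        ≡⟨ cong₂ (λ x z → poles q y (2 ℕ.* h) (u i) * x * z) (partialSum-a oy n i i<n) (ℓ≡ i) ⟩
      poles q y (2 ℕ.* h) (u i) * ((1ℚ - u i) * closedA q y i) * (prod n (λ j → skip i j (E a (u j))) * inv (np i))
        ≡⟨ l (poles q y (2 ℕ.* h) (u i)) (1ℚ - u i) (closedA q y i) (prod n (λ j → skip i j (E a (u j)))) (inv (np i)) ⟩
      poles q y (2 ℕ.* h) (u i) * (1ℚ - u i) * inv (np i) * (closedA q y i * prod n (λ j → skip i j (E a (u j)))) ∎)
    where
    np : ℕ → ℚ
    np i = prod n (λ j → skip i j (E (u i) (u j)))
    l : ∀ p x v a i → p * (x * v) * (a * i) ≡ p * x * i * (v * a)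
    l = solve-∀ ℚ-ring
    skip-nonzero : ∀ i j → skip i j (E (u i) (u j)) ≢ 0ℚ
    skip-nonzero i j with i ℕ.≟ j
    ... | yes _  = 1≢0
    ... | no i≢j = distinct i j i≢j
    skip-/ : ∀ i j → skip i j (E a (u j) / E (u i) (u j)) ≡ skip i j (E a (u j)) / skip i j (E (u i) (u j))
    skip-/ i j with i ℕ.≟ j
    ... | yes _ = sym (*-inv 1≢0)
    ... | no _  = refl
    ℓ≡ : ∀ i → ℓ n i a ≡ prod n (λ j → skip i j (E a (u j))) / np i
    ℓ≡ i = trans (prod-cong n (λ j _ → skip-/ i j)) (prod-/ n (λ j _ → skip-nonzero i j))

-- Divisibility by [n]

module Divisibility (m : ℕ) where
  open Modulus m

  ι^≢ι^ : ∀ {c d} → c ℕ.< d → ι c ^ n ≢ ι d ^ n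
  ι^≢ι^ {c} {d} c<d eq = ℕₚ.<⇒≢ (ℕₚ.^-monoˡ-< n c<d) (ι-injective (trans (ι-^ c n) (trans eq (sym (ι-^ d n)))))

  binomialPoly : Poly → ℕ → Poly
  binomialPoly F k = (con 1ℚ ⊕ ⊖ (F ⊗ powP qP (2 ℕ.* k))) ⊗ (F ⊕ ⊖ powP qP (2 ℕ.* k))

  Good-binomial : ∀ F c → 1 ℕ.< c → (∀ ρ → Admissible ρ → Odd (ρ vq) (evalP ρ F)) → (∀ q → evalP (special q) F ≡ ι c) →
    ∀ k → Good (binomialPoly F k)
  Good-binomial F c 1<c odd-F special-F k = good nz (Comaximal-⊗
      (Comaximal-binomial 1ℚ (ι c) (2 ℕ.* k) (ι^≢ι^ 1<c) (λ q → cong₂ (λ x y → 1ℚ - x * y) (special-F q) (eval-powP (special q) qP (2 ℕ.* k))))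
      (Comaximal-binomial (ι c) 1ℚ (2 ℕ.* k) (λ eq → ι^≢ι^ 1<c (sym eq)) (λ q → cong₂ (λ x y → x - y) (special-F q) (trans (eval-powP (special q) qP (2 ℕ.* k)) (sym (*-identityˡ (q ^ (2 ℕ.* k))))))))
    where
    nz : ∀ ρ → Admissible ρ → E (evalP ρ F) (evalP ρ (powP qP (2 ℕ.* k))) ≢ 0ℚ
    nz ρ ad = Values.E≢0 m ρ ad (odd-F ρ ad) (k , eval-powP ρ qP (2 ℕ.* k))

  -- `Even` with an exponent independent of the point, as required for naming one polynomial
  -- denominator.
  EvenFun : (Env → ℚ) → Set
  EvenFun f = Σ ℕ λ k → ∀ ρ → f ρ ≡ ρ vq ^ (2 ℕ.* k)

  EvenFun-* : ∀ {f g} → EvenFun f → EvenFun g → EvenFun (λ ρ → f ρ * g ρ)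
  EvenFun-* (k , ef) (l , eg) = k ℕ.+ l , λ ρ → trans (cong₂ _*_ (ef ρ) (eg ρ))
    (trans (sym (^-+ (ρ vq) (2 ℕ.* k) (2 ℕ.* l))) (cong (ρ vq ^_) (sym (ℕₚ.*-distribˡ-+ 2 k l))))

  EvenFun-s : EvenFun (Qs m)
  EvenFun-s = 1 , λ ρ → cong (_* ρ vq) (sym (*-identityˡ (ρ vq)))

  EvenFun-p : EvenFun (Qp⁴ m)
  EvenFun-p = 2 , λ ρ → cong (λ x → x * ρ vq * ρ vq * ρ vq) (sym (*-identityˡ (ρ vq)))

  EvenFun-^ : ∀ {f} j → EvenFun f → EvenFun (λ ρ → f ρ ^ j)
  EvenFun-^ zero    e = 0 , λ _ → refl
  EvenFun-^ (suc j) e = EvenFun-* (EvenFun-^ j e) e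

  Unit-E : ∀ F c → 1 ℕ.< c → (∀ ρ → Admissible ρ → Odd (ρ vq) (evalP ρ F)) → (∀ q → evalP (special q) F ≡ ι c) →
    ∀ {f} → EvenFun f → Unit m (λ ρ → E (evalP ρ F) (f ρ))
  Unit-E F c 1<c odd-F special-F {f} (k , ef) = Unit-cong m
    (λ ρ → cong (E (evalP ρ F)) (trans (eval-powP ρ qP (2 ℕ.* k)) (sym (ef ρ))))
    (unit (Good.nonzero G) (Reg-inv G))
    where
    G : Good (binomialPoly F k)
    G = Good-binomial F c 1<c odd-F special-F k

  Unit-Ea : ∀ {f} → EvenFun f → Unit m (λ ρ → E (ρ va) (f ρ))
  Unit-Ea = Unit-E aP 2 (s≤s (s≤s z≤n)) (λ ρ ad → Admissible.oddA ad) (λ _ → refl)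

  Unit-Ey : ∀ {f} → EvenFun f → Unit m (λ ρ → E (ρ vb ^ 3) (f ρ))
  -- 27 is the value of b³ at b = 3.
  Unit-Ey {f} = Unit-E (powP bP 3) 27 (s≤s (s≤s z≤n)) (λ ρ ad → Values.odd-cube m ρ ad (Admissible.oddB ad)) (λ _ → trans (sym (ι-^ 3 3)) refl) {f}

  Reg-E : ∀ {f g} → Reg f → Reg g → Reg (λ ρ → E (f ρ) (g ρ))
  Reg-E rf rg = Reg-* (Reg-- m (Reg-const 1ℚ) (Reg-* rf rg)) (Reg-- m rf rg)

  Reg-a : Reg (λ ρ → ρ va)
  Reg-a = Reg-poly aP

  Reg-b : Reg (λ ρ → ρ vb)
  Reg-b = Reg-poly bP

  Reg-y : Reg (λ ρ → ρ vb ^ 3)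
  Reg-y = Reg-^ 3 Reg-b

  Reg-/ : ∀ {f g} → Reg f → Unit m g → Reg (λ ρ → f ρ / g ρ)
  Reg-/ rf ug = Reg-* rf (Unit.reg-inv ug)

  Reg-v : ∀ i → Reg (λ ρ → closedA (ρ vq) (ρ vb ^ 3) i)
  Reg-v zero          = Reg-const 1ℚ
  Reg-v (suc zero)    = Reg-* (Reg-neg Reg-q) (Reg-/ (Reg-E Reg-y (Reg-const 1ℚ)) (Unit-Ey {Qs m} EvenFun-s))
  Reg-v (suc (suc i)) = Reg-* (Reg-v i) (Reg-/ (Reg-E Reg-y (Reg-* (Reg-s m) (Reg-^ i (Reg-s m))))
    (Unit-Ey {λ ρ → Qp⁴ m ρ * Qs m ρ ^ i} (EvenFun-* {Qp⁴ m} {λ ρ → Qs m ρ ^ i} EvenFun-p (EvenFun-^ i EvenFun-s))))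

  EvenFun-pole : ∀ j → EvenFun (λ ρ → Qp⁴ m ρ * (Qs m ρ ^ j * Qs m ρ ^ j))
  EvenFun-pole j = EvenFun-* {Qp⁴ m} {λ ρ → Qs m ρ ^ j * Qs m ρ ^ j} EvenFun-p
    (EvenFun-* {λ ρ → Qs m ρ ^ j} {λ ρ → Qs m ρ ^ j} (EvenFun-^ j EvenFun-s) (EvenFun-^ j EvenFun-s))

  Reg-w : ∀ i → Reg (λ ρ → closedY (ρ vq) (ρ va) i)
  Reg-w i = Reg-prod i λ j → Reg-/ (Reg-E Reg-a (Reg-* (Reg-s m) (Reg-* (Reg-^ j (Reg-s m)) (Reg-^ j (Reg-s m)))))
    (Unit-Ea {λ ρ → Qp⁴ m ρ * (Qs m ρ ^ j * Qs m ρ ^ j)} (EvenFun-pole j))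

  difference-unit : ∀ F G c c′ → (∀ ρ → Admissible ρ → evalP ρ F ≢ evalP ρ G) → (∀ ρ → Admissible ρ → evalP ρ F * evalP ρ G ≢ 1ℚ) →
    (∀ q → evalP (special q) F ≡ c) → (∀ q → evalP (special q) G ≡ c′) → c - c′ ≢ 0ℚ → 1ℚ - c * c′ ≢ 0ℚ →
    Unit m (λ ρ → (evalP ρ F - evalP ρ G) * (1ℚ - evalP ρ F * evalP ρ G))
  difference-unit F G c c′ ne ne′ eF eG nz nz′ = unit (Good.nonzero good-D) (Reg-inv good-D)
    where
    good-D : Good ((F ⊕ ⊖ G) ⊗ (con 1ℚ ⊕ ⊖ (F ⊗ G)))
    good-D = Good-⊗
      (good (λ ρ ad → ≢⇒-≢0 (ne ρ ad)) (Comaximal-const (c - c′) nz (λ q → cong₂ _-_ (eF q) (eG q))))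
      (good (λ ρ ad → ≢⇒-≢0 (λ eq → ne′ ρ ad (sym eq))) (Comaximal-const (1ℚ - c * c′) nz′ (λ q → cong₂ (λ x y → 1ℚ - x * y) (eF q) (eG q))))

  2≢3 : ι 2 ≢ ι 3
  2≢3 eq = ℕₚ.<⇒≢ (ℕₚ.n<1+n 2) (ι-injective eq)

  2*3≢1 : 1ℚ ≢ ι 2 * ι 3
  2*3≢1 eq = ℕₚ.<⇒≢ (s≤s (s≤s z≤n)) (ι-injective {1} {6} (trans eq (sym (ι-* 2 3))))

  θ : (Env → ℚ) → (Env → ℚ) → Env → ℚ
  θ c d ρ = ((1ℚ - c ρ * ρ vq ^ n) * (c ρ - ρ vq ^ n) * (- 1ℚ - d ρ ^ 2 + d ρ * ρ vq ^ n)) / ((d ρ - c ρ) * (1ℚ - d ρ * c ρ))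

  Reg-θ : ∀ {c d} → Reg c → Reg d → Unit m (λ ρ → (d ρ - c ρ) * (1ℚ - d ρ * c ρ)) → Reg (θ c d)
  Reg-θ rc rd u = Reg-/ (Reg-* (Reg-* (Reg-- m (Reg-const 1ℚ) (Reg-* rc rQ)) (Reg-- m rc rQ))
    (Reg-+ (Reg-- m (Reg-const (- 1ℚ)) (Reg-^ 2 rd)) (Reg-* rd rQ))) u
    where
    rQ : Reg (λ ρ → ρ vq ^ n)
    rQ = Reg-^ n Reg-q

  Reg-θab : Reg (θ (λ ρ → ρ va) (λ ρ → ρ vb))
  Reg-θab = Reg-θ Reg-a Reg-b (difference-unit bP aP (ι 3) (ι 2) (λ ρ ad eq → Admissible.a≢b ad (sym eq))
    (λ ρ ad eq → Admissible.ab≢1 ad (trans (*-comm (ρ va) (ρ vb)) eq)) (λ _ → refl) (λ _ → refl)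
    (≢⇒-≢0 (λ eq → 2≢3 (sym eq))) (≢⇒-≢0 (λ eq → 2*3≢1 (trans eq (*-comm (ι 3) (ι 2))))))

  Reg-θba : Reg (θ (λ ρ → ρ vb) (λ ρ → ρ va))
  Reg-θba = Reg-θ Reg-b Reg-a (difference-unit aP bP (ι 2) (ι 3) (λ ρ ad → Admissible.a≢b ad)
    (λ ρ ad → Admissible.ab≢1 ad) (λ _ → refl) (λ _ → refl) (≢⇒-≢0 2≢3) (≢⇒-≢0 2*3≢1))

  kappa : ∀ i → Σ (Env → ℚ) λ g → Reg g × (∀ ρ (ad : Admissible ρ) → i ℕ.< n → let open Values m ρ ad in
    poles q (ρ vb ^ 3) (2 ℕ.* h) (u i) * (1ℚ - u i) * inv (prod n (λ j → skip i j (E (u i) (u j)))) ≡ (1ℚ - q ^ n) * g ρ)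
  kappa i with i ℕ.<? n
  -- A default outside the range of summation, which makes the cofactors a total family in i.
  ... | no i≮n = (λ _ → 0ℚ) , Reg-const 0ℚ , λ ρ ad i<n → ⊥-elim (i≮n i<n)
  ... | yes i<n = g , proj₁ (proj₂ data′) , value
    where
    l = 2 ℕ.* h ℕ.∸ i
    i+l : i ℕ.+ l ≡ 2 ℕ.* h
    i+l = ℕₚ.m+[n∸m]≡n (ℕ.s≤s⁻¹ i<n)
    data′ = kappa-divisible m i l (trans (ℕₚ.+-suc i l) (cong suc i+l))
    g : Env → ℚ
    g = proj₁ data′
    value : ∀ ρ (ad : Admissible ρ) → i ℕ.< n → let open Values m ρ ad in
      poles q (ρ vb ^ 3) (2 ℕ.* h) (u i) * (1ℚ - u i) * inv (prod n (λ j → skip i j (E (u i) (u j)))) ≡ (1ℚ - q ^ n) * g ρ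
    value ρ ad _ = trans (cong (λ k → prod k (λ j → E (u i) (pl j)) * (1ℚ - u i) * inv (prod n (λ j → skip i j (E (u i) (u j))))) (sym i+l))
      (proj₂ (proj₂ data′) ρ ad (λ j _ i≢j → Evaluation.distinct m ρ ad i j i≢j))
      where open Values m ρ ad

  Reg-skip : ∀ i j {f} → Reg f → Reg (λ ρ → skip i j (f ρ))
  Reg-skip i j rf with i ℕ.≟ j
  ... | yes _ = Reg-const 1ℚ
  ... | no  _ = rf

  -- The left quotient is the interpolation formula with 1 - qⁿ taken out of every coefficient. Its
  -- denominator is the product of E(a, q^{4j+4}), a unit, so no factor 1 - q^{4j} is left to divide
  -- by.
  lhsQuotient rhsQuotient : Env → ℚ
  lhsQuotient ρ = sum n (λ i → proj₁ (kappa i) ρ * (closedA (ρ vq) (ρ vb ^ 3) i * prod n (λ j → skip i j (E (ρ va) (ρ vq * Qs m ρ ^ j)))))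
    / prod (2 ℕ.* h) (λ j → E (ρ va) (Qp⁴ m ρ * (Qs m ρ ^ j * Qs m ρ ^ j)))
  rhsQuotient ρ = θ (λ ρ → ρ va) (λ ρ → ρ vb) ρ * ((1ℚ + Q + Q * Q) * closedY (ρ vq) (ρ va) (2 ℕ.+ 3 ℕ.* m))
    + θ (λ ρ → ρ vb) (λ ρ → ρ va) ρ * closedA (ρ vq) (ρ vb ^ 3) h
    where Q = ρ vq ^ n

  Reg-lhsQuotient : Reg lhsQuotient
  Reg-lhsQuotient = Reg-/
    (Reg-sum n λ i _ → Reg-* (proj₁ (proj₂ (kappa i))) (Reg-* (Reg-v i) (Reg-prod n λ j → Reg-skip i j (Reg-E Reg-a (Reg-u m j)))))
    (Unit-prod m (2 ℕ.* h) λ j → Unit-Ea {λ ρ → Qp⁴ m ρ * (Qs m ρ ^ j * Qs m ρ ^ j)} (EvenFun-pole j))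

  Reg-rhsQuotient : Reg rhsQuotient
  Reg-rhsQuotient = Reg-+
    (Reg-* Reg-θab (Reg-* (Reg-+ (Reg-+ (Reg-const 1ℚ) rQ) (Reg-* rQ rQ)) (Reg-w (2 ℕ.+ 3 ℕ.* m))))
    (Reg-* Reg-θba (Reg-v h))
    where
    rQ : Reg (λ ρ → ρ vq ^ n)
    rQ = Reg-^ n Reg-q

  module _ (ρ : Env) (ad : Admissible ρ) where
    open Values m ρ ad using (q; u; 1-q≢0; E≢0; even-pl)
    open Evaluation m ρ ad using (lhsValue; rhsValue; interpolated; Q; M; Q³≡; oa; y; a)

    [n] : ℚ
    [n] = evalP ρ qint-n

    [n]≡ : (1ℚ - Q) * inv (1ℚ - q) ≡ [n]
    [n]≡ = /-intro 1-q≢0 (trans (sym (sum-geometric ρ n)) (*-comm (1ℚ - q) [n]))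

    lhs-divisible : lhsValue ≡ [n] * lhsQuotient ρ
    lhs-divisible = *-cancelˡ P≢0 (begin
      P * (inv (1ℚ - q) * partialSum q a y n)
        ≡⟨ l₁ P (inv (1ℚ - q)) (partialSum q a y n) ⟩
      inv (1ℚ - q) * (P * partialSum q a y n)
        ≡⟨ cong (inv (1ℚ - q) *_) (trans interpolated (trans (sum-cong n (λ i i<n → trans (cong (_* rest i) (proj₂ (proj₂ (kappa i)) ρ ad i<n)) (*-assoc (1ℚ - Q) (proj₁ (kappa i) ρ) (rest i))))
             (sum-*ˡ n (1ℚ - Q) (λ i → proj₁ (kappa i) ρ * rest i)))) ⟩
      inv (1ℚ - q) * ((1ℚ - Q) * S)
        ≡⟨ l₂ (inv (1ℚ - q)) (1ℚ - Q) S ⟩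
      (1ℚ - Q) * inv (1ℚ - q) * S
        ≡⟨ cong₂ _*_ [n]≡ (sym (/-* {S} P≢0)) ⟩
      [n] * (S / P * P)
        ≡⟨ l₃ [n] (S / P) P ⟩
      P * ([n] * lhsQuotient ρ) ∎)
      where
      P = prod (2 ℕ.* h) (λ j → E (ρ va) (Qp⁴ m ρ * (Qs m ρ ^ j * Qs m ρ ^ j)))
      P≢0 : P ≢ 0ℚ
      P≢0 = prod-nonzero (2 ℕ.* h) (λ j _ → E≢0 oa (even-pl j))
      rest : ℕ → ℚ
      rest i = closedA q y i * prod n (λ j → skip i j (E (ρ va) (u j)))
      S = sum n (λ i → proj₁ (kappa i) ρ * rest i)
      l₁ : ∀ p i s → p * (i * s) ≡ i * (p * s)
      l₁ = solve-∀ ℚ-ring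
      l₂ : ∀ i q s → i * (q * s) ≡ q * i * s
      l₂ = solve-∀ ℚ-ring
      l₃ : ∀ q s p → q * (s * p) ≡ p * (q * s)
      l₃ = solve-∀ ℚ-ring

    -- The first closed form carries 1 - q^{4M+1} = 1 - q^{3n} = (1 - qⁿ)(1 + qⁿ + q^{2n}), the
    -- second 1 - qⁿ.
    rhs-divisible : rhsValue ≡ [n] * rhsQuotient ρ
    rhs-divisible = begin
      θ₁ * ((1ℚ - q * (Values.Z m ρ ad M * Values.Z m ρ ad M)) * inv (1ℚ - q) * W) + θ₂ * ((1ℚ - Q) * inv (1ℚ - q) * V)
        ≡⟨ cong (λ x → θ₁ * ((1ℚ - x) * inv (1ℚ - q) * W) + θ₂ * ((1ℚ - Q) * inv (1ℚ - q) * V)) Q³≡ ⟨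
      θ₁ * ((1ℚ - Q ^ 3) * inv (1ℚ - q) * W) + θ₂ * ((1ℚ - Q) * inv (1ℚ - q) * V)
        ≡⟨ l₁ θ₁ Q (inv (1ℚ - q)) W θ₂ V ⟩
      (1ℚ - Q) * inv (1ℚ - q) * (θ₁ * ((1ℚ + Q + Q * Q) * W) + θ₂ * V)
        ≡⟨ cong (_* rhsQuotient ρ) [n]≡ ⟩
      [n] * rhsQuotient ρ ∎
      where
      θ₁ = θ (λ ρ → ρ va) (λ ρ → ρ vb) ρ
      θ₂ = θ (λ ρ → ρ vb) (λ ρ → ρ va) ρ
      W = closedY q a M
      V = closedA q y h
      l₁ : ∀ θ₁ Q i W θ₂ V → θ₁ * ((1ℚ - 1ℚ * Q * Q * Q) * i * W) + θ₂ * ((1ℚ - Q) * i * V) ≡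
        (1ℚ - Q) * i * (θ₁ * ((1ℚ + Q + Q * Q) * W) + θ₂ * V)
      l₁ = solve-∀ ℚ-ring

    divisible : lhsValue - rhsValue ≡ [n] * (lhsQuotient ρ - rhsQuotient ρ)
    divisible = trans (cong₂ _-_ lhs-divisible rhs-divisible) (l [n] (lhsQuotient ρ) (rhsQuotient ρ))
      where
      l : ∀ q x y → q * x - q * y ≡ q * (x - y)
      l = solve-∀ ℚ-ring

-- Only the values at admissible points matter; total expressions avoid deciding admissibility.
lhsTotal rhsTotal : ℕ → Env → ℚ
lhsTotal m ρ = inv (1ℚ - ρ vq) * partialSum (ρ vq) (ρ va) (ρ vb ^ 3) (Modulus.n m)
rhsTotal m ρ = θ (λ ρ → ρ va) (λ ρ → ρ vb) ρ * ((1ℚ - ρ vq * (s ^ M * s ^ M)) / (1ℚ - ρ vq) * closedY (ρ vq) (ρ va) M)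
  + θ (λ ρ → ρ vb) (λ ρ → ρ va) ρ * ((1ℚ - ρ vq ^ n) / (1ℚ - ρ vq) * closedA (ρ vq) (ρ vb ^ 3) h)
  where
  open Modulus m
  open Divisibility m using (θ)
  s = ρ vq * ρ vq
  M = 2 ℕ.+ 3 ℕ.* m

congruence-at : ∀ m → let n = Modulus.n m in CongMod (modulus n) (lhs n) (rhsAt n (2 ℕ.+ 3 ℕ.* m) (suc m))
congruence-at m = congruence m (lhs n) (rhsAt n (2 ℕ.+ 3 ℕ.* m) (suc m)) (lhsTotal m) (rhsTotal m) (λ ρ → D.lhsQuotient ρ - D.rhsQuotient ρ)
  (λ ρ ad → _⊢_⇓_.eval (Evaluation.lhs-⇓ m ρ ad)) (λ ρ ad → _⊢_⇓_.eval (Evaluation.rhs-⇓ m ρ ad))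
  (Reg-- m D.Reg-lhsQuotient D.Reg-rhsQuotient) D.divisible (λ ρ ad → Evaluation.boundary-equality m ρ ad)
  where
  open Modulus m
  module D = Divisibility m

theorem3p1 : (n : ℕ) → n % 4 ≡ 3 → CongMod (modulus n) (lhs n) (rhs n)
theorem3p1 n n%4≡3 = subst (λ k → CongMod (modulus k) (lhs k) (rhs k)) (sym n≡)
  (subst (CongMod (modulus N) (lhs N)) (sym (cong₂ (rhsAt N) M≡ K≡)) (congruence-at m))
  where
  open +-*-Solver
  m = n ℕ./ 4
  N = Modulus.n m
  lem : ∀ m → 3 ℕ.+ m ℕ.* 4 ≡ suc (2 ℕ.* suc (2 ℕ.* m))
  lem = solve 1 (λ m → con 3 :+ m :* con 4 := con 1 :+ con 2 :* (con 1 :+ con 2 :* m)) refl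
  n≡ : n ≡ N
  n≡ = trans (m≡m%n+[m/n]*n n 4) (trans (cong (ℕ._+ m ℕ.* 4) n%4≡3) (lem m))
  -- For n = 4m + 3 both divisions are exact: 3n - 1 = 4(3m + 2) and n + 1 = 4(m + 1).
  M≡ : (3 ℕ.* N ℕ.∸ 1) ℕ./ 4 ≡ 2 ℕ.+ 3 ℕ.* m
  M≡ = trans (cong (λ k → (k ℕ.∸ 1) ℕ./ 4) (lem′ m)) (m*n/n≡m (2 ℕ.+ 3 ℕ.* m) 4)
    where
    lem′ : ∀ m → 3 ℕ.* suc (2 ℕ.* suc (2 ℕ.* m)) ≡ suc ((2 ℕ.+ 3 ℕ.* m) ℕ.* 4)
    lem′ = solve 1 (λ m → con 3 :* (con 1 :+ con 2 :* (con 1 :+ con 2 :* m)) := con 1 :+ (con 2 :+ con 3 :* m) :* con 4) refl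
  K≡ : (N ℕ.+ 1) ℕ./ 4 ≡ suc m
  K≡ = trans (cong (ℕ._/ 4) (lem″ m)) (m*n/n≡m (suc m) 4)
    where
    lem″ : ∀ m → suc (2 ℕ.* suc (2 ℕ.* m)) ℕ.+ 1 ≡ suc m ℕ.* 4
    lem″ = solve 1 (λ m → con 1 :+ con 2 :* (con 1 :+ con 2 :* m) :+ con 1 := (con 1 :+ m) :* con 4) refl
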